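{- Fix a positive integer $n$. For each $k\in\mathbb{N}^+$ let $0\le r_{k_1}\le r_{k_2}\le\cdots\le r_{k_n}\le1$ be real numbers, and let $h_{n,k}(x)$ be the polynomial defined by $$\sum_{m\ge0}\prod_{i=1}^n(m+r_{k_i})\,x^m=\frac{h_{n,k}(x)}{(1-x)^{n+1}}.$$ Let $p\in\mathbb{R}[x]$ have the expression $p=\sum_{k\ge1}c_kh_{n,k}(x)$ with all $c_k\ge0$ (finitely many nonzero), and let $(a,b)$ be the $\mathcal{I}_n$-decomposition of $p$. If $0\le r_{k_i}+r_{\ell_{n-i+1}}\le1$ for all $k,\ell\in\mathbb{N}^+$ and all $1\le i\le n$, then $\mathcal{I}_n(p)\ll p$ for $\deg(p)=n$. In particular, $b\ll a$ and $p$ is alternatingly increasing.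
   Context: For $p$ of degree at most $n$, $\mathcal{I}_n(p)(x)=x^np(1/x)$. The $\mathcal{I}_n$-decomposition of $p$ is the unique pair $(a,b)$ of polynomials with $p=a+xb$, $\mathcal{I}_n(a)=a$ and $\mathcal{I}_{n-1}(b)=b$. For real-rooted real polynomials $f,g$ with zeros $\{r_i\}$, $\{s_j\}$ in decreasing order, $g\preceq f$ means either $\deg f=\deg g+1=d$ and $r_d\le s_{d-1}\le\cdots\le s_1\le r_1$, or $\deg f=\deg g=d$ and $s_d\le r_d\le\cdots\le s_1\le r_1$; $g\ll f$ means $g\preceq f$ with leading coefficients of the same sign, or $f\preceq g$ with leading coefficients of opposite sign; by convention $0\ll f$ and $f\ll 0$ for real-rooted $f$. A polynomial $p=\sum_{k=0}^np_kx^k$ of degree $n$ is alternatingly increasing if $0\le p_0\le p_n\le p_1\le p_{n-1}\le\cdots\le p_{\lfloor(n+1)/2\rfloor}$. -}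

module Defs where

open import Level using (0ℓ; suc)
open import Algebra.Bundles using (CommutativeRing)
import Algebra.Definitions.RawMonoid as RawMonoidDefs
open import Data.Bool.Base using (if_then_else_)
open import Data.Fin.Base as Fin using (Fin; toℕ)
open import Data.List.Base using (List; []; _∷_; length; foldr)
open import Data.List.Relation.Unary.Linked using (Linked)
open import Data.Nat.Base as ℕ using (ℕ; _∸_; _≤ᵇ_)
open import Data.Product.Base using (∃; ∃₂; _×_)
open import Data.Sum.Base using (_⊎_)
open import Function.Base using (flip)
open import Relation.Binary.Core using (Rel)
open import Relation.Binary.PropositionalEquality.Core using (_≡_)
open import Relation.Binary.Structures using (IsDecTotalOrder)
import Relation.Binary.Construct.NonStrictToStrict as ToStrict
open import Relation.Unary using (Pred; Satisfiable)

-- The real numbers, given by their axioms: a Dedekind-complete ordered field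
-- (unique up to isomorphism).  These are the classical reals, so equality and
-- order are decidable; with excluded middle the Cauchy reals are an instance.
record CompleteOrderedField : Set (suc 0ℓ) where
  field
    commutativeRing : CommutativeRing 0ℓ 0ℓ

  open CommutativeRing commutativeRing public

  infix 4 _≤_

  field
    0≉1             : 0# ≉ 1#
    inverse         : ∀ x → x ≉ 0# → ∃ λ y → x * y ≈ 1#
    _≤_             : Rel Carrier 0ℓ
    isDecTotalOrder : IsDecTotalOrder _≈_ _≤_
    +-monoʳ-≤       : ∀ {x y} z → x ≤ y → x + z ≤ y + z
    *-nonNeg        : ∀ {x y} → 0# ≤ x → 0# ≤ y → 0# ≤ x * y

  UpperBound : Pred Carrier 0ℓ → Pred Carrier 0ℓ
  UpperBound P u = ∀ x → P x → x ≤ u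

  field
    complete : (P : Pred Carrier 0ℓ) → Satisfiable P → Satisfiable (UpperBound P) →
               ∃ λ s → UpperBound P s × (∀ u → UpperBound P u → s ≤ u)

  open ToStrict _≈_ _≤_ public using (_<_)

module Polynomials (ℝ : CompleteOrderedField) where

  open CompleteOrderedField ℝ
  open RawMonoidDefs +-rawMonoid public using () renaming (sum to ∑; _×_ to _·_)
  open RawMonoidDefs *-rawMonoid public using () renaming (sum to ∏)

  -- ℝ[[x]] as coefficient sequences; ℝ[x] is the subset of those that are
  -- eventually zero.
  Series : Set
  Series = ℕ → Carrier

  infix  4 _≋_
  infixl 6 _⊕_
  infixl 7 _⊛_
  infixr 8 _^_

  _≋_ : Rel Series 0ℓ
  f ≋ g = ∀ j → f j ≈ g j

  IsPolynomial : Pred Series 0ℓ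
  IsPolynomial f = ∃ λ d → ∀ j → d ℕ.≤ j → f j ≈ 0#

  Degree : Series → ℕ → Set
  Degree f d = f d ≉ 0# × (∀ j → d ℕ.< j → f j ≈ 0#)

  constant : Carrier → Series
  constant c ℕ.zero    = c
  constant c (ℕ.suc _) = 0#

  -- linear c₀ c₁ = c₀ + c₁ x
  linear : Carrier → Carrier → Series
  linear c₀ c₁ 0                 = c₀
  linear c₀ c₁ 1                 = c₁
  linear c₀ c₁ (ℕ.suc (ℕ.suc _)) = 0#

  _⊕_ : Series → Series → Series
  (f ⊕ g) j = f j + g j

  _⊛_ : Series → Series → Series
  (f ⊛ g) j = ∑ {ℕ.suc j} λ i → f (toℕ i) * g (j ∸ toℕ i)

  _^_ : Series → ℕ → Series
  f ^ ℕ.zero  = constant 1#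
  f ^ ℕ.suc k = f ⊛ (f ^ k)

  X : Series
  X = linear 0# 1#

  -- h is the polynomial with  ∑_{m≥0} ∏ᵢ (m + rᵢ) xᵐ = h / (1 - x)ⁿ⁺¹;
  -- 1 - x is invertible in ℝ[[x]], so h is unique.
  IsNumerator : ∀ {n} → (Fin n → Carrier) → Series → Set
  IsNumerator {n} r h =
    IsPolynomial h ×
    linear 1# (- 1#) ^ (ℕ.suc n) ⊛ (λ m → ∏ λ i → m · 1# + r i) ≋ h

  -- xⁿ p(1/x) for deg p ≤ n.  Coefficients of p beyond n are dropped, so
  -- 𝓘 n p ≋ p entails deg p ≤ n.
  𝓘 : ℕ → Series → Series
  𝓘 n p j = if j ≤ᵇ n then p (n ∸ j) else 0#

  record Is𝓘-Decomposition (n : ℕ) (p a b : Series) : Set where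
    field
      a-polynomial : IsPolynomial a
      b-polynomial : IsPolynomial b
      p≋a+xb       : p ≋ a ⊕ X ⊛ b
      a-symmetric  : 𝓘 n a ≋ a
      b-symmetric  : 𝓘 (ℕ.pred n) b ≋ b

  -- f is nonzero, and rs lists all its zeros with multiplicity.
  HasZeros : Series → List Carrier → Set
  HasZeros f rs = ∃ λ c → c ≉ 0# ×
    f ≋ constant c ⊛ foldr (λ r q → linear (- r) 1# ⊛ q) (constant 1#) rs

  RealRooted : Pred Series 0ℓ
  RealRooted f = ∃ (HasZeros f)

  -- zigzag (r₁ ∷ r₂ ∷ …) (s₁ ∷ s₂ ∷ …) = r₁ ∷ s₁ ∷ r₂ ∷ s₂ ∷ …
  zigzag : List Carrier → List Carrier → List Carrier
  zigzag []       ys = ys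
  zigzag (x ∷ xs) ys = x ∷ zigzag ys xs

  infix 4 _⪯_ _≪_

  -- The two length cases are the degree cases deg f = deg g + 1 and
  -- deg f = deg g; the chain r₁ ≥ s₁ ≥ r₂ ≥ … already makes both lists of
  -- zeros decreasing.
  _⪯_ : Rel Series 0ℓ
  g ⪯ f = ∃₂ λ rs ss →
    HasZeros f rs × HasZeros g ss ×
    (length rs ≡ ℕ.suc (length ss) ⊎ length rs ≡ length ss) ×
    Linked (flip _≤_) (zigzag rs ss)

  SameSign OppositeSign : Rel Series 0ℓ
  SameSign     f g = ∃₂ λ d e → Degree f d × Degree g e × 0# < f d * g e
  OppositeSign f g = ∃₂ λ d e → Degree f d × Degree g e × f d * g e < 0#

  data _≪_ (g f : Series) : Set where
    0≪ : g ≋ constant 0# → RealRooted f → g ≪ f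
    ≪0 : RealRooted g → f ≋ constant 0# → g ≪ f
    ≪⁺ : g ⪯ f → SameSign g f → g ≪ f
    ≪⁻ : f ⪯ g → OppositeSign g f → g ≪ f

  -- 0 ≤ p₀ ≤ pₙ ≤ p₁ ≤ pₙ₋₁ ≤ ⋯ ≤ p_⌊(n+1)/2⌋, the chain running through each
  -- of the n + 1 coefficients once.
  record AlternatinglyIncreasing (n : ℕ) (p : Series) : Set where
    field
      degree : Degree p n
      0≤p₀   : 0# ≤ p 0
      pᵢ≤pₙ₋ᵢ   : ∀ i → i ℕ.+ i ℕ.< n → p i ≤ p (n ∸ i)
      pₙ₋ᵢ≤pᵢ₊₁ : ∀ i → ℕ.suc (i ℕ.+ i) ℕ.< n → p (n ∸ i) ≤ p (ℕ.suc i)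

-- Let g(n,j) be the numerator of ∑ₘ (m+1)ʲ mⁿ⁻ʲ xᵐ over (1-x)ⁿ⁺¹, j ≤ n.  Then
-- g(n+1,j) = ∑_{k<j} g(n,k) + x ∑_{k≥j} g(n,k), and writing
-- m + r = r (m+1) + (1-r) m gives h_r = ∑ⱼ eⱼ(r) g(n,j), where eⱼ(r) are the
-- coefficients of ∏ (rᵢ t + 1 - rᵢ).
--
-- The recursion shows, pointwise on the whole real line, that the Wronskians
-- W(f,g) = f′g - fg′ satisfy W(g(n,i), g(n,j)) ≥ 0 and W(x g(n,j), g(n,i)) ≥ 0
-- for i ≤ j.  If rᵢ + sᵢ ≤ 1, the sequences e(r) and the reversal of e(s) are in
-- likelihood ratio order; this is bilinear, so it passes to the cone generated
-- by the h's.  As 𝓘 n reverses the order of the g(n,j), W(p, 𝓘 n p) is a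
-- combination of the W(g(n,i), g(n,j)), i < j, with nonnegative coefficients.
--
-- The rest is sign counting with the intermediate value theorem.  Comparison
-- with T = g(n,n), whose zeros interlace those of its predecessor, shows that p
-- has n simple zeros, and then 𝓘 n p alternates in sign at the zeros of p.  With
-- p = a + xb we have 𝓘 n p = a + b, hence (1-x) b = 𝓘 n p at the zeros of p and
-- a = p at the zeros of b, which locates the zeros of b and then those of a.  A
-- symmetric polynomial with nonpositive zeros only is log-concave, hence
-- unimodal, and unimodality of a and b says that p is alternatingly increasing.
--
-- Strictness fails in two cases only, treated separately: p = 𝓘 n p (b = 0), and
-- p = x 𝓘 n p (a = 0).
module Submission where

open import Defs
import Algebra.Properties.CommutativeMonoid.Sum as Sum
import Algebra.Properties.Ring as RingProperties
import Algebra.Properties.Semiring.Mult.TCOptimised as Mult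
import Algebra.Properties.Semiring.Sum as SemiringSum
import Algebra.Solver.Ring as RingSolver
open import Algebra.Solver.Ring.AlmostCommutativeRing
  using (fromCommutativeRing; _-Raw-AlmostCommutative⟶_)
open import Data.Bool.Base as Bool using (true; false)
open import Data.Empty using (⊥)
open import Data.Fin.Base as Fin using (Fin; toℕ; opposite)
import Data.Fin.Permutation as Permutation
import Data.Fin.Properties as Fin
open import Data.Integer.Base as ℤ using (ℤ; +_; -[1+_])
import Data.Integer.Properties as ℤ
open import Data.List.Base using (List; []; _∷_; length; foldr)
open import Data.List.Relation.Unary.All as All using (All; []; _∷_)
open import Data.List.Relation.Unary.AllPairs as AllPairs using (AllPairs; []; _∷_)
open import Data.List.Relation.Unary.Linked as Linked using (Linked; []; [-]; _∷_)
open import Data.List.Relation.Unary.Linked.Properties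
  using (Linked⇒All; Linked⇒AllPairs; AllPairs⇒Linked)
open import Data.Maybe.Base using (Maybe; just; nothing)
open import Data.Nat.Base as ℕ using (ℕ; NonZero; s≤s; s<s; z≤n; z<s)
import Data.Nat.Properties as ℕ
open import Data.Product.Base using (∃; ∃₂; _,_; proj₁; proj₂; _×_)
open import Data.Sum.Base using (_⊎_; inj₁; inj₂)
open import Function.Base using (_∘_; flip)
import Relation.Binary.Construct.NonStrictToStrict as ToStrict
open import Relation.Binary.PropositionalEquality.Core as ≡ using (_≡_)
import Relation.Binary.Reasoning.Setoid as SetoidReasoning
open import Relation.Binary.Structures using (IsDecTotalOrder)
open import Relation.Nullary.Decidable.Core using (yes; no)
open import Relation.Nullary.Negation.Core using (¬_; contradiction)

-- Nonnegative Wronskians alone give weak alternation only and do not exclude multiple or common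
-- zeros. Strictness comes from one remembered square: for n ≥ 1, g(n,0) = x T with T = g(n,n), so
-- W(g(n,0), T) = T² exactly. This square bounds from below the Wronskians of g(n+1,j), 0 < j ≤ n,
-- with the top polynomial of level n + 1. Hence consecutive polynomials T have no common zero, by
-- descent to the constant 1, and the bound is positive at the points where it is applied. The
-- inequality for x g(n,j) is carried along because the recursion multiplies only the upper part of
-- a level by x, so mixed terms enter the Wronskians of the next level. Wronskians are bilinear
-- forms in values and derivatives at one real point; each inductive step is then a ring identity
-- between real numbers. The hypothesis pairs the i-th entry of one tuple with the i-th entry from
-- the end of another, while the induction on the number of factors pairs equal positions. Therefore
-- p is expanded twice, by the tuples and by their reversals. Whether p(0) vanishes decides the
-- degrees of 𝓘 n p and a, hence how many sign changes locate all zeros; this causes the repeated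
-- case distinctions.

-- Ring normalisation with integer coefficients

module IntegerSolver (ℝ : CompleteOrderedField) where
  open CompleteOrderedField ℝ
  open RingProperties ring
  open Mult semiring using (1+×; ×-homo-+; ×1-homo-*) renaming (_×_ to _·_)
  open SetoidReasoning setoid

  -- Coefficients are taken in ℤ, where equality computes, as it does not in the abstract field. The
  -- optimised multiple reduces `1 · 1#` to `1#`, so `con (+ 1)` denotes `1#` on the nose.
  fromℤ : ℤ → Carrier
  fromℤ (+ n)    = n · 1#
  fromℤ -[1+ n ] = - (ℕ.suc n · 1#)

  private
    cancel-1# : ∀ a b → (1# + a) - (1# + b) ≈ a - b
    cancel-1# a b = begin
      (1# + a) - (1# + b)       ≈⟨ +-congˡ (sym (-‿+-comm 1# b)) ⟩
      (1# + a) + (- 1# - b)     ≈⟨ +-congʳ (+-comm 1# a) ⟩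
      (a + 1#) + (- 1# - b)     ≈⟨ +-assoc a 1# _ ⟩
      a + (1# + (- 1# - b))     ≈⟨ +-congˡ (sym (+-assoc 1# (- 1#) (- b))) ⟩
      a + ((1# - 1#) - b)       ≈⟨ +-congˡ (+-congʳ (-‿inverseʳ 1#)) ⟩
      a + (0# - b)              ≈⟨ +-congˡ (+-identityˡ _) ⟩
      a - b                     ∎

  fromℤ-⊖ : ∀ m n → fromℤ (m ℤ.⊖ n) ≈ m · 1# - n · 1#
  fromℤ-⊖ m ℕ.zero = begin
    m · 1#            ≈⟨ sym (+-identityʳ _) ⟩
    m · 1# + 0#       ≈⟨ +-congˡ (sym -0#≈0#) ⟩
    m · 1# - 0#       ∎
  fromℤ-⊖ ℕ.zero (ℕ.suc n) = sym (+-identityˡ _)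
  fromℤ-⊖ (ℕ.suc m) (ℕ.suc n) = begin
    fromℤ (ℕ.suc m ℤ.⊖ ℕ.suc n)          ≡⟨ ≡.cong fromℤ (ℤ.[1+m]⊖[1+n]≡m⊖n m n) ⟩
    fromℤ (m ℤ.⊖ n)                      ≈⟨ fromℤ-⊖ m n ⟩
    m · 1# - n · 1#                      ≈⟨ sym (cancel-1# _ _) ⟩
    (1# + m · 1#) - (1# + n · 1#)        ≈⟨ +-cong (sym (1+× m 1#)) (-‿cong (sym (1+× n 1#))) ⟩
    ℕ.suc m · 1# - ℕ.suc n · 1#          ∎

  fromℤ-neg : ∀ i → fromℤ (ℤ.- i) ≈ - fromℤ i
  fromℤ-neg (+ ℕ.zero)    = sym -0#≈0#
  fromℤ-neg (+ (ℕ.suc n)) = refl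
  fromℤ-neg -[1+ n ]      = sym (-‿involutive _)

  fromℤ-+ : ∀ i j → fromℤ (i ℤ.+ j) ≈ fromℤ i + fromℤ j
  fromℤ-+ (+ m)    (+ n)    = ×-homo-+ 1# m n
  fromℤ-+ (+ m)    -[1+ n ] = fromℤ-⊖ m (ℕ.suc n)
  fromℤ-+ -[1+ m ] (+ n)    = trans (fromℤ-⊖ n (ℕ.suc m)) (+-comm _ _)
  fromℤ-+ -[1+ m ] -[1+ n ] = begin
    - (ℕ.suc (ℕ.suc (m ℕ.+ n)) · 1#)     ≡⟨ ≡.cong (λ k → - (ℕ.suc k · 1#)) (≡.sym (ℕ.+-suc m n)) ⟩
    - ((ℕ.suc m ℕ.+ ℕ.suc n) · 1#)       ≈⟨ -‿cong (×-homo-+ 1# (ℕ.suc m) (ℕ.suc n)) ⟩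
    - (ℕ.suc m · 1# + ℕ.suc n · 1#)      ≈⟨ sym (-‿+-comm _ _) ⟩
    - (ℕ.suc m · 1#) - ℕ.suc n · 1#      ∎

  private
    fromℤ-*⁺ : ∀ m j → fromℤ (+ m ℤ.* j) ≈ m · 1# * fromℤ j
    fromℤ-*⁺ m (+ n) = begin
      fromℤ (+ m ℤ.* + n)  ≡⟨ ≡.cong fromℤ (≡.sym (ℤ.pos-* m n)) ⟩
      (m ℕ.* n) · 1#       ≈⟨ ×1-homo-* m n ⟩
      m · 1# * (n · 1#)    ∎
    fromℤ-*⁺ m -[1+ n ] = begin
      fromℤ (+ m ℤ.* ℤ.- (+ (ℕ.suc n)))   ≡⟨ ≡.cong fromℤ (≡.sym (ℤ.neg-distribʳ-* (+ m) (+ (ℕ.suc n)))) ⟩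
      fromℤ (ℤ.- (+ m ℤ.* + (ℕ.suc n)))   ≈⟨ fromℤ-neg (+ m ℤ.* + (ℕ.suc n)) ⟩
      - fromℤ (+ m ℤ.* + (ℕ.suc n))       ≈⟨ -‿cong (fromℤ-*⁺ m (+ (ℕ.suc n))) ⟩
      - (m · 1# * (ℕ.suc n · 1#))         ≈⟨ -‿distribʳ-* _ _ ⟩
      m · 1# * - (ℕ.suc n · 1#)           ∎

  fromℤ-* : ∀ i j → fromℤ (i ℤ.* j) ≈ fromℤ i * fromℤ j
  fromℤ-* (+ m)    j = fromℤ-*⁺ m j
  fromℤ-* -[1+ m ] j = begin
    fromℤ (ℤ.- (+ (ℕ.suc m)) ℤ.* j)    ≡⟨ ≡.cong fromℤ (≡.sym (ℤ.neg-distribˡ-* (+ (ℕ.suc m)) j)) ⟩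
    fromℤ (ℤ.- (+ (ℕ.suc m) ℤ.* j))    ≈⟨ fromℤ-neg (+ (ℕ.suc m) ℤ.* j) ⟩
    - fromℤ (+ (ℕ.suc m) ℤ.* j)        ≈⟨ -‿cong (fromℤ-*⁺ (ℕ.suc m) j) ⟩
    - (ℕ.suc m · 1# * fromℤ j)         ≈⟨ -‿distribˡ-* _ _ ⟩
    - (ℕ.suc m · 1#) * fromℤ j         ∎

  morphism : ℤ.+-*-rawRing -Raw-AlmostCommutative⟶ fromCommutativeRing commutativeRing
  morphism = record
    { ⟦_⟧    = fromℤ
    ; +-homo = fromℤ-+
    ; *-homo = fromℤ-*
    ; -‿homo = fromℤ-neg
    ; 0-homo = refl
    ; 1-homo = refl
    }

  private
    weaklyDecidable : ∀ i j → Maybe (fromℤ i ≈ fromℤ j)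
    weaklyDecidable i j with i ℤ.≟ j
    ... | yes ≡.refl = just refl
    ... | no  _      = nothing

  open RingSolver ℤ.+-*-rawRing (fromCommutativeRing commutativeRing) morphism weaklyDecidable public
    using (solve; _:=_; _:+_; _:*_; _:-_; :-_; con)

-- Arithmetic of ordered fields

module OrderedField (ℝ : CompleteOrderedField) where
  open CompleteOrderedField ℝ
  open IntegerSolver ℝ
  open RingProperties ring

  open IsDecTotalOrder isDecTotalOrder public
    using (antisym; total; _≟_; _≤?_; ≤-respˡ-≈; ≤-respʳ-≈)
    renaming (refl to ≤-refl; trans to ≤-trans; reflexive to ≤-reflexive)
  private
    module Strict = ToStrict _≈_ _≤_

  <-trans : ∀ {x y z} → x < y → y < z → x < z
  <-trans = Strict.<-trans (IsDecTotalOrder.isPartialOrder isDecTotalOrder)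

  <-≤-trans : ∀ {x y z} → x < y → y ≤ z → x < z
  <-≤-trans = Strict.<-≤-trans sym ≤-trans antisym ≤-respʳ-≈

  ≤-<-trans : ∀ {x y z} → x ≤ y → y < z → x < z
  ≤-<-trans = Strict.≤-<-trans ≤-trans antisym ≤-respˡ-≈

  <⇒≱ : ∀ {x y} → x < y → ¬ (y ≤ x)
  <⇒≱ = Strict.<⇒≱ antisym

  ≰⇒> : ∀ {x y} → ¬ (x ≤ y) → y < x
  ≰⇒> = Strict.≰⇒> sym ≤-reflexive total

  <-respʳ-≈ : ∀ {x y z} → y ≈ z → x < y → x < z
  <-respʳ-≈ = Strict.<-respʳ-≈ sym trans ≤-respʳ-≈

  <⊎≈⊎> : ∀ x y → x < y ⊎ x ≈ y ⊎ y < x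
  <⊎≈⊎> x y with x ≟ y | total x y
  ... | yes x≈y | _        = inj₂ (inj₁ x≈y)
  ... | no  x≉y | inj₁ x≤y = inj₁ (x≤y , x≉y)
  ... | no  x≉y | inj₂ y≤x = inj₂ (inj₂ (y≤x , x≉y ∘ sym))

  x≤y⇒0≤y-x : ∀ {x y} → x ≤ y → 0# ≤ y - x
  x≤y⇒0≤y-x {x} x≤y = ≤-respˡ-≈ (-‿inverseʳ x) (+-monoʳ-≤ (- x) x≤y)

  0≤y-x⇒x≤y : ∀ {x y} → 0# ≤ y - x → x ≤ y
  0≤y-x⇒x≤y {x} {y} 0≤y-x =
    ≤-respˡ-≈ (+-identityˡ x)
      (≤-respʳ-≈ (solve 2 (λ x y → (y :- x) :+ x := y) refl x y) (+-monoʳ-≤ x 0≤y-x))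

  x≈y⇒y-x≈0 : ∀ {x y} → x ≈ y → y - x ≈ 0#
  x≈y⇒y-x≈0 {x} x≈y = trans (+-congʳ (sym x≈y)) (-‿inverseʳ x)

  y-x≈0⇒x≈y : ∀ {x y} → y - x ≈ 0# → x ≈ y
  y-x≈0⇒x≈y {x} {y} y-x≈0 = trans (sym (trans (+-congʳ y-x≈0) (+-identityˡ x)))
    (solve 2 (λ x y → (y :- x) :+ x := y) refl x y)

  x<y⇒0<y-x : ∀ {x y} → x < y → 0# < y - x
  x<y⇒0<y-x (x≤y , x≉y) = x≤y⇒0≤y-x x≤y , x≉y ∘ y-x≈0⇒x≈y ∘ sym

  0<y-x⇒x<y : ∀ {x y} → 0# < y - x → x < y
  0<y-x⇒x<y (0≤y-x , 0≉y-x) = 0≤y-x⇒x≤y 0≤y-x , 0≉y-x ∘ sym ∘ x≈y⇒y-x≈0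

  -- The usual shape of an inequality proof below: a ring identity rewrites the difference as a sum
  -- of terms whose signs are known.
  ≤-by-difference : ∀ {x y d} → y - x ≈ d → 0# ≤ d → x ≤ y
  ≤-by-difference y-x≈d 0≤d = 0≤y-x⇒x≤y (≤-respʳ-≈ (sym y-x≈d) 0≤d)

  <-by-difference : ∀ {x y d} → y - x ≈ d → 0# < d → x < y
  <-by-difference y-x≈d 0<d = 0<y-x⇒x<y (<-respʳ-≈ (sym y-x≈d) 0<d)

  +-nonNeg : ∀ {x y} → 0# ≤ x → 0# ≤ y → 0# ≤ x + y
  +-nonNeg {x} {y} 0≤x 0≤y = ≤-trans 0≤y (≤-respˡ-≈ (+-identityˡ y) (+-monoʳ-≤ y 0≤x))

  +-pos-nonNeg : ∀ {x y} → 0# < x → 0# ≤ y → 0# < x + y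
  +-pos-nonNeg {x} {y} 0<x 0≤y =
    <-≤-trans 0<x (≤-by-difference (solve 2 (λ x y → x :+ y :- x := y) refl x y) 0≤y)

  +-nonNeg-pos : ∀ {x y} → 0# ≤ x → 0# < y → 0# < x + y
  +-nonNeg-pos {x} {y} 0≤x 0<y = <-respʳ-≈ (+-comm y x) (+-pos-nonNeg 0<y 0≤x)

  x≤0⇒0≤-x : ∀ {x} → x ≤ 0# → 0# ≤ - x
  x≤0⇒0≤-x {x} x≤0 = ≤-respʳ-≈ (+-identityˡ (- x)) (x≤y⇒0≤y-x x≤0)

  x<0⇒0<-x : ∀ {x} → x < 0# → 0# < - x
  x<0⇒0<-x {x} x<0 = <-respʳ-≈ (+-identityˡ (- x)) (x<y⇒0<y-x x<0)

  0≤-x⇒x≤0 : ∀ {x} → 0# ≤ - x → x ≤ 0#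
  0≤-x⇒x≤0 {x} 0≤-x = ≤-by-difference (+-identityˡ (- x)) 0≤-x

  0<-x⇒x<0 : ∀ {x} → 0# < - x → x < 0#
  0<-x⇒x<0 {x} 0<-x = <-by-difference (+-identityˡ (- x)) 0<-x

  x*x-nonNeg : ∀ x → 0# ≤ x * x
  x*x-nonNeg x with total 0# x
  ... | inj₁ 0≤x = *-nonNeg 0≤x 0≤x
  ... | inj₂ x≤0 = ≤-respʳ-≈ (solve 1 (λ x → :- x :* :- x := x :* x) refl x)
                     (*-nonNeg (x≤0⇒0≤-x x≤0) (x≤0⇒0≤-x x≤0))

  0<1 : 0# < 1#
  0<1 = ≤-respʳ-≈ (*-identityˡ 1#) (x*x-nonNeg 1#) , 0≉1

  xy≈0⇒x≈0⊎y≈0 : ∀ {x y} → x * y ≈ 0# → x ≈ 0# ⊎ y ≈ 0#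
  xy≈0⇒x≈0⊎y≈0 {x} {y} xy≈0 with x ≟ 0#
  ... | yes x≈0 = inj₁ x≈0
  ... | no  x≉0 = let z , xz≈1 = inverse x x≉0 in inj₂ (trans (sym (*-identityˡ y))
    (trans (*-congʳ (sym xz≈1))
      (trans (solve 3 (λ x y z → (x :* z) :* y := z :* (x :* y)) refl x y z)
        (trans (*-congˡ xy≈0) (zeroʳ z)))))

  x*x≈0⇒x≈0 : ∀ {x} → x * x ≈ 0# → x ≈ 0#
  x*x≈0⇒x≈0 xx≈0 with xy≈0⇒x≈0⊎y≈0 xx≈0
  ... | inj₁ x≈0 = x≈0
  ... | inj₂ x≈0 = x≈0

  *-nonZero : ∀ {x y} → x ≉ 0# → y ≉ 0# → x * y ≉ 0#
  *-nonZero x≉0 y≉0 xy≈0 with xy≈0⇒x≈0⊎y≈0 xy≈0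
  ... | inj₁ x≈0 = x≉0 x≈0
  ... | inj₂ y≈0 = y≉0 y≈0

  *-pos : ∀ {x y} → 0# < x → 0# < y → 0# < x * y
  *-pos (0≤x , 0≉x) (0≤y , 0≉y) =
    *-nonNeg 0≤x 0≤y , *-nonZero (0≉x ∘ sym) (0≉y ∘ sym) ∘ sym

  x*x-pos : ∀ {x} → x ≉ 0# → 0# < x * x
  x*x-pos {x} x≉0 = x*x-nonNeg x , *-nonZero x≉0 x≉0 ∘ sym

  *-cancel-pos : ∀ {x y} → 0# < x → 0# < x * y → 0# < y
  *-cancel-pos {x} {y} 0<x 0<xy with <⊎≈⊎> 0# y
  ... | inj₁ 0<y        = 0<y
  ... | inj₂ (inj₁ 0≈y) = contradiction (sym (trans (*-congˡ (sym 0≈y)) (zeroʳ x))) (proj₂ 0<xy)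
  ... | inj₂ (inj₂ y<0) = contradiction
    (0≤-x⇒x≤0 (≤-respʳ-≈ (sym (-‿distribʳ-* x y)) (*-nonNeg (proj₁ 0<x) (x≤0⇒0≤-x (proj₁ y<0)))))
    (<⇒≱ 0<xy)

  *-cancel-nonNeg : ∀ {x y} → 0# < x → 0# ≤ x * y → 0# ≤ y
  *-cancel-nonNeg {x} {y} 0<x 0≤xy with 0# ≤? y
  ... | yes 0≤y = 0≤y
  ... | no  0≰y = contradiction 0≤xy (<⇒≱ (0<-x⇒x<0
    (<-respʳ-≈ (sym (-‿distribʳ-* x y)) (*-pos 0<x (x<0⇒0<-x (≰⇒> 0≰y))))))

  pos-inverse : ∀ {x} → 0# < x → ∃ λ y → 0# < y × x * y ≈ 1#
  pos-inverse {x} 0<x = let y , xy≈1 = inverse x (proj₂ 0<x ∘ sym) in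
    y , *-cancel-pos 0<x (<-respʳ-≈ (sym xy≈1) 0<1) , xy≈1

-- Finite sums over initial segments

module Sums (ℝ : CompleteOrderedField) where
  open CompleteOrderedField ℝ
  open Polynomials ℝ
  open IntegerSolver ℝ
  open OrderedField ℝ
  open SemiringSum semiring using (*-distribˡ-sum)
  open Sum +-commutativeMonoid using (sum-cong-≋; ∑-distrib-+)

  -- Summands are functions on ℕ, so that ranges can be split, shifted and reversed without
  -- coercions between finite types.
  Σ< : ℕ → (ℕ → Carrier) → Carrier
  Σ< m f = ∑ {m} (f ∘ toℕ)

  Σ<-cong : ∀ m {f g} → (∀ t → t ℕ.< m → f t ≈ g t) → Σ< m f ≈ Σ< m g
  Σ<-cong m f≈g = sum-cong-≋ {m} (λ i → f≈g (toℕ i) (Fin.toℕ<n i))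

  Σ<-distrib-+ : ∀ m f g → Σ< m (λ t → f t + g t) ≈ Σ< m f + Σ< m g
  Σ<-distrib-+ m f g = ∑-distrib-+ {m} (f ∘ toℕ) (g ∘ toℕ)

  *-distribˡ-Σ< : ∀ m c f → c * Σ< m f ≈ Σ< m (λ t → c * f t)
  *-distribˡ-Σ< m c f = *-distribˡ-sum {m} c (f ∘ toℕ)

  Σ<-split : ∀ m k f → Σ< (m ℕ.+ k) f ≈ Σ< m f + Σ< k (f ∘ (m ℕ.+_))
  Σ<-split ℕ.zero    k f = sym (+-identityˡ _)
  Σ<-split (ℕ.suc m) k f = trans (+-congˡ (Σ<-split m k (f ∘ ℕ.suc))) (sym (+-assoc _ _ _))

  Σ<-last : ∀ m f → Σ< (ℕ.suc m) f ≈ Σ< m f + f m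
  Σ<-last ℕ.zero    f = trans (+-identityʳ _) (sym (+-identityˡ _))
  Σ<-last (ℕ.suc m) f = trans (+-congˡ (Σ<-last m (f ∘ ℕ.suc))) (sym (+-assoc _ _ _))

  Σ<-zero : ∀ m {f} → (∀ t → t ℕ.< m → f t ≈ 0#) → Σ< m f ≈ 0#
  Σ<-zero ℕ.zero    f≈0 = refl
  Σ<-zero (ℕ.suc m) f≈0 = trans (+-cong (f≈0 0 z<s) (Σ<-zero m (λ t t<m → f≈0 (ℕ.suc t) (s<s t<m))))
    (+-identityˡ 0#)

  Σ<-nonNeg : ∀ m {f} → (∀ t → t ℕ.< m → 0# ≤ f t) → 0# ≤ Σ< m f
  Σ<-nonNeg ℕ.zero    0≤f = ≤-refl
  Σ<-nonNeg (ℕ.suc m) 0≤f = +-nonNeg (0≤f 0 z<s) (Σ<-nonNeg m (λ t t<m → 0≤f (ℕ.suc t) (s<s t<m)))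

  Σ<-≥term : ∀ m {f} → (∀ t → t ℕ.< m → 0# ≤ f t) → ∀ t → t ℕ.< m → f t ≤ Σ< m f
  Σ<-≥term (ℕ.suc m) {f} 0≤f ℕ.zero t<m =
    ≤-by-difference (solve 2 (λ a s → a :+ s :- a := s) refl (f 0) _)
      (Σ<-nonNeg m (λ t t<m → 0≤f (ℕ.suc t) (s<s t<m)))
  Σ<-≥term (ℕ.suc m) {f} 0≤f (ℕ.suc t) (s<s t<m) =
    ≤-trans (Σ<-≥term m (λ t t<m → 0≤f (ℕ.suc t) (s<s t<m)) t t<m)
      (≤-by-difference (solve 2 (λ a s → a :+ s :- s := a) refl (f 0) _) (0≤f 0 z<s))

-- Bilinear pairings of jets

-- A jet (v , d) stands for the value and the derivative of a polynomial at a
-- fixed point x.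
module Jets (ℝ : CompleteOrderedField) where
  open CompleteOrderedField ℝ
  open IntegerSolver ℝ
  open OrderedField ℝ
  open Sums ℝ

  Jet : Set
  Jet = Carrier × Carrier

  infix 4 _≈ᴶ_

  _≈ᴶ_ : Jet → Jet → Set
  (v , d) ≈ᴶ (w , e) = v ≈ w × d ≈ e

  -- The coefficients (0, 1) give the Wronskian of f and g, and (1, -x) the Wronskian of x g and f
  -- at the point x. One family serves both, so linearity over sums is proved once.
  pairing : Carrier → Carrier → Jet → Jet → Carrier
  pairing a b (v , d) (w , e) = a * (v * w) + b * (d * w - v * e)

  pairing-cong : ∀ a b {F F′ G G′} → F ≈ᴶ F′ → G ≈ᴶ G′ → pairing a b F G ≈ pairing a b F′ G′
  pairing-cong a b (v≈ , d≈) (w≈ , e≈) =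
    +-cong (*-congˡ (*-cong v≈ w≈)) (*-congˡ (+-cong (*-cong d≈ w≈) (-‿cong (*-cong v≈ e≈))))

  Σᴶ : ℕ → (ℕ → Jet) → Jet
  Σᴶ m F = Σ< m (proj₁ ∘ F) , Σ< m (proj₂ ∘ F)

  pairing-Σˡ : ∀ a b m F G → pairing a b (Σᴶ m F) G ≈ Σ< m (λ k → pairing a b (F k) G)
  pairing-Σˡ a b ℕ.zero    F (w , e) =
    solve 4 (λ a b w e → a :* (con (+ 0) :* w) :+ b :* (con (+ 0) :* w :- con (+ 0) :* e) :=
      con (+ 0)) refl a b w e
  pairing-Σˡ a b (ℕ.suc m) F G@(w , e) = trans
    (solve 8 (λ a b v v′ d d′ w e →
      a :* ((v :+ v′) :* w) :+ b :* ((d :+ d′) :* w :- (v :+ v′) :* e) :=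
      (a :* (v :* w) :+ b :* (d :* w :- v :* e)) :+ (a :* (v′ :* w) :+ b :* (d′ :* w :- v′ :* e)))
      refl a b (proj₁ (F 0)) (proj₁ S) (proj₂ (F 0)) (proj₂ S) w e)
    (+-congˡ (pairing-Σˡ a b m (F ∘ ℕ.suc) G))
    where S = Σᴶ m (F ∘ ℕ.suc)

  pairing-Σʳ : ∀ a b F m G → pairing a b F (Σᴶ m G) ≈ Σ< m (λ k → pairing a b F (G k))
  pairing-Σʳ a b (v , d) ℕ.zero    G =
    solve 4 (λ a b v d → a :* (v :* con (+ 0)) :+ b :* (d :* con (+ 0) :- v :* con (+ 0)) :=
      con (+ 0)) refl a b v d
  pairing-Σʳ a b F@(v , d) (ℕ.suc m) G = trans
    (solve 8 (λ a b v d w w′ e e′ →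
      a :* (v :* (w :+ w′)) :+ b :* (d :* (w :+ w′) :- v :* (e :+ e′)) :=
      (a :* (v :* w) :+ b :* (d :* w :- v :* e)) :+ (a :* (v :* w′) :+ b :* (d :* w′ :- v :* e′)))
      refl a b v d (proj₁ (G 0)) (proj₁ S) (proj₂ (G 0)) (proj₂ S))
    (+-congˡ (pairing-Σʳ a b F m (G ∘ ℕ.suc)))
    where S = Σᴶ m (G ∘ ℕ.suc)

  module _ (a b : Carrier) (m m′ : ℕ) (F G : ℕ → Jet)
           (0≤FG : ∀ k l → k ℕ.< m → l ℕ.< m′ → 0# ≤ pairing a b (F k) (G l)) where

    private
      0≤ΣFG : ∀ k → k ℕ.< m → 0# ≤ pairing a b (F k) (Σᴶ m′ G)
      0≤ΣFG k k<m = ≤-respʳ-≈ (sym (pairing-Σʳ a b (F k) m′ G)) (Σ<-nonNeg m′ (λ l l<m′ → 0≤FG k l k<m l<m′))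

    pairing-Σ-nonNeg : 0# ≤ pairing a b (Σᴶ m F) (Σᴶ m′ G)
    pairing-Σ-nonNeg = ≤-respʳ-≈ (sym (pairing-Σˡ a b m F (Σᴶ m′ G))) (Σ<-nonNeg m 0≤ΣFG)

    -- Keeping one term of a nonnegative double sum is how a square survives from one level to the
    -- next.
    pairing-Σ-≥term : ∀ k l → k ℕ.< m → l ℕ.< m′ → pairing a b (F k) (G l) ≤ pairing a b (Σᴶ m F) (Σᴶ m′ G)
    pairing-Σ-≥term k l k<m l<m′ = ≤-respʳ-≈ (sym (pairing-Σˡ a b m F (Σᴶ m′ G)))
      (≤-trans
        (≤-respʳ-≈ (sym (pairing-Σʳ a b (F k) m′ G)) (Σ<-≥term m′ (λ l l<m′ → 0≤FG k l k<m l<m′) l l<m′))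
        (Σ<-≥term m 0≤ΣFG k k<m))

-- Positivity of Wronskians at a point

module WronskianPositivity (ℝ : CompleteOrderedField) (x : CompleteOrderedField.Carrier ℝ) where
  open CompleteOrderedField ℝ
  open IntegerSolver ℝ
  open OrderedField ℝ
  open Sums ℝ
  open Jets ℝ

  -- The Wronskian f′ g − f g′.
  W : Jet → Jet → Carrier
  W = pairing 0# 1#

  -- The Wronskian of x g and f.
  Z : Jet → Jet → Carrier
  Z = pairing 1# (- x)

  -- The jet of P + x (T - P): with P the sum of a level below j and T its full sum, this is the
  -- recursion for g(n+1,j), differentiated by the product rule.
  nextJet : (P T : Jet) → Jet
  nextJet (p , p′) (t , t′) = p + x * (t - p) , p′ + ((t - p) + x * (t′ - p′))

  -- The jet of g(n,j) at `x`, generated by the recursion alone; `jet-eulerian` identifies it with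
  -- the actual polynomial.
  level : ℕ → ℕ → Jet
  level ℕ.zero    j = 1# , 0#
  level (ℕ.suc n) j = nextJet (Σᴶ j (level n)) (Σᴶ (ℕ.suc n) (level n))

  top : ℕ → Carrier
  top n = proj₁ (level n n)

  infixl 6 _+ᴶ_
  _+ᴶ_ : Jet → Jet → Jet
  (v , d) +ᴶ (w , e) = v + w , d + e

  private
    nextJet-cong : ∀ {P P′ T T′} → P ≈ᴶ P′ → T ≈ᴶ T′ → nextJet P T ≈ᴶ nextJet P′ T′
    nextJet-cong (p≈ , p′≈) (t≈ , t′≈) =
      +-cong p≈ (*-congˡ (+-cong t≈ (-‿cong p≈))) ,
      +-cong p′≈ (+-cong (+-cong t≈ (-‿cong p≈)) (*-congˡ (+-cong t′≈ (-‿cong p′≈))))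

    Σᴶ-split : ∀ m k F → Σᴶ (m ℕ.+ k) F ≈ᴶ Σᴶ m F +ᴶ Σᴶ k (F ∘ (m ℕ.+_))
    Σᴶ-split m k F = Σ<-split m k (proj₁ ∘ F) , Σ<-split m k (proj₂ ∘ F)

    refl-ᴶ : ∀ {F} → F ≈ᴶ F
    refl-ᴶ = refl , refl

    trans-ᴶ : ∀ {F G H} → F ≈ᴶ G → G ≈ᴶ H → F ≈ᴶ H
    trans-ᴶ (v≈ , d≈) (w≈ , e≈) = trans v≈ w≈ , trans d≈ e≈

  -- P, Q, R are the sums of the level-n polynomials with index below i, from i
  -- to j, and from j on.  Everything on the right-hand side is a bilinear image
  -- of Wronskians of level n, or a square.
  W-next : ∀ P Q R →
    W (nextJet P (P +ᴶ Q +ᴶ R)) (nextJet (P +ᴶ Q) (P +ᴶ Q +ᴶ R)) ≈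
    W P Q + (Z Q R + Z P Q + x * x * W Q R + proj₁ Q * proj₁ Q)
  W-next (p , p′) (q , q′) (r , r′) = solve 7 (λ x p p′ q q′ r r′ →
    let W v d w e = con (+ 0) :* (v :* w) :+ con (+ 1) :* (d :* w :- v :* e)
        Z v d w e = con (+ 1) :* (v :* w) :+ (:- x) :* (d :* w :- v :* e)
        t = p :+ q :+ r ; t′ = p′ :+ q′ :+ r′
        s = p :+ q      ; s′ = p′ :+ q′
    in
    W (p :+ x :* (t :- p)) (p′ :+ ((t :- p) :+ x :* (t′ :- p′)))
      (s :+ x :* (t :- s)) (s′ :+ ((t :- s) :+ x :* (t′ :- s′))) :=
    W p p′ q q′ :+ (Z q q′ r r′ :+ Z p p′ q q′ :+ x :* x :* W q q′ r r′ :+ q :* q))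
    refl x p p′ q q′ r r′

  Z-next : ∀ P Q R →
    Z (nextJet P (P +ᴶ Q +ᴶ R)) (nextJet (P +ᴶ Q) (P +ᴶ Q +ᴶ R)) ≈
    (proj₁ P + x * proj₁ R) * (proj₁ P + x * proj₁ R) + x * x * (W P Q + Z Q R) + Z P Q + x * x * W Q R
  Z-next (p , p′) (q , q′) (r , r′) = solve 7 (λ x p p′ q q′ r r′ →
    let W v d w e = con (+ 0) :* (v :* w) :+ con (+ 1) :* (d :* w :- v :* e)
        Z v d w e = con (+ 1) :* (v :* w) :+ (:- x) :* (d :* w :- v :* e)
        t = p :+ q :+ r ; t′ = p′ :+ q′ :+ r′
        s = p :+ q      ; s′ = p′ :+ q′
    in
    Z (p :+ x :* (t :- p)) (p′ :+ ((t :- p) :+ x :* (t′ :- p′)))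
      (s :+ x :* (t :- s)) (s′ :+ ((t :- s) :+ x :* (t′ :- s′))) :=
    (p :+ x :* r) :* (p :+ x :* r) :+ x :* x :* (W p p′ q q′ :+ Z q q′ r r′) :+ Z p p′ q q′ :+ x :* x :* W q q′ r r′)
    refl x p p′ q q′ r r′

  -- Neither inequality is inductive by itself: `W-next` contains Z-terms and `Z-next` contains
  -- W-terms. In both identities `x` occurs as a coefficient only through `x * x` or inside a
  -- square, so its sign is irrelevant.
  Nonnegative : ℕ → Set
  Nonnegative n = ∀ i j → i ℕ.≤ j → j ℕ.≤ n → 0# ≤ W (level n i) (level n j) × 0# ≤ Z (level n i) (level n j)

  private
    module Step {n : ℕ} (nonneg : Nonnegative n) (i d e : ℕ) (i+d+e≡1+n : i ℕ.+ d ℕ.+ e ≡ ℕ.suc n) where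
      P = Σᴶ i (level n)
      Q = Σᴶ d (level n ∘ (i ℕ.+_))
      R = Σᴶ e (level n ∘ ((i ℕ.+ d) ℕ.+_))

      P+Q : Σᴶ (i ℕ.+ d) (level n) ≈ᴶ P +ᴶ Q
      P+Q = Σᴶ-split i d (level n)

      P+Q+R : Σᴶ (ℕ.suc n) (level n) ≈ᴶ P +ᴶ Q +ᴶ R
      P+Q+R = ≡.subst (λ m → Σᴶ m (level n) ≈ᴶ P +ᴶ Q +ᴶ R) i+d+e≡1+n 
        (trans-ᴶ (Σᴶ-split (i ℕ.+ d) e (level n)) (+-congʳ (proj₁ P+Q) , +-congʳ (proj₂ P+Q)))

      pairing-level : ∀ a b → pairing a b (level (ℕ.suc n) i) (level (ℕ.suc n) (i ℕ.+ d)) ≈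
                              pairing a b (nextJet P (P +ᴶ Q +ᴶ R)) (nextJet (P +ᴶ Q) (P +ᴶ Q +ᴶ R))
      pairing-level a b = pairing-cong a b (nextJet-cong refl-ᴶ P+Q+R) (nextJet-cong P+Q P+Q+R)

      bound : ∀ {k} → k ℕ.< i ℕ.+ d ℕ.+ e → k ℕ.≤ n
      bound {k} k< = ℕ.s≤s⁻¹ (≡.subst (λ m → k ℕ.< m) i+d+e≡1+n k<)

      PQ : ∀ k l → k ℕ.< i → l ℕ.< d → 0# ≤ W (level n k) (level n (i ℕ.+ l)) ×
        0# ≤ Z (level n k) (level n (i ℕ.+ l))
      PQ k l k<i l<d = nonneg k (i ℕ.+ l) (ℕ.<⇒≤ (ℕ.<-≤-trans k<i (ℕ.m≤m+n i l)))
        (bound (ℕ.<-≤-trans (ℕ.+-monoʳ-< i l<d) (ℕ.m≤m+n (i ℕ.+ d) e)))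

      QR : ∀ k l → k ℕ.< d → l ℕ.< e → 0# ≤ W (level n (i ℕ.+ k)) (level n (i ℕ.+ d ℕ.+ l)) ×
                                       0# ≤ Z (level n (i ℕ.+ k)) (level n (i ℕ.+ d ℕ.+ l))
      QR k l k<d l<e = nonneg (i ℕ.+ k) (i ℕ.+ d ℕ.+ l)
        (ℕ.<⇒≤ (ℕ.<-≤-trans (ℕ.+-monoʳ-< i k<d) (ℕ.m≤m+n (i ℕ.+ d) l)))
        (bound (ℕ.+-monoʳ-< (i ℕ.+ d) l<e))

      0≤WPQ : 0# ≤ W P Q
      0≤WPQ = pairing-Σ-nonNeg _ _ i d _ _ (λ k l k< l< → proj₁ (PQ k l k< l<))

      0≤ZPQ : 0# ≤ Z P Q
      0≤ZPQ = pairing-Σ-nonNeg _ _ i d _ _ (λ k l k< l< → proj₂ (PQ k l k< l<))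

      0≤ZQR : 0# ≤ Z Q R
      0≤ZQR = pairing-Σ-nonNeg _ _ d e _ _ (λ k l k< l< → proj₂ (QR k l k< l<))

      0≤xxWQR : 0# ≤ x * x * W Q R
      0≤xxWQR = *-nonNeg (x*x-nonNeg x) (pairing-Σ-nonNeg _ _ d e _ _ (λ k l k< l< → proj₁ (QR k l k< l<)))

      -- Retaining `W P Q`, instead of concluding mere nonnegativity, is what later yields strict
      -- bounds.
      WPQ≤W : W P Q ≤ W (level (ℕ.suc n) i) (level (ℕ.suc n) (i ℕ.+ d))
      WPQ≤W = ≤-by-difference
        (trans (+-congʳ (trans (pairing-level _ _) (W-next P Q R)))
          (solve 2 (λ a b → a :+ b :- a := b) refl _ _))
        (+-nonNeg (+-nonNeg (+-nonNeg 0≤ZQR 0≤ZPQ) 0≤xxWQR) (x*x-nonNeg (proj₁ Q)))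

      0≤Z : 0# ≤ Z (level (ℕ.suc n) i) (level (ℕ.suc n) (i ℕ.+ d))
      0≤Z = ≤-respʳ-≈ (sym (trans (pairing-level _ _) (Z-next P Q R)))
        (+-nonNeg (+-nonNeg (+-nonNeg (x*x-nonNeg _)
          (*-nonNeg (x*x-nonNeg x) (+-nonNeg 0≤WPQ 0≤ZQR))) 0≤ZPQ) 0≤xxWQR)

  nonnegative : ∀ n → Nonnegative n
  nonnegative ℕ.zero    i j i≤j j≤n =
    ≤-reflexive (solve 0 (con (+ 0) :=
      con (+ 0) :* (con (+ 1) :* con (+ 1)) :+ con (+ 1) :* (con (+ 0) :* con (+ 1) :- con (+ 1) :* con (+ 0))) refl) ,
    ≤-respʳ-≈ (solve 1 (λ x → con (+ 1) :=
      con (+ 1) :* (con (+ 1) :* con (+ 1)) :+ :- x :* (con (+ 0) :* con (+ 1) :- con (+ 1) :* con (+ 0))) refl x) (proj₁ 0<1)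
  nonnegative (ℕ.suc n) i j i≤j j≤1+n with ℕ.m≤n⇒∃[o]m+o≡n i≤j | ℕ.m≤n⇒∃[o]m+o≡n j≤1+n
  ... | d , ≡.refl | e , i+d+e≡1+n = ≤-trans 0≤WPQ WPQ≤W , 0≤Z
    where open Step {n} (nonnegative n) i d e i+d+e≡1+n

  -- The recursion with an empty lower part gives x t, with an empty upper part t, and the Wronskian
  -- of x t and t is t².
  W-extreme : ∀ n → W (level (ℕ.suc n) 0) (level (ℕ.suc n) (ℕ.suc n)) ≈ top (ℕ.suc n) * top (ℕ.suc n)
  W-extreme n = solve 3 (λ x t t′ →
    let W v d w e = con (+ 0) :* (v :* w) :+ con (+ 1) :* (d :* w :- v :* e)
        o = con (+ 0)
    in
    W (o :+ x :* (t :- o)) (o :+ ((t :- o) :+ x :* (t′ :- o)))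
      (t :+ x :* (t :- t)) (t′ :+ ((t :- t) :+ x :* (t′ :- t′))) :=
    (t :+ x :* (t :- t)) :* (t :+ x :* (t :- t)))
    refl x (proj₁ T) (proj₂ T)
    where T = Σᴶ (ℕ.suc n) (level n)

  -- Since 0 < j ≤ n, index 0 belongs to the lower sum and index n to the upper one. This pair alone
  -- contributes the square of `W-extreme`.
  W-top-≥ : ∀ n j → 0 ℕ.< j → j ℕ.≤ n → top n * top n ≤ W (level (ℕ.suc n) j) (level (ℕ.suc n) (ℕ.suc n))
  W-top-≥ ℕ.zero ℕ.zero () j≤n
  W-top-≥ n@(ℕ.suc n′) i 0<i i≤n = ≤-respˡ-≈ (W-extreme n′) (≤-trans W0n≤WPQ WPQ≤W′)
    where
    d = n ℕ.∸ i

    i+1+d≡1+n : i ℕ.+ ℕ.suc d ≡ ℕ.suc n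
    i+1+d≡1+n = ≡.trans (ℕ.+-suc i d) (≡.cong ℕ.suc (ℕ.m+[n∸m]≡n i≤n))

    open Step {n} (nonnegative n) i (ℕ.suc d) 0 (≡.trans (ℕ.+-identityʳ _) i+1+d≡1+n)

    W0n≤WPQ : W (level n 0) (level n n) ≤ W P Q
    W0n≤WPQ = ≡.subst (λ k → W (level n 0) (level n k) ≤ W P Q) (ℕ.m+[n∸m]≡n i≤n)
      (pairing-Σ-≥term _ _ i (ℕ.suc d) _ _ (λ k l k< l< → proj₁ (PQ k l k< l<)) 0 d 0<i ℕ.≤-refl)

    WPQ≤W′ : W P Q ≤ W (level (ℕ.suc n) i) (level (ℕ.suc n) (ℕ.suc n))
    WPQ≤W′ = ≡.subst (λ k → W P Q ≤ W (level (ℕ.suc n) i) (level (ℕ.suc n) k)) i+1+d≡1+n WPQ≤W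

  -- The next top is the sum of the whole level. Its summand of index 1 is bounded by `W-top-≥`,
  -- which requires 1 ≤ n; the others contribute nonnegatively.
  W-consecutive-tops-≥ : ∀ n → 0 ℕ.< n →
    top n * top n ≤ W (level (ℕ.suc (ℕ.suc n)) (ℕ.suc (ℕ.suc n))) (level (ℕ.suc n) (ℕ.suc n))
  W-consecutive-tops-≥ n 0<n = ≤-trans (W-top-≥ n 1 z<s 0<n)
    (≤-respʳ-≈ (trans (sym (pairing-Σˡ 0# 1# (ℕ.suc (ℕ.suc n)) (level (ℕ.suc n)) T))
      (pairing-cong 0# 1# (sym top≈₁ , sym top≈₂) (refl , refl)))
      (Σ<-≥term (ℕ.suc (ℕ.suc n))
        (λ k k<2+n → proj₁ (nonnegative (ℕ.suc n) k (ℕ.suc n) (ℕ.s≤s⁻¹ k<2+n) ℕ.≤-refl)) 1 (s<s z<s)))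
    where
    T = level (ℕ.suc n) (ℕ.suc n)
    S = Σᴶ (ℕ.suc (ℕ.suc n)) (level (ℕ.suc n))
    top≈₁ : proj₁ (level (ℕ.suc (ℕ.suc n)) (ℕ.suc (ℕ.suc n))) ≈ proj₁ S
    top≈₁ = solve 2 (λ x s → s :+ x :* (s :- s) := s) refl x (proj₁ S)
    top≈₂ : proj₂ (level (ℕ.suc (ℕ.suc n)) (ℕ.suc (ℕ.suc n))) ≈ proj₂ S
    top≈₂ = solve 3 (λ x s s′ → s′ :+ ((s :- s) :+ x :* (s′ :- s′)) := s′) refl x (proj₁ S) (proj₂ S)

  top-1 : top 1 ≈ 1#
  top-1 = solve 1 (λ x → (con (+ 1) :+ con (+ 0)) :+ x :* ((con (+ 1) :+ con (+ 0)) :- (con (+ 1) :+ con (+ 0))) := con (+ 1)) refl x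

  W-common-zero : ∀ F G → proj₁ F ≈ 0# → proj₁ G ≈ 0# → W F G ≈ 0#
  W-common-zero (v , d) (w , e) v≈0 w≈0 = trans (pairing-cong 0# 1# (v≈0 , refl) (w≈0 , refl))
    (solve 2 (λ d e → con (+ 0) :* (con (+ 0) :* con (+ 0)) :+ con (+ 1) :* (d :* con (+ 0) :- con (+ 0) :* e) := con (+ 0)) refl d e)

  -- Descent: at a common zero the Wronskian vanishes, so the square below it does too, and the zero
  -- is shared by the preceding pair. This ends at `top 1`, which is 1.
  consecutive-tops-nonZero : ∀ n → top (ℕ.suc n) ≈ 0# → top n ≉ 0#
  consecutive-tops-nonZero ℕ.zero            top₁≈0 _ = 0≉1 (trans (sym top₁≈0) top-1)
  consecutive-tops-nonZero (ℕ.suc ℕ.zero)    _ top₁≈0 = 0≉1 (trans (sym top₁≈0) top-1)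
  consecutive-tops-nonZero (ℕ.suc (ℕ.suc n)) top₃≈0 top₂≈0 =
    consecutive-tops-nonZero (ℕ.suc n) top₂≈0 (x*x≈0⇒x≈0 (antisym
      (≤-respʳ-≈ (W-common-zero _ (level (ℕ.suc (ℕ.suc n)) (ℕ.suc (ℕ.suc n))) top₃≈0 top₂≈0)
        (W-consecutive-tops-≥ (ℕ.suc n) z<s))
      (x*x-nonNeg _)))

-- Evaluation, derivatives and synthetic division

module Evaluation (ℝ : CompleteOrderedField) where
  open CompleteOrderedField ℝ
  open Polynomials ℝ
  open IntegerSolver ℝ
  open Sums ℝ

  VanishesAbove : ℕ → Series → Set
  VanishesAbove n f = ∀ j → n ℕ.< j → f j ≈ 0#

  shift : Series → Series
  shift f ℕ.zero    = 0#
  shift f (ℕ.suc j) = f j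

  shift-cong : ∀ {f g} → f ≋ g → shift f ≋ shift g
  shift-cong f≋g ℕ.zero    = refl
  shift-cong f≋g (ℕ.suc j) = f≋g j

  constant-0 : ∀ j → constant 0# j ≈ 0#
  constant-0 ℕ.zero    = refl
  constant-0 (ℕ.suc j) = refl

  constant-⊛ : ∀ c f → constant c ⊛ f ≋ λ j → c * f j
  constant-⊛ c f j = trans (+-congˡ (Σ<-zero j (λ t _ → zeroˡ (f (j ℕ.∸ ℕ.suc t))))) (+-identityʳ _)

  linear-⊛ : ∀ a b f → linear a b ⊛ f ≋ λ j → a * f j + b * shift f j
  linear-⊛ a b f ℕ.zero    = +-congˡ (sym (zeroʳ b))
  linear-⊛ a b f (ℕ.suc j) = +-congˡ
    (trans (+-congˡ (Σ<-zero j (λ t _ → zeroˡ (f (j ℕ.∸ ℕ.suc t))))) (+-identityʳ _))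

  -- The first argument is a bound on the degree; coefficients beyond it are
  -- ignored.
  eval : ℕ → Series → Carrier → Carrier
  eval ℕ.zero    f x = f 0
  eval (ℕ.suc n) f x = f 0 + x * eval n (f ∘ ℕ.suc) x

  derivative : ℕ → Series → Carrier → Carrier
  derivative ℕ.zero    f x = 0#
  derivative (ℕ.suc n) f x = eval n (f ∘ ℕ.suc) x + x * derivative n (f ∘ ℕ.suc) x

  eval-cong : ∀ n {f g} x → f ≋ g → eval n f x ≈ eval n g x
  eval-cong ℕ.zero    x f≋g = f≋g 0
  eval-cong (ℕ.suc n) x f≋g = +-cong (f≋g 0) (*-congˡ (eval-cong n x (f≋g ∘ ℕ.suc)))

  derivative-cong : ∀ n {f g} x → f ≋ g → derivative n f x ≈ derivative n g x
  derivative-cong ℕ.zero    x f≋g = refl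
  derivative-cong (ℕ.suc n) x f≋g =
    +-cong (eval-cong n x (f≋g ∘ ℕ.suc)) (*-congˡ (derivative-cong n x (f≋g ∘ ℕ.suc)))

  eval-respects : ∀ n f {x y} → x ≈ y → eval n f x ≈ eval n f y
  eval-respects ℕ.zero    f x≈y = refl
  eval-respects (ℕ.suc n) f x≈y = +-congˡ (*-cong x≈y (eval-respects n (f ∘ ℕ.suc) x≈y))

  eval-linear : ∀ n a b f g x → eval n (λ j → a * f j + b * g j) x ≈ a * eval n f x + b * eval n g x
  eval-linear ℕ.zero    a b f g x = refl
  eval-linear (ℕ.suc n) a b f g x = trans (+-congˡ (*-congˡ (eval-linear n a b (f ∘ ℕ.suc) (g ∘ ℕ.suc) x)))
    (solve 7 (λ a b x f₀ g₀ f₁ g₁ → (a :* f₀ :+ b :* g₀) :+ x :* (a :* f₁ :+ b :* g₁) :=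
      a :* (f₀ :+ x :* f₁) :+ b :* (g₀ :+ x :* g₁)) refl a b x (f 0) (g 0) _ _)

  eval-⊕ : ∀ n f g x → eval n (f ⊕ g) x ≈ eval n f x + eval n g x
  eval-⊕ n f g x = trans (eval-cong n x (λ j → sym (+-cong (*-identityˡ (f j)) (*-identityˡ (g j)))))
    (trans (eval-linear n 1# 1# f g x) (+-cong (*-identityˡ _) (*-identityˡ _)))

  derivative-linear : ∀ n a b f g x →
    derivative n (λ j → a * f j + b * g j) x ≈ a * derivative n f x + b * derivative n g x
  derivative-linear ℕ.zero    a b f g x = solve 2 (λ a b → con (+ 0) :=
    a :* con (+ 0) :+ b :* con (+ 0)) refl a b
  derivative-linear (ℕ.suc n) a b f g x =
    trans (+-cong (eval-linear n a b (f ∘ ℕ.suc) (g ∘ ℕ.suc) x)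
      (*-congˡ (derivative-linear n a b (f ∘ ℕ.suc) (g ∘ ℕ.suc) x)))
      (solve 7 (λ a b x f₀ g₀ f₁ g₁ → (a :* f₀ :+ b :* g₀) :+ x :* (a :* f₁ :+ b :* g₁) :=
        a :* (f₀ :+ x :* f₁) :+ b :* (g₀ :+ x :* g₁)) refl a b x _ _ _ _)

  eval-suc : ∀ n f x → VanishesAbove n f → eval (ℕ.suc n) f x ≈ eval n f x
  eval-suc ℕ.zero    f x vanish = trans (+-congˡ (trans (*-congˡ (vanish 1 z<s)) (zeroʳ x))) (+-identityʳ _)
  eval-suc (ℕ.suc n) f x vanish = +-congˡ
    (*-congˡ (eval-suc n (f ∘ ℕ.suc) x (λ j n<j → vanish (ℕ.suc j) (s<s n<j))))

  derivative-suc : ∀ n f x → VanishesAbove n f → derivative (ℕ.suc n) f x ≈ derivative n f x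
  derivative-suc ℕ.zero    f x vanish = trans (+-cong (vanish 1 z<s) (zeroʳ x)) (+-identityʳ _)
  derivative-suc (ℕ.suc n) f x vanish = +-cong (eval-suc n (f ∘ ℕ.suc) x vanish′)
    (*-congˡ (derivative-suc n (f ∘ ℕ.suc) x vanish′))
    where
    vanish′ : VanishesAbove n (f ∘ ℕ.suc)
    vanish′ j n<j = vanish (ℕ.suc j) (s<s n<j)

  eval-0 : ∀ n f → eval n f 0# ≈ f 0
  eval-0 ℕ.zero    f = refl
  eval-0 (ℕ.suc n) f = trans (+-congˡ (zeroˡ _)) (+-identityʳ _)

  -- The product (x - r) g, written in the form that `linear-⊛` produces.
  times-root : Carrier → Series → Series
  times-root r g j = - r * g j + 1# * shift g j

  times-root-cong : ∀ r {f g} → f ≋ g → times-root r f ≋ times-root r g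
  times-root-cong r f≋g j = +-cong (*-congˡ (f≋g j)) (*-congˡ (shift-cong f≋g j))

  eval-times-root : ∀ n r g x → VanishesAbove n g → eval (ℕ.suc n) (times-root r g) x ≈ (x - r) * eval n g x
  eval-times-root n r g x vanish = trans (eval-linear (ℕ.suc n) (- r) 1# g (shift g) x)
    (trans (+-congʳ (*-congˡ (eval-suc n g x vanish)))
      (solve 3 (λ r x e → :- r :* e :+ con (+ 1) :* (con (+ 0) :+ x :* e) := (x :- r) :* e) refl r x
        (eval n g x)))

  derivative-times-root : ∀ n r g x → VanishesAbove n g →
    derivative (ℕ.suc n) (times-root r g) x ≈ eval n g x + (x - r) * derivative n g x
  derivative-times-root n r g x vanish = trans (derivative-linear (ℕ.suc n) (- r) 1# g (shift g) x)
    (trans (+-congʳ (*-congˡ (derivative-suc n g x vanish)))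
      (solve 4 (λ r x e d → :- r :* d :+ con (+ 1) :* (e :+ x :* d) := e :+ (x :- r) :* d) refl r x
        (eval n g x) (derivative n g x)))

  -- Synthetic division by x - r: the coefficients are the Horner values at r of the successive
  -- tails of f.
  quotient : ℕ → Series → Carrier → Series
  quotient ℕ.zero    f r j         = 0#
  quotient (ℕ.suc n) f r ℕ.zero    = eval n (f ∘ ℕ.suc) r
  quotient (ℕ.suc n) f r (ℕ.suc j) = quotient n (f ∘ ℕ.suc) r j

  quotient-vanishes : ∀ n f r j → n ℕ.≤ j → quotient n f r j ≈ 0#
  quotient-vanishes ℕ.zero    f r j         _         = refl
  quotient-vanishes (ℕ.suc n) f r (ℕ.suc j) (s≤s n≤j) = quotient-vanishes n (f ∘ ℕ.suc) r j n≤j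

  quotient-leading : ∀ n f r → quotient (ℕ.suc n) f r n ≡ f (ℕ.suc n)
  quotient-leading ℕ.zero    f r = ≡.refl
  quotient-leading (ℕ.suc n) f r = quotient-leading n (f ∘ ℕ.suc) r

  division : ∀ n f r → VanishesAbove n f →
             f ≋ constant (eval n f r) ⊕ times-root r (quotient n f r)
  division ℕ.zero f r vanish ℕ.zero =
    solve 2 (λ f₀ r → f₀ := f₀ :+ (:- r :* con (+ 0) :+ con (+ 1) :* con (+ 0))) refl (f 0) r
  division ℕ.zero f r vanish (ℕ.suc j) = trans (vanish (ℕ.suc j) z<s)
    (solve 1 (λ r → con (+ 0) := con (+ 0) :+ (:- r :* con (+ 0) :+ con (+ 1) :* con (+ 0))) refl r)
  division (ℕ.suc n) f r vanish ℕ.zero =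
    solve 3 (λ f₀ r e → f₀ := (f₀ :+ r :* e) :+ (:- r :* e :+ con (+ 1) :* con (+ 0))) refl (f 0) r _
  division (ℕ.suc n) f r vanish (ℕ.suc ℕ.zero) =
    trans (division n (f ∘ ℕ.suc) r (λ j n<j → vanish (ℕ.suc j) (s<s n<j)) 0)
      (solve 3 (λ r e q → e :+ (:- r :* q :+ con (+ 1) :* con (+ 0)) :=
        con (+ 0) :+ (:- r :* q :+ con (+ 1) :* e)) refl r _ _)
  division (ℕ.suc n) f r vanish (ℕ.suc (ℕ.suc j)) =
    division n (f ∘ ℕ.suc) r (λ j n<j → vanish (ℕ.suc j) (s<s n<j)) (ℕ.suc j)

  factor : ∀ n f r → VanishesAbove n f → eval n f r ≈ 0# → f ≋ times-root r (quotient n f r)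
  factor n f r vanish root j = trans (division n f r vanish j) (trans (+-congʳ (constant≈0 j)) (+-identityˡ _))
    where
    constant≈0 : ∀ j → constant (eval n f r) j ≈ 0#
    constant≈0 ℕ.zero    = root
    constant≈0 (ℕ.suc j) = refl

-- Intermediate value theorem for polynomials

module IntermediateValue (ℝ : CompleteOrderedField) where
  open CompleteOrderedField ℝ
  open Polynomials ℝ
  open IntegerSolver ℝ
  open OrderedField ℝ
  open Evaluation ℝ

  _∈±_ : Carrier → Carrier → Set
  x ∈± k = - k ≤ x × x ≤ k

  private
    0≤k-x : ∀ {x k} → x ∈± k → 0# ≤ k - x
    0≤k-x (_ , hi) = x≤y⇒0≤y-x hi

    0≤k+x : ∀ {x k} → x ∈± k → 0# ≤ k + x
    0≤k+x {x} {k} (lo , _) = ≤-respʳ-≈ (solve 2 (λ x k → x :- :- k := k :+ x) refl x k) (x≤y⇒0≤y-x lo)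

    ∈±-intro : ∀ {x k} → 0# ≤ k - x → 0# ≤ k + x → x ∈± k
    ∈±-intro {x} {k} 0≤k-x 0≤k+x =
      ≤-by-difference (solve 2 (λ x k → x :- :- k := k :+ x) refl x k) 0≤k+x , 0≤y-x⇒x≤y 0≤k-x

    0≤x+x⇒0≤x : ∀ {x} → 0# ≤ x + x → 0# ≤ x
    0≤x+x⇒0≤x {x} 0≤x+x = *-cancel-nonNeg (+-pos-nonNeg 0<1 (proj₁ 0<1))
      (≤-respʳ-≈ (solve 1 (λ x → x :+ x := (con (+ 1) :+ con (+ 1)) :* x) refl x) 0≤x+x)

  ∈±-nonNeg : ∀ {x k} → x ∈± k → 0# ≤ k
  ∈±-nonNeg {x} {k} x∈ = 0≤x+x⇒0≤x (≤-respʳ-≈ (solve 2 (λ x k → (k :- x) :+ (k :+ x) := k :+ k) refl x k)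
    (+-nonNeg (0≤k-x x∈) (0≤k+x x∈)))

  magnitude : ∀ x → ∃ λ k → x ∈± k
  magnitude x with total 0# x
  ... | inj₁ 0≤x = x , ∈±-intro (≤-reflexive (sym (-‿inverseʳ x))) (+-nonNeg 0≤x 0≤x)
  ... | inj₂ x≤0 = - x , ∈±-intro (+-nonNeg (x≤0⇒0≤-x x≤0) (x≤0⇒0≤-x x≤0)) (≤-reflexive (sym (-‿inverseˡ x)))

  ∈±-+ : ∀ {x y k l} → x ∈± k → y ∈± l → (x + y) ∈± (k + l)
  ∈±-+ {x} {y} {k} {l} x∈ y∈ = ∈±-intro
    (≤-respʳ-≈ (solve 4 (λ x y k l → (k :- x) :+ (l :- y) := (k :+ l) :- (x :+ y)) refl x y k l)
      (+-nonNeg (0≤k-x x∈) (0≤k-x y∈)))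
    (≤-respʳ-≈ (solve 4 (λ x y k l → (k :+ x) :+ (l :+ y) := (k :+ l) :+ (x :+ y)) refl x y k l)
      (+-nonNeg (0≤k+x x∈) (0≤k+x y∈)))

  -- Twice kl - xy and twice kl + xy are sums of products of the nonnegative numbers k ± x and l ±
  -- y, so no case distinction on signs arises.
  ∈±-* : ∀ {x y k l} → x ∈± k → y ∈± l → (x * y) ∈± (k * l)
  ∈±-* {x} {y} {k} {l} x∈ y∈ = ∈±-intro
    (0≤x+x⇒0≤x (≤-respʳ-≈ (solve 4 (λ x y k l →
      (k :- x) :* (l :+ y) :+ (k :+ x) :* (l :- y) := (k :* l :- x :* y) :+ (k :* l :- x :* y)) refl x y k l)
      (+-nonNeg (*-nonNeg (0≤k-x x∈) (0≤k+x y∈)) (*-nonNeg (0≤k+x x∈) (0≤k-x y∈)))))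
    (0≤x+x⇒0≤x (≤-respʳ-≈ (solve 4 (λ x y k l →
      (k :- x) :* (l :- y) :+ (k :+ x) :* (l :+ y) := (k :* l :+ x :* y) :+ (k :* l :+ x :* y)) refl x y k l)
      (+-nonNeg (*-nonNeg (0≤k-x x∈) (0≤k-x y∈)) (*-nonNeg (0≤k+x x∈) (0≤k+x y∈)))))

  eval-bounded : ∀ n f R → ∃ λ K → ∀ x → x ∈± R → eval n f x ∈± K
  eval-bounded ℕ.zero    f R = let K , f₀∈ = magnitude (f 0) in K , λ _ _ → f₀∈
  eval-bounded (ℕ.suc n) f R =
    let K , f₀∈ = magnitude (f 0)
        L , f₁∈ = eval-bounded n (f ∘ ℕ.suc) R
    in K + R * L , λ x x∈ → ∈±-+ f₀∈ (∈±-* x∈ (f₁∈ x x∈))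

  -- A Lipschitz bound relative to the point s; it stands in for continuity. For a polynomial the
  -- slope is the quotient by x - s.
  SecantBounded : (Carrier → Carrier) → Set
  SecantBounded F = ∀ u v s → ∃ λ K → 0# < K ×
    (∀ x → u ≤ x → x ≤ v → ∃ λ g → F x ≈ F s + (x - s) * g × g ≤ K × - K ≤ g)

  eval-secantBounded : ∀ n f → VanishesAbove n f → SecantBounded (eval n f)
  eval-secantBounded n f vanish u v s =
    -- `K` may be 0; adding 1 makes the bound invertible.
    K + 1# , +-nonNeg-pos 0≤K 0<1 , λ x u≤x x≤v →
      let lo , hi = bound x (≤-trans -R≤u u≤x , ≤-trans x≤v v≤R)
      in eval n q x , secant x , ≤-trans hi K≤K+1 ,
         ≤-trans (≤-by-difference (solve 1 (λ K → :- K :- :- (K :+ con (+ 1)) := con (+ 1)) refl K)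
           (proj₁ 0<1)) lo
    where
    q = quotient n f s

    k = proj₁ (magnitude u)
    l = proj₁ (magnitude v)
    0≤k = ∈±-nonNeg (proj₂ (magnitude u))
    0≤l = ∈±-nonNeg (proj₂ (magnitude v))
    R = k + l
    K = proj₁ (eval-bounded n q R)
    bound = proj₂ (eval-bounded n q R)

    K≤K+1 : K ≤ K + 1#
    K≤K+1 = ≤-by-difference (solve 1 (λ K → K :+ con (+ 1) :- K := con (+ 1)) refl K) (proj₁ 0<1)

    -R≤u : - R ≤ u
    -R≤u = ≤-trans (≤-by-difference (solve 2 (λ k l → :- k :- :- (k :+ l) := l) refl k l) 0≤l)
      (proj₁ (proj₂ (magnitude u)))

    v≤R : v ≤ R
    v≤R = ≤-trans (proj₂ (proj₂ (magnitude v)))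
      (≤-by-difference (solve 2 (λ k l → k :+ l :- l := k) refl k l) 0≤k)

    0≤K : 0# ≤ K
    0≤K = ∈±-nonNeg (bound R (≤-by-difference (solve 1 (λ r → r :- :- r := r :+ r) refl R)
      (+-nonNeg (+-nonNeg 0≤k 0≤l) (+-nonNeg 0≤k 0≤l)) , ≤-refl))

    eval-division : ∀ n c g x → eval n (constant c ⊕ g) x ≈ c + eval n g x
    eval-division ℕ.zero    c g x = refl
    eval-division (ℕ.suc n) c g x = trans (+-assoc c _ _)
      (+-congˡ (+-congˡ (*-congˡ (eval-cong n x (λ j → +-identityˡ _)))))

    secant : ∀ x → eval n f x ≈ eval n f s + (x - s) * eval n q x
    secant x = begin
      eval n f x                                           ≈⟨ eval-suc n f x vanish ⟨
      eval (ℕ.suc n) f x                                   ≈⟨ eval-cong (ℕ.suc n) x (division n f s vanish) ⟩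
      eval (ℕ.suc n) (constant (eval n f s) ⊕ times-root s q) x       ≈⟨ eval-division (ℕ.suc n) (eval n f s)
        (times-root s q) x ⟩
      eval n f s + eval (ℕ.suc n) (times-root s q) x       ≈⟨ +-congˡ
        (eval-times-root n s q x (λ j n<j → quotient-vanishes n f s j (ℕ.<⇒≤ n<j))) ⟩
      eval n f s + (x - s) * eval n q x                    ∎
      where open SetoidReasoning setoid

  -- Let s be the supremum of the points of [u, v] with F ≤ 0. By the slope bound F cannot change
  -- sign within distance |F s| / K of s. So F s < 0 would put larger points into the set, and F s >
  -- 0 would give a smaller upper bound.
  intermediate-value : ∀ {F} → (∀ {x y} → x ≈ y → F x ≈ F y) → SecantBounded F →
                       ∀ {u v} → u < v → F u < 0# → 0# < F v → ∃ λ s → u < s × s < v × F s ≈ 0#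
  intermediate-value {F} F-resp secantBounded {u} {v} (u≤v , _) Fu<0 0<Fv with
    complete (λ x → u ≤ x × x ≤ v × F x ≤ 0#) (u , ≤-refl , u≤v , proj₁ Fu<0) (v , λ x (_ , x≤v , _) → x≤v)
  ... | s , s-upper , s-least with secantBounded u v s
  ... | K , 0<K , secant = s , (u≤s , s≉u ∘ sym) , (s≤v , s≉v) , Fs≈0
    where
    u≤s : u ≤ s
    u≤s = s-upper u (≤-refl , u≤v , proj₁ Fu<0)

    s≤v : s ≤ v
    s≤v = s-least v (λ x (_ , x≤v , _) → x≤v)

    Fs≮0 : ¬ (F s < 0#)
    Fs≮0 Fs<0 with pos-inverse 0<K
    ... | K⁻¹ , 0<K⁻¹ , KK⁻¹≈1 = case
      where
      -- The least distance in which F can climb from F s to 0 with slope at most K.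
      δ = - F s * K⁻¹
      0<δ : 0# < δ
      0<δ = *-pos (x<0⇒0<-x Fs<0) 0<K⁻¹

      F≤0 : ∀ t → 0# ≤ t → t ≤ δ → s + t ≤ v → F (s + t) ≤ 0#
      F≤0 t 0≤t t≤δ s+t≤v with secant (s + t)
        (≤-trans u≤s (≤-by-difference (solve 2 (λ s t → s :+ t :- s := t) refl s t) 0≤t)) s+t≤v
      ... | g , Fx≈ , g≤K , _ = ≤-by-difference
        (begin
          0# - F (s + t)                                          ≈⟨ +-congˡ (-‿cong Fx≈) ⟩
          0# - (F s + (s + t - s) * g)
            ≈⟨ solve 5 (λ F s t g K → con (+ 0) :- (F :+ (s :+ t :- s) :* g) :=
              :- F :* con (+ 1) :- t :* K :+ t :* (K :- g)) refl (F s) s t g K ⟩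
          - F s * 1# - t * K + t * (K - g)                        ≈⟨ +-congʳ (+-congʳ (*-congˡ (sym KK⁻¹≈1))) ⟩
          - F s * (K * K⁻¹) - t * K + t * (K - g)
            ≈⟨ solve 5 (λ F t g K L → :- F :* (K :* L) :- t :* K :+ t :* (K :- g) :=
              (:- F :* L :- t) :* K :+ t :* (K :- g)) refl (F s) t g K K⁻¹ ⟩
          (δ - t) * K + t * (K - g)                               ∎)
        (+-nonNeg (*-nonNeg (x≤y⇒0≤y-x t≤δ) (proj₁ 0<K)) (*-nonNeg 0≤t (x≤y⇒0≤y-x g≤K)))
        where open SetoidReasoning setoid

      case : ⊥
      case with total δ (v - s)
      ... | inj₁ δ≤v-s = <⇒≱ (<-by-difference (solve 2 (λ s t → s :+ t :- s := t) refl s δ) 0<δ)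
                           (s-upper (s + δ) (≤-trans u≤s
                             (≤-by-difference (solve 2 (λ s t → s :+ t :- s := t) refl s δ) (proj₁ 0<δ)) ,
                             s+δ≤v , F≤0 δ (proj₁ 0<δ) ≤-refl s+δ≤v))
        where
        s+δ≤v : s + δ ≤ v
        s+δ≤v = ≤-by-difference (solve 3 (λ s v δ → v :- (s :+ δ) := (v :- s) :- δ) refl s v δ)
          (x≤y⇒0≤y-x δ≤v-s)
      -- Here `v` itself lies within distance δ of s, so F v would be nonpositive.
      ... | inj₂ v-s≤δ = <⇒≱ 0<Fv (≤-respˡ-≈ (F-resp s+v-s≈v)
                           (F≤0 (v - s) (x≤y⇒0≤y-x s≤v) v-s≤δ (≤-reflexive s+v-s≈v)))
        where
        s+v-s≈v : s + (v - s) ≈ v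
        s+v-s≈v = solve 2 (λ s v → s :+ (v :- s) := v) refl s v

    0≮Fs : ¬ (0# < F s)
    0≮Fs 0<Fs with pos-inverse 0<K
    ... | K⁻¹ , 0<K⁻¹ , KK⁻¹≈1 = <⇒≱ (<-by-difference (solve 2 (λ s t → s :- (s :- t) := t) refl s δ) 0<δ)
      (s-least (s - δ) upper)
      where
      δ = F s * K⁻¹
      0<δ : 0# < δ
      0<δ = *-pos 0<Fs 0<K⁻¹

      upper : UpperBound (λ x → u ≤ x × x ≤ v × F x ≤ 0#) (s - δ)
      upper x x∈@(u≤x , x≤v , Fx≤0) with x ≤? (s - δ) | secant x u≤x x≤v
      ... | yes x≤s-δ | _                     = x≤s-δ
      ... | no  x≰s-δ | g , Fx≈ , g≤K , _ = contradiction Fx≤0 (<⇒≱ (<-respʳ-≈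
        (begin
          (x - (s - δ)) * K + (s - x) * (K - g)
            ≈⟨ solve 6 (λ F s x g K L → (x :- (s :- F :* L)) :* K :+ (s :- x) :* (K :- g) :=
              F :* (K :* L) :+ (x :- s) :* g) refl (F s) s x g K K⁻¹ ⟩
          F s * (K * K⁻¹) + (x - s) * g     ≈⟨ +-congʳ (trans (*-congˡ KK⁻¹≈1) (*-identityʳ _)) ⟩
          F s + (x - s) * g                 ≈⟨ Fx≈ ⟨
          F x                               ∎)
        (+-pos-nonNeg (*-pos (x<y⇒0<y-x (≰⇒> x≰s-δ)) 0<K)
          (*-nonNeg (x≤y⇒0≤y-x (s-upper x x∈)) (x≤y⇒0≤y-x g≤K)))))
        where open SetoidReasoning setoid

    Fs≈0 : F s ≈ 0#
    Fs≈0 with <⊎≈⊎> (F s) 0#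
    ... | inj₁ Fs<0        = contradiction Fs<0 Fs≮0
    ... | inj₂ (inj₁ Fs≈0) = Fs≈0
    ... | inj₂ (inj₂ 0<Fs) = contradiction 0<Fs 0≮Fs

    s≉u : s ≉ u
    s≉u s≈u = proj₂ Fu<0 (trans (F-resp (sym s≈u)) Fs≈0)

    s≉v : s ≉ v
    s≉v s≈v = proj₂ 0<Fv (trans (sym Fs≈0) (F-resp s≈v))

  abstract
    eval-intermediate-value : ∀ n f → VanishesAbove n f → ∀ {u v} → u < v → eval n f u < 0# → 0# < eval n f v →
                              ∃ λ s → u < s × s < v × eval n f s ≈ 0#
    eval-intermediate-value n f vanish = intermediate-value (eval-respects n f) (eval-secantBounded n f vanish)

-- Factorisation from sign changes

module Roots (ℝ : CompleteOrderedField) where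
  open CompleteOrderedField ℝ
  open Polynomials ℝ
  open IntegerSolver ℝ
  open OrderedField ℝ
  open RingProperties ring
  open Evaluation ℝ
  open IntermediateValue ℝ

  Descending : List Carrier → Set
  Descending = Linked (flip _<_)

  -- The signs are +, -, +, and so on. Negating F in the tail makes the tail an instance of the same
  -- notion, which matches division by a linear factor.
  data Alternates (F : Carrier → Carrier) : List Carrier → Set where
    []  : Alternates F []
    _∷_ : ∀ {y ys} → 0# < F y → Alternates (λ y → - F y) ys → Alternates F (y ∷ ys)

  -- Both implications are needed because `Alternates` negates the function at each step, whereupon
  -- the two exchange roles.
  SameSignAt : (F G : Carrier → Carrier) → Carrier → Set
  SameSignAt F G y = (0# < F y → 0# < G y) × (0# < - F y → 0# < - G y)

  alternates-sameSign : ∀ {F G ys} → All (SameSignAt F G) ys → Alternates F ys → Alternates G ys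
  alternates-sameSign []                     []          = []
  alternates-sameSign ((F⇒G , _) ∷ sameSign) (0<F ∷ alt) =
    F⇒G 0<F ∷ alternates-sameSign (All.map (λ (F⇒G , -F⇒-G) →
      -F⇒-G , λ 0<--F → <-respʳ-≈ (sym (-‿involutive _)) (F⇒G (<-respʳ-≈ (-‿involutive _) 0<--F))) sameSign) alt

  sameSign-scale : ∀ F G y c → 0# < c → F y ≈ c * G y → SameSignAt F G y
  sameSign-scale F G y c 0<c Fy≈cGy =
    (λ 0<F → *-cancel-pos 0<c (<-respʳ-≈ Fy≈cGy 0<F)) ,
    (λ 0<-F → *-cancel-pos 0<c (<-respʳ-≈ (trans (-‿cong Fy≈cGy) (-‿distribʳ-* c _)) 0<-F))

  sameSign-positive-multiple : ∀ F G y c → 0# < c → G y ≈ c * F y → SameSignAt F G y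
  sameSign-positive-multiple F G y c 0<c Gy≈cFy =
    (λ 0<F → <-respʳ-≈ (sym Gy≈cFy) (*-pos 0<c 0<F)) ,
    (λ 0<-F → <-respʳ-≈ (trans (sym (-‿distribʳ-* c _)) (-‿cong (sym Gy≈cFy))) (*-pos 0<c 0<-F))

  sameSign-product : ∀ F G y → 0# < F y * G y → SameSignAt F G y
  sameSign-product F G y 0<FG =
    (λ 0<F → *-cancel-pos 0<F 0<FG) ,
    (λ 0<-F → *-cancel-pos 0<-F (<-respʳ-≈ (solve 2 (λ f g → f :* g := :- f :* :- g) refl (F y) (G y)) 0<FG))

  sameSign-≈ : ∀ F G y → F y ≈ G y → SameSignAt F G y
  sameSign-≈ F G y F≈G = <-respʳ-≈ F≈G , <-respʳ-≈ (-‿cong F≈G)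

  monic : List Carrier → Series
  monic = foldr (λ r q → linear (- r) 1# ⊛ q) (constant 1#)

  factored-∷ : ∀ {f g} c rs r → f ≋ times-root r g → g ≋ constant c ⊛ monic rs → f ≋ constant c ⊛ monic (r ∷ rs)
  factored-∷ {f} {g} c rs r f≋ g≋ j = begin
    f j                                                       ≈⟨ f≋ j ⟩
    times-root r g j                                          ≈⟨ times-root-cong r
      (λ j → trans (g≋ j) (constant-⊛ c (monic rs) j)) j ⟩
    - r * (c * monic rs j) + 1# * shift (λ j → c * monic rs j) j  ≈⟨ +-congˡ (*-congˡ (shift-scale j)) ⟩
    - r * (c * monic rs j) + 1# * (c * shift (monic rs) j)
      ≈⟨ solve 4 (λ r c a b → :- r :* (c :* a) :+ con (+ 1) :* (c :* b) :=
        c :* (:- r :* a :+ con (+ 1) :* b)) refl r c _ _ ⟩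
    c * times-root r (monic rs) j                             ≈⟨ *-congˡ
      (sym (linear-⊛ (- r) 1# (monic rs) j)) ⟩
    c * monic (r ∷ rs) j                                      ≈⟨ sym (constant-⊛ c (monic (r ∷ rs)) j) ⟩
    (constant c ⊛ monic (r ∷ rs)) j                           ∎
    where
    open SetoidReasoning setoid
    shift-scale : ∀ j → shift (λ j → c * monic rs j) j ≈ c * shift (monic rs) j
    shift-scale ℕ.zero    = sym (zeroʳ c)
    shift-scale (ℕ.suc j) = refl

  factored-[] : ∀ {f} → VanishesAbove 0 f → f ≋ constant (f 0) ⊛ monic []
  factored-[] {f} vanish j = trans (f≈ j) (sym (constant-⊛ (f 0) (constant 1#) j))
    where
    f≈ : ∀ j → f j ≈ f 0 * constant 1# j
    f≈ ℕ.zero    = sym (*-identityʳ _)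
    f≈ (ℕ.suc j) = trans (vanish (ℕ.suc j) z<s) (sym (zeroʳ _))

  Splits : ℕ → Series → List Carrier → Set
  Splits n f ys = ∃₂ λ c rs → 0# < c × f ≋ constant c ⊛ monic rs × length rs ≡ n × Descending (zigzag ys rs)

  private
    -- A zero r lies between the first two points. At points below r the factor x - r is negative,
    -- so the quotient has the signs of -f there and again starts with + at `y₁`.
    peel : ∀ n f {y₀ y₁ ys} → VanishesAbove (ℕ.suc n) f → Descending (y₀ ∷ y₁ ∷ ys) →
           Alternates (eval (ℕ.suc n) f) (y₀ ∷ y₁ ∷ ys) →
           ∃ λ r → r < y₀ × y₁ < r × f ≋ times-root r (quotient (ℕ.suc n) f r) ×
                   Alternates (eval n (quotient (ℕ.suc n) f r)) (y₁ ∷ ys)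
    peel n f vanish (y₁<y₀ ∷ desc) (0<Fy₀ ∷ alt@(0<-Fy₁ ∷ _)) with eval-intermediate-value
      (ℕ.suc n) f vanish y₁<y₀ (0<-x⇒x<0 0<-Fy₁) 0<Fy₀
    ... | r , y₁<r , r<y₀ , Fr≈0 =
      r , r<y₀ , y₁<r , factor (ℕ.suc n) f r vanish Fr≈0 ,
      alternates-sameSign (All.map sameSign (Linked⇒All (flip <-trans) y₁<r desc)) alt
      where
      q = quotient (ℕ.suc n) f r
      sameSign : ∀ {y} → y < r → SameSignAt (λ y → - eval (ℕ.suc n) f y) (eval n q) y
      sameSign {y} y<r = sameSign-scale (λ y → - eval (ℕ.suc n) f y) (eval n q) y (r - y) (x<y⇒0<y-x y<r) (begin
        - eval (ℕ.suc n) f y                  ≈⟨ -‿cong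
          (eval-cong (ℕ.suc n) y (factor (ℕ.suc n) f r vanish Fr≈0)) ⟩
        - eval (ℕ.suc n) (times-root r q) y   ≈⟨ -‿cong
          (eval-times-root n r q y (λ j n<j → quotient-vanishes (ℕ.suc n) f r j n<j)) ⟩
        - ((y - r) * eval n q y)              ≈⟨ solve 3
          (λ y r e → :- ((y :- r) :* e) := (r :- y) :* e) refl y r (eval n q y) ⟩
        (r - y) * eval n q y                  ∎)
        where open SetoidReasoning setoid

  -- Each of the n gaps between n + 1 points holds a zero, and degree at most n admits no others.
  -- The constant left at the end is positive, being the sign at the lowest point.
  splits : ∀ n f ys → VanishesAbove n f → length ys ≡ ℕ.suc n → Descending ys → Alternates (eval n f) ys →
    Splits n f ys
  splits ℕ.zero    f (y ∷ [])       vanish eq desc (0<Fy ∷ []) = f 0 , [] , 0<Fy , factored-[] vanish ,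
    ≡.refl , [-]
  splits (ℕ.suc n) f (y₀ ∷ y₁ ∷ ys) vanish eq desc@(_ ∷ desc′) alt with peel n f vanish desc alt
  ... | r , r<y₀ , y₁<r , f≋ ,
    alt′ with splits n (quotient (ℕ.suc n) f r) (y₁ ∷ ys) (λ j n<j → quotient-vanishes (ℕ.suc n) f r j n<j)
      (ℕ.suc-injective eq) desc′ alt′
  ... | c , rs , 0<c , q≋ , len , desc″ = c , r ∷ rs , 0<c , factored-∷ c rs r f≋ q≋ , ≡.cong ℕ.suc len ,
    r<y₀ ∷ y₁<r ∷ desc″

  -- One point fewer than in `splits`: the positive leading coefficient supplies a zero below all
  -- points once the quotient has become linear.
  splits-leading : ∀ n f ys → VanishesAbove n f → 0# < f n → length ys ≡ n → Descending ys → Alternates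
    (eval n f) ys → Splits n f ys
  splits-leading ℕ.zero f [] vanish 0<fₙ eq desc alt = f 0 , [] , 0<fₙ , factored-[] vanish , ≡.refl , []
  splits-leading (ℕ.suc ℕ.zero) f (y ∷ []) vanish 0<fₙ eq desc (0<Fy ∷ []) with pos-inverse 0<fₙ
  ... | d , 0<d , f₁d≈1 =
    f 1 , r ∷ [] , 0<fₙ , factored-∷ (f 1) [] r (factor 1 f r vanish Fr≈0)
      (factored-[] (λ j 0<j → quotient-vanishes 1 f r j 0<j)) , ≡.refl , r<y ∷ [-]
    where
    r = - f 0 * d
    Fr≈0 : f 0 + r * f 1 ≈ 0#
    Fr≈0 = trans (solve 3 (λ a b d → a :+ (:- a :* d) :* b := a :* (con (+ 1) :- b :* d)) refl (f 0) (f 1) d)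
      (trans (*-congˡ (trans (+-congˡ (-‿cong f₁d≈1)) (-‿inverseʳ 1#))) (zeroʳ _))

    r<y : r < y
    r<y = 0<y-x⇒x<y (*-cancel-pos 0<fₙ
      (<-respʳ-≈ (trans (sym (trans (+-congˡ (-‿cong Fr≈0)) (trans (+-congˡ -0#≈0#) (+-identityʳ _))))
      (solve 4 (λ a b y r → (a :+ y :* b) :- (a :+ r :* b) := b :* (y :- r)) refl (f 0) (f 1) y r)) 0<Fy))
  splits-leading (ℕ.suc n@(ℕ.suc _)) f
    (y₀ ∷ y₁ ∷ ys) vanish 0<fₙ eq desc@(_ ∷ desc′) alt with peel n f vanish desc alt
  ... | r , r<y₀ , y₁<r , f≋ , alt′ with splits-leading n (quotient (ℕ.suc n) f r) (y₁ ∷ ys)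
    (λ j n<j → quotient-vanishes (ℕ.suc n) f r j n<j)
                                           (≡.subst (0# <_) (≡.sym (quotient-leading n f r)) 0<fₙ)
                                             (ℕ.suc-injective eq) desc′ alt′
  ... | c , rs , 0<c , q≋ , len , desc″ = c , r ∷ rs , 0<c , factored-∷ c rs r f≋ q≋ , ≡.cong ℕ.suc len ,
    r<y₀ ∷ y₁<r ∷ desc″

-- Interleaved descending lists

module Zigzag (ℝ : CompleteOrderedField) where
  open CompleteOrderedField ℝ
  open Polynomials ℝ
  open OrderedField ℝ
  open Roots ℝ using (Descending)

  All-zigzag⁻ : ∀ {P : Carrier → Set} xs ys → All P (zigzag xs ys) → All P xs × All P ys
  All-zigzag⁻ []       ys all        = [] , all
  All-zigzag⁻ (x ∷ xs) ys (px ∷ all) = let pys , pxs = All-zigzag⁻ ys xs all in px ∷ pxs , pys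

  AllPairs-zigzag⁻ : ∀ {R : Carrier → Carrier → Set} xs ys → AllPairs R (zigzag xs ys) → AllPairs R xs ×
    AllPairs R ys
  AllPairs-zigzag⁻ []       ys pairs          = [] , pairs
  AllPairs-zigzag⁻ (x ∷ xs) ys (rx ∷ pairs) =
    let rys , rxs = AllPairs-zigzag⁻ ys xs pairs
    in proj₂ (All-zigzag⁻ ys xs rx) ∷ rxs , rys

  -- Neighbours in `xs` are not neighbours in the zigzag, hence the detour through `AllPairs`, the
  -- transitively closed form of the order.
  descending-zigzag⁻ : ∀ xs ys → Descending (zigzag xs ys) → Descending xs × Descending ys
  descending-zigzag⁻ xs ys desc =
    let dxs , dys = AllPairs-zigzag⁻ xs ys (Linked⇒AllPairs (flip <-trans) desc)
    in AllPairs⇒Linked dxs , AllPairs⇒Linked dys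

  descending-head : ∀ {x xs} → Descending (x ∷ xs) → All (_< x) xs
  descending-head desc = AllPairs.head (Linked⇒AllPairs (flip <-trans) desc)

  descending⇒linked : ∀ {xs} → Descending xs → Linked (flip _≤_) xs
  descending⇒linked = Linked.map proj₁

  zigzag-self : ∀ xs → Descending xs → Linked (flip _≤_) (zigzag xs xs)
  zigzag-self []           desc           = []
  zigzag-self (x ∷ [])     desc           = ≤-refl ∷ [-]
  zigzag-self (x ∷ y ∷ xs) (y<x ∷ desc)   = ≤-refl ∷ proj₁ y<x ∷ zigzag-self (y ∷ xs) desc

-- Signs of split polynomials and their derivatives

module SplitPolynomials (ℝ : CompleteOrderedField) where
  open CompleteOrderedField ℝ
  open Polynomials ℝ
  open IntegerSolver ℝ
  open OrderedField ℝ
  open RingProperties ring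
  open Evaluation ℝ
  open Roots ℝ
  open Zigzag ℝ

  monic-∷ : ∀ r rs → monic (r ∷ rs) ≋ times-root r (monic rs)
  monic-∷ r rs = linear-⊛ (- r) 1# (monic rs)

  monic-vanishes : ∀ rs → VanishesAbove (length rs) (monic rs)
  monic-vanishes []       (ℕ.suc j) _         = refl
  monic-vanishes (r ∷ rs) (ℕ.suc j) (s<s m<j) = trans (monic-∷ r rs (ℕ.suc j))
    (trans (+-cong (trans (*-congˡ (monic-vanishes rs (ℕ.suc j) (ℕ.m<n⇒m<1+n m<j))) (zeroʳ _))
                   (trans (*-congˡ (monic-vanishes rs j m<j)) (zeroʳ _)))
           (+-identityˡ 0#))

  monic-leading : ∀ rs → monic rs (length rs) ≈ 1#
  monic-leading []       = refl
  monic-leading (r ∷ rs) = trans (monic-∷ r rs (ℕ.suc (length rs)))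
    (trans (+-cong (trans (*-congˡ (monic-vanishes rs _ ℕ.≤-refl)) (zeroʳ _)) (*-identityˡ _))
      (trans (+-identityˡ _) (monic-leading rs)))

  eval-monic : List Carrier → Carrier → Carrier
  eval-monic rs = eval (length rs) (monic rs)

  derivative-monic : List Carrier → Carrier → Carrier
  derivative-monic rs = derivative (length rs) (monic rs)

  eval-monic-∷ : ∀ r rs x → eval-monic (r ∷ rs) x ≈ (x - r) * eval-monic rs x
  eval-monic-∷ r rs x = trans (eval-cong (ℕ.suc (length rs)) x (monic-∷ r rs))
    (eval-times-root (length rs) r (monic rs) x (monic-vanishes rs))

  derivative-monic-∷ : ∀ r rs x → derivative-monic (r ∷ rs) x ≈ eval-monic rs x +
    (x - r) * derivative-monic rs x
  derivative-monic-∷ r rs x =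
    trans (derivative-cong (ℕ.suc (length rs)) x (monic-∷ r rs))
      (derivative-times-root (length rs) r (monic rs) x (monic-vanishes rs))

  monic-positive : ∀ rs {x} → All (_< x) rs → 0# < eval-monic rs x
  monic-positive []       []           = 0<1
  monic-positive (r ∷ rs) {x} (r<x ∷ rs<x) =
    <-respʳ-≈ (sym (eval-monic-∷ r rs x)) (*-pos (x<y⇒0<y-x r<x) (monic-positive rs rs<x))

  monic-root : ∀ rs → All (λ r → eval-monic rs r ≈ 0#) rs
  monic-root []       = []
  monic-root (r ∷ rs) =
    trans (eval-monic-∷ r rs r) (trans (*-congʳ (-‿inverseʳ r)) (zeroˡ _)) ∷
    All.map (λ {y} y-root → trans (eval-monic-∷ r rs y) (trans (*-congˡ y-root) (zeroʳ _))) (monic-root rs)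

  -- At the largest root r only the product of the remaining, positive factors survives. At a
  -- smaller root y the derivative is that of the remaining product times y - r < 0.
  derivative-monic-alternates : ∀ rs → Descending rs → Alternates (derivative-monic rs) rs
  derivative-monic-alternates []       desc = []
  derivative-monic-alternates (r ∷ rs) desc =
    <-respʳ-≈ (sym (trans (derivative-monic-∷ r rs r)
      (trans (+-congˡ (trans (*-congʳ (-‿inverseʳ r)) (zeroˡ _))) (+-identityʳ _))))
      (monic-positive rs (descending-head desc)) ∷
    alternates-sameSign (All.zipWith (λ {y} (y<r , y-root) → sameSign y y<r y-root) (descending-head desc ,
      monic-root rs))
      (derivative-monic-alternates rs (Linked.tail desc))
    where
    sameSign : ∀ y → y < r → eval-monic rs y ≈ 0# → SameSignAt (derivative-monic rs)
      (λ y → - derivative-monic (r ∷ rs) y) y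
    sameSign y y<r y-root = sameSign-positive-multiple (derivative-monic rs)
      (λ y → - derivative-monic (r ∷ rs) y) y (r - y) (x<y⇒0<y-x y<r)
      (trans (-‿cong (trans (derivative-monic-∷ r rs y) (trans (+-congʳ y-root) (+-identityˡ _))))
        (solve 3 (λ y r e → :- ((y :- r) :* e) := (r :- y) :* e) refl y r (derivative-monic rs y)))

  -- At the first point exactly one linear factor is negative. At all later points the factor of the
  -- first root is negative too, so removing it reverses the sign.
  interlaced⇒alternates : ∀ rs ys → length ys ℕ.≤ length rs → Descending (zigzag rs ys) →
                          Alternates (λ y → - eval-monic rs y) ys
  interlaced⇒alternates rs       []       len desc = []
  interlaced⇒alternates (r ∷ rs) (y ∷ ys) (s≤s len) desc@(y<r ∷ desc′) =
    <-respʳ-≈ (neg-eval y) (*-pos (x<y⇒0<y-x y<r)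
      (monic-positive rs (proj₁ (All-zigzag⁻ rs ys (descending-head desc′))))) ∷
    alternates-sameSign (All.map (λ {z} z<r → sameSign z z<r)
      (All.tail (proj₁ (All-zigzag⁻ (y ∷ ys) rs (descending-head desc)))))
      (interlaced⇒alternates rs ys len (Linked.tail desc′))
    where
    neg-eval : ∀ z → (r - z) * eval-monic rs z ≈ - eval-monic (r ∷ rs) z
    neg-eval z = trans (solve 3 (λ z r e → (r :- z) :* e := :- ((z :- r) :* e)) refl z r (eval-monic rs z))
      (-‿cong (sym (eval-monic-∷ r rs z)))

    sameSign : ∀ z → z < r → SameSignAt (λ z → - eval-monic rs z) (λ z → - - eval-monic (r ∷ rs) z) z
    sameSign z z<r = sameSign-positive-multiple (λ z → - eval-monic rs z) (λ z → - - eval-monic (r ∷ rs) z) z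
      (r - z) (x<y⇒0<y-x z<r)
      (trans (-‿cong (sym (neg-eval z))) (-‿distribʳ-* _ _))

-- Log-concavity and unimodality

module LogConcavity (ℝ : CompleteOrderedField) where
  open CompleteOrderedField ℝ
  open Polynomials ℝ
  open IntegerSolver ℝ
  open OrderedField ℝ
  open Evaluation ℝ
  open Roots ℝ
  open SplitPolynomials ℝ

  Nonnegative : Series → Set
  Nonnegative f = ∀ j → 0# ≤ f j

  -- The form for arbitrary outer and inner pairs with equal index sum. Unlike the condition on
  -- three consecutive coefficients it excludes internal zeros, and it passes through multiplication
  -- by x - r directly.
  LogConcave : Series → Set
  LogConcave f = ∀ k i j l → k ℕ.≤ i → k ℕ.≤ j → k ℕ.+ l ≡ i ℕ.+ j → f k * f l ≤ f i * f j

  shift-nonNeg : ∀ {f} → Nonnegative f → Nonnegative (shift f)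
  shift-nonNeg 0≤f ℕ.zero    = ≤-refl
  shift-nonNeg 0≤f (ℕ.suc j) = 0≤f j

  private
    shift-shift : ∀ {f} → Nonnegative f → LogConcave f → LogConcave (shift f)
    shift-shift {f} 0≤f lc ℕ.zero i j l _ _ _ = ≤-respˡ-≈ (sym (zeroˡ _))
      (*-nonNeg (shift-nonNeg 0≤f i) (shift-nonNeg 0≤f j))
    shift-shift {f} 0≤f lc (ℕ.suc k) (ℕ.suc i) (ℕ.suc j) ℕ.zero k≤i k≤j eq =
      ≤-respˡ-≈ (sym (zeroʳ _)) (*-nonNeg (0≤f i) (0≤f j))
    shift-shift {f} 0≤f lc (ℕ.suc k) (ℕ.suc i) (ℕ.suc j) (ℕ.suc l) (s≤s k≤i) (s≤s k≤j) eq =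
      lc k i j l k≤i k≤j (ℕ.suc-injective
        (≡.trans (≡.sym (ℕ.+-suc k l)) (≡.trans (ℕ.suc-injective eq) (ℕ.+-suc i j))))

    shift-left : ∀ {f} → Nonnegative f → LogConcave f → ∀ k i j l → k ℕ.≤ i → k ℕ.≤ j → k ℕ.+ l ≡ i ℕ.+ j →
                 shift f k * f l ≤ shift f i * f j
    shift-left {f} 0≤f lc ℕ.zero i j l _ _ _ = ≤-respˡ-≈ (sym (zeroˡ _)) (*-nonNeg (shift-nonNeg 0≤f i) (0≤f j))
    shift-left {f} 0≤f lc (ℕ.suc k) (ℕ.suc i) j l (s≤s k≤i) k≤j eq =
      lc k i j l k≤i (ℕ.<⇒≤ k≤j) (ℕ.suc-injective eq)

    shift-right : ∀ {f} → Nonnegative f → LogConcave f → ∀ k i j l → k ℕ.≤ i → k ℕ.< j → k ℕ.+ l ≡ i ℕ.+ j →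
                  f k * shift f l ≤ f i * shift f j
    shift-right {f} 0≤f lc k i (ℕ.suc j) ℕ.zero k≤i k<j eq = ≤-respˡ-≈ (sym (zeroʳ _))
      (*-nonNeg (0≤f i) (0≤f j))
    shift-right {f} 0≤f lc k i (ℕ.suc j) (ℕ.suc l) k≤i (s≤s k≤j) eq =
      lc k i j l k≤i k≤j (ℕ.suc-injective (≡.trans (≡.sym (ℕ.+-suc k l)) (≡.trans eq (ℕ.+-suc i j))))

  times-root-nonNeg : ∀ r {f} → r ≤ 0# → Nonnegative f → Nonnegative (times-root r f)
  times-root-nonNeg r r≤0 0≤f j =
    +-nonNeg (*-nonNeg (x≤0⇒0≤-x r≤0) (0≤f j)) (*-nonNeg (proj₁ 0<1) (shift-nonNeg 0≤f j))

  -- For k < j the difference is a combination of such differences for f and its shift, with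
  -- coefficients r², -r and 1. For j = k the index sums force l = i, and only commutativity is
  -- left.
  times-root-logConcave : ∀ r {f} → r ≤ 0# → Nonnegative f → LogConcave f → LogConcave (times-root r f)
  times-root-logConcave r {f} r≤0 0≤f lc k i j l k≤i k≤j eq with ℕ.m≤n⇒m<n∨m≡n k≤j
  ... | inj₂ ≡.refl rewrite ℕ.+-cancelˡ-≡ k l i (≡.trans eq (ℕ.+-comm i k)) = ≤-reflexive (*-comm _ _)
  ... | inj₁ k<j    = ≤-by-difference
    (solve 9 (λ r a a′ b b′ c c′ d d′ →
      (:- r :* b :+ con (+ 1) :* b′) :* (:- r :* c :+ con (+ 1) :* c′) :- (:- r :* a :+ con (+ 1) :* a′) :* (:- r :* d :+ con (+ 1) :* d′) :=
      (:- r :* :- r) :* (b :* c :- a :* d) :+ :- r :* ((b :* c′ :- a :* d′) :+ (b′ :* c :- a′ :* d)) :+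
        (b′ :* c′ :- a′ :* d′))
      refl r (f k) (shift f k) (f i) (shift f i) (f j) (shift f j) (f l) (shift f l))
    (+-nonNeg (+-nonNeg
      (*-nonNeg (x*x-nonNeg _) (x≤y⇒0≤y-x (lc k i j l k≤i k≤j eq)))
      (*-nonNeg (x≤0⇒0≤-x r≤0) (+-nonNeg (x≤y⇒0≤y-x (shift-right 0≤f lc k i j l k≤i k<j eq))
        (x≤y⇒0≤y-x (shift-left 0≤f lc k i j l k≤i k≤j eq)))))
      (x≤y⇒0≤y-x (shift-shift 0≤f lc k i j l k≤i k≤j eq)))

  private
    constant-nonNeg : Nonnegative (constant 1#)
    constant-nonNeg ℕ.zero    = proj₁ 0<1
    constant-nonNeg (ℕ.suc j) = ≤-refl

  monic-nonNeg : ∀ rs → All (_≤ 0#) rs → Nonnegative (monic rs)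
  monic-nonNeg []       []            = constant-nonNeg
  monic-nonNeg (r ∷ rs) (r≤0 ∷ rs≤0) j = ≤-respʳ-≈ (sym (monic-∷ r rs j))
    (times-root-nonNeg r r≤0 (monic-nonNeg rs rs≤0) j)

  monic-logConcave : ∀ rs → All (_≤ 0#) rs → LogConcave (monic rs)
  monic-logConcave [] [] k i j (ℕ.suc l) _ _ eq = ≤-respˡ-≈ (sym (zeroʳ _))
    (*-nonNeg (constant-nonNeg i) (constant-nonNeg j))
  monic-logConcave [] [] ℕ.zero    ℕ.zero    ℕ.zero ℕ.zero _ _ eq = ≤-refl
  monic-logConcave [] [] (ℕ.suc k) (ℕ.suc i) j ℕ.zero _ _ eq = ≤-respˡ-≈ (sym (zeroˡ _))
    (*-nonNeg (constant-nonNeg (ℕ.suc i)) (constant-nonNeg j))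
  monic-logConcave (r ∷ rs) (r≤0 ∷ rs≤0) k i j l k≤i k≤j eq =
    ≤-respˡ-≈ (sym (*-cong (monic-∷ r rs k) (monic-∷ r rs l)))
      (≤-respʳ-≈ (sym (*-cong (monic-∷ r rs i) (monic-∷ r rs j)))
        (times-root-logConcave r r≤0 (monic-nonNeg rs rs≤0) (monic-logConcave rs rs≤0) k i j l k≤i k≤j eq))

  𝓘-≤ : ∀ n p j → j ℕ.≤ n → 𝓘 n p j ≡ p (n ℕ.∸ j)
  𝓘-≤ n p j j≤n with j ℕ.≤ᵇ n in eq
  ... | true  = ≡.refl
  ... | false = contradiction (≡.subst Bool.T eq (ℕ.≤⇒≤ᵇ j≤n)) (λ ())

  𝓘-> : ∀ n p j → n ℕ.< j → 𝓘 n p j ≡ 0#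
  𝓘-> n p j n<j with j ℕ.≤ᵇ n in eq
  ... | false = ≡.refl
  ... | true  = contradiction (ℕ.≤ᵇ⇒≤ j n (≡.subst Bool.T (≡.sym eq) _)) (ℕ.<⇒≱ n<j)

  NonPositiveZeros : Series → List Carrier → Set
  NonPositiveZeros f rs = ∃ λ c → 0# < c × f ≋ constant c ⊛ monic rs × All (_≤ 0#) rs

  split-nonNeg : ∀ {f rs} → NonPositiveZeros f rs → Nonnegative f
  split-nonNeg {f} {rs} (c , 0<c , f≋ , rs≤0) j =
    ≤-respʳ-≈ (sym (trans (f≋ j) (constant-⊛ c (monic rs) j))) (*-nonNeg (proj₁ 0<c) (monic-nonNeg rs rs≤0 j))

  -- Log-concavity for i, i + 1 and their mirror images reads f_i² ≤ f_(i+1)² by symmetry;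
  -- nonnegativity then removes the squares.
  symmetric-unimodal : ∀ {n f rs} → NonPositiveZeros f rs → 𝓘 n f ≋ f → ∀ i → ℕ.suc (i ℕ.+ i) ℕ.≤ n → f i ≤ f
    (ℕ.suc i)
  symmetric-unimodal {n} {f} {rs} zeros@(c , 0<c , f≋ , rs≤0) sym-f i 2i<n with ℕ.m≤n⇒∃[o]m+o≡n 2i<n
  ... | d , ≡.refl with f i ≤? f (ℕ.suc i)
  ... | yes f≤ = f≤
  ... | no  f≰ = contradiction fᵢ²≤fᵢ₊₁² (<⇒≱ fᵢ₊₁²<fᵢ²)
    where
    -- The mirror images: j = n - (i + 1) and l = n - i.
    j = i ℕ.+ d
    l = ℕ.suc (i ℕ.+ d)
    symmetric : ∀ a b → a ℕ.+ b ≡ ℕ.suc (i ℕ.+ i) ℕ.+ d → f a ≈ f b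
    symmetric a b a+b≡ = trans (sym (sym-f a))
      (reflexive (≡.trans (𝓘-≤ _ f a (≡.subst (a ℕ.≤_) a+b≡ (ℕ.m≤m+n a b)))
      (≡.cong f (≡.trans (≡.cong (ℕ._∸ a) (≡.sym a+b≡)) (ℕ.m+n∸m≡n a b)))))
    f≈ : ∀ j → f j ≈ c * monic rs j
    f≈ j = trans (f≋ j) (constant-⊛ c (monic rs) j)
    f-logConcave : f i * f l ≤ f (ℕ.suc i) * f j
    f-logConcave = ≤-by-difference
      (trans (+-cong (*-cong (f≈ (ℕ.suc i)) (f≈ j)) (-‿cong (*-cong (f≈ i) (f≈ l))))
        (solve 5 (λ c a b d e → (c :* a) :* (c :* b) :- (c :* d) :* (c :* e) :=
          (c :* c) :* (a :* b :- d :* e)) refl c _ _ _ _))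
      (*-nonNeg (x*x-nonNeg c) (x≤y⇒0≤y-x
        (monic-logConcave rs rs≤0 i (ℕ.suc i) j l (ℕ.n≤1+n i) (ℕ.m≤m+n i d) (ℕ.+-suc i (i ℕ.+ d)))))
    fᵢ²≤fᵢ₊₁² : f i * f i ≤ f (ℕ.suc i) * f (ℕ.suc i)
    fᵢ²≤fᵢ₊₁² = ≤-respˡ-≈ (*-congˡ
      (symmetric l i (≡.cong ℕ.suc (≡.trans (ℕ.+-comm (i ℕ.+ d) i) (≡.sym (ℕ.+-assoc i i d))))))
      (≤-respʳ-≈ (*-congˡ (symmetric j (ℕ.suc i)
        (≡.trans (ℕ.+-suc (i ℕ.+ d) i)
          (≡.cong ℕ.suc (≡.trans (ℕ.+-comm (i ℕ.+ d) i) (≡.sym (ℕ.+-assoc i i d)))))))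
        f-logConcave)
    fᵢ₊₁²<fᵢ² : f (ℕ.suc i) * f (ℕ.suc i) < f i * f i
    fᵢ₊₁²<fᵢ² = <-by-difference
      (solve 2 (λ a b → a :* a :- b :* b := (a :- b) :* (a :+ b)) refl (f i) (f (ℕ.suc i)))
      (*-pos (x<y⇒0<y-x (≰⇒> f≰))
        (+-pos-nonNeg (≤-<-trans (split-nonNeg {f} {rs} zeros (ℕ.suc i)) (≰⇒> f≰))
          (split-nonNeg {f} {rs} zeros (ℕ.suc i))))

-- Refined Eulerian polynomials

module Eulerian (ℝ : CompleteOrderedField) where
  open CompleteOrderedField ℝ
  open Polynomials ℝ
  open IntegerSolver ℝ
  open OrderedField ℝ
  open Sums ℝ
  open Evaluation ℝ
  open SetoidReasoning setoid

  -- For j ≤ n, the numerator of ∑ₘ (m + 1)ʲ mⁿ⁻ʲ xᵐ.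
  eulerian : ℕ → ℕ → Series
  partialSum : ℕ → ℕ → Series

  eulerian ℕ.zero    j   = constant 1#
  eulerian (ℕ.suc n) j i = partialSum n j i + shift (λ i → partialSum n (ℕ.suc n) i - partialSum n j i) i

  partialSum n j i = Σ< j (λ k → eulerian n k i)

  private
    x-x≈0 : ∀ {x y} → x ≈ y → x - y ≈ 0#
    x-x≈0 x≈y = x≈y⇒y-x≈0 (sym x≈y)

    x+[0-0]≈x : ∀ {x y z} → y ≈ 0# → z ≈ 0# → x + (y - z) ≈ x
    x+[0-0]≈x y≈0 z≈0 = trans (+-congˡ (x-x≈0 (trans y≈0 (sym z≈0)))) (+-identityʳ _)

  eulerian-vanishes : ∀ n j → VanishesAbove n (eulerian n j)
  partialSum-vanishes : ∀ n j → VanishesAbove n (partialSum n j)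

  eulerian-vanishes ℕ.zero    j (ℕ.suc i) _         = refl
  eulerian-vanishes (ℕ.suc n) j (ℕ.suc i) (s<s n<i) =
    trans (x+[0-0]≈x (partialSum-vanishes n (ℕ.suc n) i n<i) (partialSum-vanishes n j i n<i))
      (partialSum-vanishes n j (ℕ.suc i) (ℕ.m<n⇒m<1+n n<i))

  partialSum-vanishes n j i n<i = Σ<-zero j (λ k _ → eulerian-vanishes n k i n<i)

  eulerian-constant-0 : ∀ n j → j ℕ.< n → eulerian n j 0 ≈ 0#
  eulerian-constant-0 (ℕ.suc n) j (s<s j≤n) =
    trans (+-identityʳ _) (Σ<-zero j (λ k k<j → eulerian-constant-0 n k (ℕ.<-≤-trans k<j j≤n)))

  eulerian-constant-1 : ∀ n → eulerian n n 0 ≈ 1#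
  eulerian-constant-1 ℕ.zero    = refl
  eulerian-constant-1 (ℕ.suc n) = begin
    partialSum n (ℕ.suc n) 0 + 0#       ≈⟨ +-identityʳ _ ⟩
    partialSum n (ℕ.suc n) 0            ≈⟨ Σ<-last n (λ k → eulerian n k 0) ⟩
    partialSum n n 0 + eulerian n n 0   ≈⟨ +-cong (Σ<-zero n (eulerian-constant-0 n)) (eulerian-constant-1 n) ⟩
    0# + 1#                             ≈⟨ +-identityˡ 1# ⟩
    1#                                  ∎

  -- The coefficient of highest degree is a difference of leading coefficients of two nonempty
  -- partial sums. Both are 1, contributed by the summand of index 0 alone.
  eulerian-leading-0 : ∀ n j → j ℕ.≤ n → eulerian (ℕ.suc n) (ℕ.suc j) (ℕ.suc n) ≈ 0#
  eulerian-leading-1 : ∀ n → eulerian n 0 n ≈ 1#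
  partialSum-leading : ∀ n j → j ℕ.≤ n → partialSum n (ℕ.suc j) n ≈ 1#

  eulerian-leading-0 n j j≤n =
    trans (+-cong (partialSum-vanishes n (ℕ.suc j) (ℕ.suc n) ℕ.≤-refl)
                  (x-x≈0 (trans (partialSum-leading n n ℕ.≤-refl) (sym (partialSum-leading n j j≤n)))))
      (+-identityˡ 0#)

  eulerian-leading-1 ℕ.zero    = refl
  eulerian-leading-1 (ℕ.suc n) = begin
    0# + (partialSum n (ℕ.suc n) n - 0#)  ≈⟨ solve 1 (λ a → con (+ 0) :+ (a :- con (+ 0)) := a) refl _ ⟩
    partialSum n (ℕ.suc n) n              ≈⟨ partialSum-leading n n ℕ.≤-refl ⟩
    1#                                    ∎

  partialSum-leading ℕ.zero    ℕ.zero _   = +-identityʳ 1#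
  partialSum-leading (ℕ.suc n) j      j≤n =
    trans (+-cong (eulerian-leading-1 (ℕ.suc n))
                  (Σ<-zero j (λ k k<j → eulerian-leading-0 n k (ℕ.s≤s⁻¹ (ℕ.<-≤-trans k<j j≤n)))))
      (+-identityʳ 1#)

  eulerian-last : ∀ n → eulerian (ℕ.suc n) (ℕ.suc n) ≋ partialSum n (ℕ.suc n)
  eulerian-last n ℕ.zero    = +-identityʳ _
  eulerian-last n (ℕ.suc i) = trans (+-congˡ (-‿inverseʳ _)) (+-identityʳ _)

  eulerian-first : ∀ n → eulerian (ℕ.suc n) 0 ≋ shift (eulerian (ℕ.suc n) (ℕ.suc n))
  eulerian-first n ℕ.zero    = +-identityˡ 0#
  eulerian-first n (ℕ.suc i) =
    trans (solve 1 (λ a → con (+ 0) :+ (a :- con (+ 0)) := a) refl _) (sym (eulerian-last n i))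

  -- The last j terms appear as the total minus the rest, which is the shape of the upper part in
  -- the recursion of `eulerian`.
  Σ<-reverse : ∀ n (f : ℕ → Carrier) j j′ → j ℕ.+ j′ ≡ ℕ.suc n →
               Σ< j (λ k → f (n ℕ.∸ k)) ≈ Σ< (ℕ.suc n) f - Σ< j′ f
  Σ<-reverse n f ℕ.zero    j′ ≡.refl = sym (-‿inverseʳ _)
  Σ<-reverse n f (ℕ.suc j) j′ eq     = begin
    Σ< (ℕ.suc j) (λ k → f (n ℕ.∸ k))                      ≈⟨ Σ<-last j (λ k → f (n ℕ.∸ k)) ⟩
    Σ< j (λ k → f (n ℕ.∸ k)) + f (n ℕ.∸ j)                ≈⟨ +-cong
      (Σ<-reverse n f j (ℕ.suc j′) (≡.trans (ℕ.+-suc j j′) eq)) (reflexive (≡.cong f n∸j≡j′)) ⟩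
    (Σ< (ℕ.suc n) f - Σ< (ℕ.suc j′) f) + f j′             ≈⟨ +-congʳ (+-congˡ (-‿cong (Σ<-last j′ f))) ⟩
    (Σ< (ℕ.suc n) f - (Σ< j′ f + f j′)) + f j′            ≈⟨ solve 3 (λ s t a → (s :- (t :+ a)) :+ a :=
      s :- t) refl _ _ _ ⟩
    Σ< (ℕ.suc n) f - Σ< j′ f                              ∎
    where
    n∸j≡j′ : n ℕ.∸ j ≡ j′
    n∸j≡j′ = ≡.trans (≡.cong (ℕ._∸ j) (≡.sym (ℕ.suc-injective eq))) (ℕ.m+n∸m≡n j j′)

  -- Reversal turns the lower part of a level into an upper part, so the two halves of the recursion
  -- exchange. The outermost coefficients meet only one half and are treated separately.
  eulerian-symmetric : ∀ n j j′ i i′ → j ℕ.+ j′ ≡ n → i ℕ.+ i′ ≡ n → eulerian n j i ≈ eulerian n j′ i′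
  partialSum-symmetric : ∀ n j j′ i i′ → j ℕ.+ j′ ≡ ℕ.suc n → i ℕ.+ i′ ≡ n →
                         partialSum n j i ≈ partialSum n (ℕ.suc n) i′ - partialSum n j′ i′

  partialSum-symmetric n j j′ i i′ j+j′≡ i+i′≡ = trans
    (Σ<-cong j (λ k k<j → eulerian-symmetric n k (n ℕ.∸ k) i i′
      (ℕ.m+[n∸m]≡n (ℕ.s≤s⁻¹ (ℕ.<-≤-trans k<j (≡.subst (j ℕ.≤_) j+j′≡ (ℕ.m≤m+n j j′))))) i+i′≡))
    (Σ<-reverse n (λ k → eulerian n k i′) j j′ j+j′≡)

  private
    eulerian-symmetric-ends : ∀ n j j′ → j ℕ.+ j′ ≡ ℕ.suc n → eulerian (ℕ.suc n) j 0 ≈ eulerian (ℕ.suc n) j′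
      (ℕ.suc n)
    eulerian-symmetric-ends n j ℕ.zero eq =
      trans (reflexive (≡.cong (λ j → eulerian (ℕ.suc n) j 0) (≡.trans (≡.sym (ℕ.+-identityʳ j)) eq)))
        (trans (eulerian-constant-1 (ℕ.suc n)) (sym (eulerian-leading-1 (ℕ.suc n))))
    eulerian-symmetric-ends n j (ℕ.suc j′) eq =
      trans (eulerian-constant-0 (ℕ.suc n) j
        (≡.subst (j ℕ.<_) eq (≡.subst (j ℕ.<_) (≡.sym (ℕ.+-suc j j′)) (s<s (ℕ.m≤m+n j j′)))))
        (sym (eulerian-leading-0 n j′ (ℕ.s≤s⁻¹ (≡.subst (ℕ.suc j′ ℕ.≤_) eq (ℕ.m≤n+m (ℕ.suc j′) j)))))

  eulerian-symmetric ℕ.zero    ℕ.zero ℕ.zero ℕ.zero ℕ.zero _ _ = refl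
  eulerian-symmetric (ℕ.suc n) j j′ ℕ.zero i′ j+j′≡ ≡.refl = eulerian-symmetric-ends n j j′ j+j′≡
  eulerian-symmetric (ℕ.suc n) j j′ (ℕ.suc i) ℕ.zero j+j′≡ i≡ rewrite ≡.trans (≡.sym (ℕ.+-identityʳ i))
    (ℕ.suc-injective i≡) =
    sym (eulerian-symmetric-ends n j′ j (≡.trans (ℕ.+-comm j′ j) j+j′≡))
  eulerian-symmetric (ℕ.suc n) j j′ (ℕ.suc i) (ℕ.suc i′) j+j′≡ i+i′≡ = begin
    partialSum n j (ℕ.suc i) + (partialSum n (ℕ.suc n) i - partialSum n j i)
      ≈⟨ +-cong (partialSum-symmetric n j j′ (ℕ.suc i) i′ j+j′≡ 1+i+i′≡n)
                (+-cong (partialSum-symmetric n (ℕ.suc n) 0 i (ℕ.suc i′) (ℕ.+-identityʳ _) i+1+i′≡n)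
                        (-‿cong (partialSum-symmetric n j j′ i (ℕ.suc i′) j+j′≡ i+1+i′≡n))) ⟩
    (partialSum n (ℕ.suc n) i′ - partialSum n j′ i′) +
      ((partialSum n (ℕ.suc n) (ℕ.suc i′) - 0#) - (partialSum n (ℕ.suc n) (ℕ.suc i′) - partialSum n j′
        (ℕ.suc i′)))
      ≈⟨ solve 3 (λ a s t → a :+ ((s :- con (+ 0)) :- (s :- t)) := t :+ a) refl _ _ _ ⟩
    partialSum n j′ (ℕ.suc i′) + (partialSum n (ℕ.suc n) i′ - partialSum n j′ i′) ∎
    where
    i+1+i′≡n : i ℕ.+ ℕ.suc i′ ≡ n
    i+1+i′≡n = ℕ.suc-injective i+i′≡
    1+i+i′≡n : ℕ.suc i ℕ.+ i′ ≡ n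
    1+i+i′≡n = ≡.trans (≡.sym (ℕ.+-suc i i′)) i+1+i′≡n

-- Jets of the refined Eulerian polynomials

module EulerianJets (ℝ : CompleteOrderedField) (x : CompleteOrderedField.Carrier ℝ) where
  open CompleteOrderedField ℝ
  open Polynomials ℝ
  open IntegerSolver ℝ
  open Sums ℝ
  open Jets ℝ
  open Evaluation ℝ
  open Eulerian ℝ
  open WronskianPositivity ℝ x

  jet : ℕ → Series → Jet
  jet n f = eval n f x , derivative n f x

  jet-Σ : ∀ n m (c : ℕ → Carrier) (f : ℕ → Series) →
    jet n (λ i → Σ< m (λ k → c k * f k i)) ≈ᴶ Σᴶ m (λ k → c k * eval n (f k) x , c k * derivative n (f k) x)
  jet-Σ n ℕ.zero c f = eval-zero n , derivative-zero n
    where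
    eval-zero : ∀ n → eval n (λ _ → 0#) x ≈ 0#
    eval-zero ℕ.zero    = refl
    eval-zero (ℕ.suc n) = trans (+-identityˡ _) (trans (*-congˡ (eval-zero n)) (zeroʳ x))
    derivative-zero : ∀ n → derivative n (λ _ → 0#) x ≈ 0#
    derivative-zero ℕ.zero    = refl
    derivative-zero (ℕ.suc n) = trans (+-cong (eval-zero n) (trans (*-congˡ (derivative-zero n)) (zeroʳ x)))
      (+-identityˡ 0#)
  jet-Σ n (ℕ.suc m) c f =
    trans (eval-cong n x as-linear)
      (trans (eval-linear n (c 0) 1# (f 0) rest x)
        (+-congˡ (trans (*-identityˡ _) (proj₁ (jet-Σ n m (c ∘ ℕ.suc) (f ∘ ℕ.suc)))))) ,
    trans (derivative-cong n x as-linear)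
      (trans (derivative-linear n (c 0) 1# (f 0) rest x)
        (+-congˡ (trans (*-identityˡ _) (proj₂ (jet-Σ n m (c ∘ ℕ.suc) (f ∘ ℕ.suc))))))
    where
    rest : Series
    rest i = Σ< m (λ k → c (ℕ.suc k) * f (ℕ.suc k) i)
    as-linear : (λ i → Σ< (ℕ.suc m) (λ k → c k * f k i)) ≋ λ i → c 0 * f 0 i + 1# * rest i
    as-linear i = +-congˡ (sym (*-identityˡ _))

  jet-partialSum : ∀ n j → jet n (partialSum n j) ≈ᴶ Σᴶ j (λ k → jet n (eulerian n k))
  jet-partialSum n j =
    trans (eval-cong n x 1*) (trans (proj₁ (jet-Σ n j (λ _ → 1#) (eulerian n)))
      (Σ<-cong j (λ k _ → *-identityˡ (eval n (eulerian n k) x)))) ,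
    trans (derivative-cong n x 1*)
      (trans (proj₂ (jet-Σ n j (λ _ → 1#) (eulerian n)))
        (Σ<-cong j (λ k _ → *-identityˡ (derivative n (eulerian n k) x))))
    where
    1* : partialSum n j ≋ λ i → Σ< j (λ k → 1# * eulerian n k i)
    1* i = Σ<-cong j (λ k _ → sym (*-identityˡ (eulerian n k i)))

  -- The coefficient recursion, evaluated and differentiated, is `nextJet`. The partial sums have
  -- degree at most n, so evaluating them with the bound n + 1 changes nothing.
  jet-eulerian : ∀ n j → jet n (eulerian n j) ≈ᴶ level n j
  jet-eulerian ℕ.zero    j = refl , refl
  jet-eulerian (ℕ.suc n) j = eval-next , derivative-next
    where
    S T : Series
    S = partialSum n j
    T = partialSum n (ℕ.suc n)

    jet-sum : ∀ m → jet n (partialSum n m) ≈ᴶ Σᴶ m (level n)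
    jet-sum m = trans (proj₁ (jet-partialSum n m)) (Σ<-cong m (λ k _ → proj₁ (jet-eulerian n k))) ,
                trans (proj₂ (jet-partialSum n m)) (Σ<-cong m (λ k _ → proj₂ (jet-eulerian n k)))

    D : Series
    D i = 1# * T i + - 1# * S i

    as-linear : eulerian (ℕ.suc n) j ≋ λ i → 1# * S i + 1# * shift D i
    as-linear ℕ.zero    = solve 1 (λ s → s :+ con (+ 0) := con (+ 1) :* s :+ con (+ 1) :* con (+ 0)) refl (S 0)
    as-linear (ℕ.suc i) = solve 3 (λ s′ s t → s′ :+ (t :- s) :=
      con (+ 1) :* s′ :+ con (+ 1) :* (con (+ 1) :* t :+ :- con (+ 1) :* s)) refl (S (ℕ.suc i)) (S i) (T i)

    eval-next : eval (ℕ.suc n) (eulerian (ℕ.suc n) j) x ≈ proj₁ (level (ℕ.suc n) j)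
    eval-next = trans (eval-cong (ℕ.suc n) x as-linear) (trans (eval-linear (ℕ.suc n) 1# 1# S (shift D) x)
      (trans (+-cong (*-congˡ (trans (eval-suc n S x (partialSum-vanishes n j)) (proj₁ (jet-sum j))))
                     (*-congˡ (+-congˡ (*-congˡ
                       (trans (eval-linear n 1# (- 1#) T S x)
                         (+-cong (*-congˡ (proj₁ (jet-sum (ℕ.suc n)))) (*-congˡ (proj₁ (jet-sum j)))))))))
        (solve 3 (λ x s t → con (+ 1) :* s :+ con (+ 1) :* (con (+ 0) :+ x :* (con (+ 1) :* t :+ :- con (+ 1) :* s)) := s :+ x :* (t :- s)) refl x _ _)))

    derivative-next : derivative (ℕ.suc n) (eulerian (ℕ.suc n) j) x ≈ proj₂ (level (ℕ.suc n) j)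
    derivative-next = trans (derivative-cong (ℕ.suc n) x as-linear)
      (trans (derivative-linear (ℕ.suc n) 1# 1# S (shift D) x)
      (trans (+-cong (*-congˡ (trans (derivative-suc n S x (partialSum-vanishes n j)) (proj₂ (jet-sum j))))
                     (*-congˡ (+-cong
                        (trans (eval-linear n 1# (- 1#) T S x)
                          (+-cong (*-congˡ (proj₁ (jet-sum (ℕ.suc n)))) (*-congˡ (proj₁ (jet-sum j)))))
                        (*-congˡ (trans (derivative-linear n 1# (- 1#) T S x)
                          (+-cong (*-congˡ (proj₂ (jet-sum (ℕ.suc n)))) (*-congˡ (proj₂ (jet-sum j)))))))))
        (solve 5 (λ x s t s′ t′ →
          con (+ 1) :* s′ :+ con (+ 1) :* ((con (+ 1) :* t :+ :- con (+ 1) :* s) :+ x :* (con (+ 1) :* t′ :+ :- con (+ 1) :* s′)) :=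
           s′ :+ ((t :- s) :+ x :* (t′ :- s′))) refl x _ _ _ _)))

-- Expansion of the numerators in Eulerian polynomials

module Numerators (ℝ : CompleteOrderedField) where
  open CompleteOrderedField ℝ
  open Polynomials ℝ
  open IntegerSolver ℝ
  open OrderedField ℝ
  open RingProperties ring
  open Sums ℝ
  open Evaluation ℝ
  open Eulerian ℝ
  open SetoidReasoning setoid

  -- Multiplication by 1 - x.
  Δ : Series → Series
  Δ f j = f j - shift f j

  Δ^ : ℕ → Series → Series
  Δ^ ℕ.zero    f = f
  Δ^ (ℕ.suc k) f = Δ (Δ^ k f)

  Δ-cong : ∀ {f g} → f ≋ g → Δ f ≋ Δ g
  Δ-cong f≋g j = +-cong (f≋g j) (-‿cong (shift-cong f≋g j))

  Δ^-cong : ∀ k {f g} → f ≋ g → Δ^ k f ≋ Δ^ k g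
  Δ^-cong ℕ.zero    f≋g = f≋g
  Δ^-cong (ℕ.suc k) f≋g = Δ-cong (Δ^-cong k f≋g)

  Δ^-Δ : ∀ k f → Δ^ k (Δ f) ≋ Δ^ (ℕ.suc k) f
  Δ^-Δ ℕ.zero    f j = refl
  Δ^-Δ (ℕ.suc k) f   = Δ-cong (Δ^-Δ k f)

  Δ^-shift : ∀ k f → Δ^ k (shift f) ≋ shift (Δ^ k f)
  Δ^-shift ℕ.zero    f j = refl
  Δ^-shift (ℕ.suc k) f j = trans (Δ-cong (Δ^-shift k f) j) (Δ-shift j)
    where
    Δ-shift : Δ (shift (Δ^ k f)) ≋ shift (Δ^ (ℕ.suc k) f)
    Δ-shift ℕ.zero    = -‿inverseʳ 0#
    Δ-shift (ℕ.suc j) = refl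

  Δ^-linear : ∀ k a b f g → Δ^ k (λ j → a * f j + b * g j) ≋ λ j → a * Δ^ k f j + b * Δ^ k g j
  Δ^-linear ℕ.zero    a b f g j = refl
  Δ^-linear (ℕ.suc k) a b f g j = trans (Δ-cong (Δ^-linear k a b f g) j) (Δ-linear j)
    where
    Δ-linear : Δ (λ j → a * Δ^ k f j + b * Δ^ k g j) ≋ λ j → a * Δ^ (ℕ.suc k) f j + b * Δ^ (ℕ.suc k) g j
    Δ-linear ℕ.zero    = solve 4 (λ a b f g → a :* f :+ b :* g :- con (+ 0) :=
      a :* (f :- con (+ 0)) :+ b :* (g :- con (+ 0))) refl a b _ _
    Δ-linear (ℕ.suc j) = solve 6 (λ a b f f′ g g′ → (a :* f :+ b :* g) :- (a :* f′ :+ b :* g′) :=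
      a :* (f :- f′) :+ b :* (g :- g′)) refl a b _ _ _ _

  Δ^-Σ : ∀ k m (c : ℕ → Carrier) (f : ℕ → Series) →
         Δ^ k (λ i → Σ< m (λ t → c t * f t i)) ≋ λ i → Σ< m (λ t → c t * Δ^ k (f t) i)
  Δ^-Σ k ℕ.zero c f = Δ^-zero k
    where
    Δ^-zero : ∀ k → Δ^ k (λ _ → 0#) ≋ λ _ → 0#
    Δ^-zero ℕ.zero    j         = refl
    Δ^-zero (ℕ.suc k) ℕ.zero    = trans (+-congʳ (Δ^-zero k 0)) (-‿inverseʳ 0#)
    Δ^-zero (ℕ.suc k) (ℕ.suc j) = trans (+-cong (Δ^-zero k (ℕ.suc j)) (-‿cong (Δ^-zero k j))) (-‿inverseʳ 0#)
  Δ^-Σ k (ℕ.suc m) c f i = begin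
    Δ^ k (λ i → c 0 * f 0 i + rest i) i                 ≈⟨ Δ^-cong k
      (λ i → +-congˡ (sym (*-identityˡ (rest i)))) i ⟩
    Δ^ k (λ i → c 0 * f 0 i + 1# * rest i) i            ≈⟨ Δ^-linear k (c 0) 1# (f 0) rest i ⟩
    c 0 * Δ^ k (f 0) i + 1# * Δ^ k rest i               ≈⟨ +-congˡ
      (trans (*-identityˡ _) (Δ^-Σ k m (c ∘ ℕ.suc) (f ∘ ℕ.suc) i)) ⟩
    Σ< (ℕ.suc m) (λ t → c t * Δ^ k (f t) i)             ∎
    where
    rest : Series
    rest i = Σ< m (λ t → c (ℕ.suc t) * f (ℕ.suc t) i)

  private
    ⊛-congʳ : ∀ {f g} h → f ≋ g → f ⊛ h ≋ g ⊛ h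
    ⊛-congʳ h f≋g j = Σ<-cong (ℕ.suc j) (λ i _ → *-congʳ {h (j ℕ.∸ i)} (f≋g i))

    shift-⊛ : ∀ f h → shift f ⊛ h ≋ shift (f ⊛ h)
    shift-⊛ f h ℕ.zero    = trans (+-identityʳ _) (zeroˡ _)
    shift-⊛ f h (ℕ.suc j) = trans (+-congʳ (zeroˡ _)) (+-identityˡ _)

    linear-⊛-assoc : ∀ a b f h → (linear a b ⊛ f) ⊛ h ≋ λ j → a * (f ⊛ h) j + b * shift (f ⊛ h) j
    linear-⊛-assoc a b f h j = begin
      ((linear a b ⊛ f) ⊛ h) j                                  ≈⟨ ⊛-congʳ h (linear-⊛ a b f) j ⟩
      Σ< (ℕ.suc j) (λ i → (a * f i + b * shift f i) * h (j ℕ.∸ i))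
        ≈⟨ Σ<-cong (ℕ.suc j) (λ i _ → solve 5 (λ a b f f′ h → (a :* f :+ b :* f′) :* h :=
          a :* (f :* h) :+ b :* (f′ :* h)) refl a b (f i) (shift f i) (h (j ℕ.∸ i))) ⟩
      Σ< (ℕ.suc j) (λ i → a * (f i * h (j ℕ.∸ i)) + b * (shift f i * h (j ℕ.∸ i)))
        ≈⟨ Σ<-distrib-+ (ℕ.suc j) (λ i → a * (f i * h (j ℕ.∸ i))) (λ i → b * (shift f i * h (j ℕ.∸ i))) ⟩
      Σ< (ℕ.suc j) (λ i → a * (f i * h (j ℕ.∸ i))) + Σ< (ℕ.suc j) (λ i → b * (shift f i * h (j ℕ.∸ i)))
        ≈⟨ sym (+-cong (*-distribˡ-Σ< (ℕ.suc j) a (λ i → f i * h (j ℕ.∸ i)))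
          (*-distribˡ-Σ< (ℕ.suc j) b (λ i → shift f i * h (j ℕ.∸ i)))) ⟩
      a * (f ⊛ h) j + b * (shift f ⊛ h) j                       ≈⟨ +-congˡ (*-congˡ (shift-⊛ f h j)) ⟩
      a * (f ⊛ h) j + b * shift (f ⊛ h) j                       ∎

  [1-x]^-⊛ : ∀ k f → linear 1# (- 1#) ^ k ⊛ f ≋ Δ^ k f
  [1-x]^-⊛ ℕ.zero    f j = trans (constant-⊛ 1# f j) (*-identityˡ _)
  [1-x]^-⊛ (ℕ.suc k) f j = begin
    (linear 1# (- 1#) ^ ℕ.suc k ⊛ f) j          ≈⟨ linear-⊛-assoc 1# (- 1#) (linear 1# (- 1#) ^ k) f j ⟩
    1# * (linear 1# (- 1#) ^ k ⊛ f) j + - 1# * shift (linear 1# (- 1#) ^ k ⊛ f) j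
      ≈⟨ +-cong (trans (*-identityˡ _) ([1-x]^-⊛ k f j))
        (trans (-1*x≈-x _) (-‿cong (shift-cong ([1-x]^-⊛ k f) j))) ⟩
    Δ^ (ℕ.suc k) f j                            ∎

  -- For j ≤ n, the value (m + 1)ʲ mⁿ⁻ʲ.
  powers : ℕ → ℕ → Series
  powers ℕ.zero    j         m = 1#
  powers (ℕ.suc n) ℕ.zero    m = m · 1# * powers n 0 m
  powers (ℕ.suc n) (ℕ.suc j) m = (m · 1# + 1#) * powers n j m

  powers-suc : ∀ n j m → j ℕ.≤ n → powers (ℕ.suc n) j m ≈ m · 1# * powers n j m
  powers-suc n         ℕ.zero    m _         = refl
  powers-suc (ℕ.suc n) (ℕ.suc j) m (s≤s j≤n) =
    trans (*-congˡ (powers-suc n j m j≤n))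
      (solve 3 (λ a b c → a :* (b :* c) := b :* (a :* c)) refl (m · 1# + 1#) (m · 1#) (powers n j m))

  powers-first : ∀ n → powers (ℕ.suc n) 0 ≋ shift (powers (ℕ.suc n) (ℕ.suc n))
  powers-first n ℕ.zero    = zeroˡ _
  powers-first n (ℕ.suc m) = step n
    where
    step : ∀ n → powers (ℕ.suc n) 0 (ℕ.suc m) ≈ powers (ℕ.suc n) (ℕ.suc n) m
    step ℕ.zero    = *-congʳ (+-comm _ _)
    step (ℕ.suc n) = *-cong (+-comm _ _) (step n)

  private
    -- Telescoping: raising the exponent of m + 1 at the expense of that of m adds ((m + 1) - m)
    -- times the value of the previous level.
    powers-Σ : ∀ n j m → j ℕ.≤ ℕ.suc n → powers (ℕ.suc n) j m ≈ powers (ℕ.suc n) 0 m + Σ< j (λ k → powers n k m)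
    powers-Σ n ℕ.zero    m _         = sym (+-identityʳ _)
    powers-Σ n (ℕ.suc j) m (s≤s j≤n) = begin
      (m · 1# + 1#) * powers n j m                                        ≈⟨ solve 2
        (λ a b → (a :+ con (+ 1)) :* b := a :* b :+ b) refl _ _ ⟩
      m · 1# * powers n j m + powers n j m                                ≈⟨ +-congʳ
        (sym (powers-suc n j m j≤n)) ⟩
      powers (ℕ.suc n) j m + powers n j m                                 ≈⟨ +-congʳ
        (powers-Σ n j m (ℕ.m≤n⇒m≤1+n j≤n)) ⟩
      powers (ℕ.suc n) 0 m + Σ< j (λ k → powers n k m) + powers n j m     ≈⟨ +-assoc _ _ _ ⟩
      powers (ℕ.suc n) 0 m + (Σ< j (λ k → powers n k m) + powers n j m)   ≈⟨ +-congˡ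
        (sym (Σ<-last j (λ k → powers n k m))) ⟩
      powers (ℕ.suc n) 0 m + Σ< (ℕ.suc j) (λ k → powers n k m)            ∎

    powersSum : ℕ → ℕ → Series
    powersSum n j m = Σ< j (λ k → powers n k m)

    difference : ℕ → ℕ → Series
    difference n j m = 1# * powersSum n (ℕ.suc n) m + - 1# * powersSum n j m

    -- Expand by `powers-Σ` and write the initial m^(n+1) as the previous term of (m + 1)^(n+1). The
    -- two shifted initial terms cancel, leaving the recursion of `eulerian`.
    Δ-powers : ∀ n j → j ℕ.≤ ℕ.suc n → Δ (powers (ℕ.suc n) j) ≋ λ m → 1# * powersSum n j m + 1# * shift
      (difference n j) m
    Δ-powers n j j≤ m = begin
      powers (ℕ.suc n) j m - shift (powers (ℕ.suc n) j) m
        ≈⟨ +-cong (trans (powers-Σ n j m j≤)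
          (+-congʳ (trans (powers-first n m) (shift-cong (λ m → powers-Σ n (ℕ.suc n) m ℕ.≤-refl) m))))
                  (-‿cong (shift-cong (λ m → powers-Σ n j m j≤) m)) ⟩
      (shift (λ m → powers (ℕ.suc n) 0 m + powersSum n (ℕ.suc n) m) m + powersSum n j m) -
        shift (λ m → powers (ℕ.suc n) 0 m + powersSum n j m) m
        ≈⟨ collect m ⟩
      1# * powersSum n j m + 1# * shift (difference n j) m ∎
      where
      collect : ∀ m → (shift (λ m → powers (ℕ.suc n) 0 m + powersSum n (ℕ.suc n) m) m + powersSum n j m) -
        shift (λ m → powers (ℕ.suc n) 0 m + powersSum n j m) m ≈ 1# * powersSum n j m + 1# * shift
          (difference n j) m
      collect ℕ.zero    = solve 1 (λ s → (con (+ 0) :+ s) :- con (+ 0) :=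
        con (+ 1) :* s :+ con (+ 1) :* con (+ 0)) refl _
      collect (ℕ.suc m) = solve 4 (λ p t s s′ → (p :+ t :+ s′) :- (p :+ s) :=
        con (+ 1) :* s′ :+ con (+ 1) :* (con (+ 1) :* t :+ :- con (+ 1) :* s)) refl
        (powers (ℕ.suc n) 0 m) (powersSum n (ℕ.suc n) m) (powersSum n j m) (powersSum n j (ℕ.suc m))

  -- One factor 1 - x lowers the level by `Δ-powers`; the remaining n + 1 factors are handled by
  -- induction.
  numerator-powers : ∀ n j → j ℕ.≤ n → Δ^ (ℕ.suc n) (powers n j) ≋ eulerian n j
  numerator-powers ℕ.zero    j j≤n ℕ.zero    = solve 0 (con (+ 1) :- con (+ 0) := con (+ 1)) refl
  numerator-powers ℕ.zero    j j≤n (ℕ.suc m) = -‿inverseʳ 1#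
  numerator-powers (ℕ.suc n) j j≤ i = begin
    Δ^ (ℕ.suc (ℕ.suc n)) (powers (ℕ.suc n) j) i           ≈⟨ Δ^-Δ (ℕ.suc n) (powers (ℕ.suc n) j) i ⟨
    Δ^ (ℕ.suc n) (Δ (powers (ℕ.suc n) j)) i               ≈⟨ Δ^-cong (ℕ.suc n) (Δ-powers n j j≤) i ⟩
    Δ^ (ℕ.suc n) (λ m → 1# * powersSum n j m + 1# * shift (difference n j) m) i
      ≈⟨ Δ^-linear (ℕ.suc n) 1# 1# (powersSum n j) (shift (difference n j)) i ⟩
    1# * Δ^ (ℕ.suc n) (powersSum n j) i + 1# * Δ^ (ℕ.suc n) (shift (difference n j)) i
      ≈⟨ +-cong (*-congˡ (sum-numerator j j≤ i)) (*-congˡ (trans (Δ^-shift (ℕ.suc n) (difference n j) i)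
           (shift-cong (λ i → trans (Δ^-linear (ℕ.suc n) 1# (- 1#) (powersSum n (ℕ.suc n)) (powersSum n j) i)
             (+-cong (*-congˡ (sum-numerator (ℕ.suc n) ℕ.≤-refl i)) (*-congˡ (sum-numerator j j≤ i)))) i))) ⟩
    1# * partialSum n j i + 1# * shift (λ i → 1# * partialSum n (ℕ.suc n) i + - 1# * partialSum n j i) i
      ≈⟨ +-cong (*-identityˡ _)
        (trans (*-identityˡ _) (shift-cong (λ i → +-cong (*-identityˡ _) (-1*x≈-x _)) i)) ⟩
    eulerian (ℕ.suc n) j i                                ∎
    where
    sum-numerator : ∀ j → j ℕ.≤ ℕ.suc n → Δ^ (ℕ.suc n) (powersSum n j) ≋ partialSum n j
    sum-numerator j j≤ i = begin
      Δ^ (ℕ.suc n) (powersSum n j) i                                  ≈⟨ Δ^-cong (ℕ.suc n)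
        (λ m → Σ<-cong j (λ k _ → sym (*-identityˡ (powers n k m)))) i ⟩
      Δ^ (ℕ.suc n) (λ m → Σ< j (λ k → 1# * powers n k m)) i           ≈⟨ Δ^-Σ (ℕ.suc n) j (λ _ → 1#)
        (powers n) i ⟩
      Σ< j (λ k → 1# * Δ^ (ℕ.suc n) (powers n k) i)
        ≈⟨ Σ<-cong j (λ k k<j → trans (*-identityˡ _) (numerator-powers n k (ℕ.s≤s⁻¹ (ℕ.<-≤-trans k<j j≤)) i)) ⟩
      partialSum n j i                                                ∎

  -- The coefficients of ∏ᵢ (rᵢ t + (1 - rᵢ)).
  weights : ∀ {n} → (Fin n → Carrier) → Series
  weights {ℕ.zero}  r   = constant 1#
  weights {ℕ.suc n} r j = r Fin.zero * shift (weights (r ∘ Fin.suc)) j + (1# - r Fin.zero) * weights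
    (r ∘ Fin.suc) j

  weights-vanishes : ∀ {n} (r : Fin n → Carrier) → VanishesAbove n (weights r)
  weights-vanishes {ℕ.zero}  r (ℕ.suc j) _         = refl
  weights-vanishes {ℕ.suc n} r (ℕ.suc j) (s<s n<j) =
    trans (+-cong (trans (*-congˡ (weights-vanishes (r ∘ Fin.suc) j n<j)) (zeroʳ _))
                  (trans (*-congˡ (weights-vanishes (r ∘ Fin.suc) (ℕ.suc j) (ℕ.m<n⇒m<1+n n<j))) (zeroʳ _)))
      (+-identityˡ 0#)

  -- Expand each factor as m + r = r (m + 1) + (1 - r) m.
  ∏-powers : ∀ {n} (r : Fin n → Carrier) m → ∏ (λ i → m · 1# + r i) ≈ Σ< (ℕ.suc n)
    (λ j → weights r j * powers n j m)
  ∏-powers {ℕ.zero}  r m = solve 0 (con (+ 1) := con (+ 1) :* con (+ 1) :+ con (+ 0)) refl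
  ∏-powers {ℕ.suc n} r m = begin
    (m · 1# + ρ) * ∏ (λ i → m · 1# + r (Fin.suc i))                       ≈⟨ *-congˡ
      (∏-powers (r ∘ Fin.suc) m) ⟩
    (m · 1# + ρ) * Σ< (ℕ.suc n) (λ j → w j * powers n j m)                ≈⟨ *-distribˡ-Σ< (ℕ.suc n)
      (m · 1# + ρ) (λ j → w j * powers n j m) ⟩
    Σ< (ℕ.suc n) (λ j → (m · 1# + ρ) * (w j * powers n j m))              ≈⟨ Σ<-cong (ℕ.suc n)
      (λ j j<1+n → expand j (ℕ.s≤s⁻¹ j<1+n)) ⟩
    Σ< (ℕ.suc n) (λ j → up j + stay j)                                    ≈⟨ Σ<-distrib-+ (ℕ.suc n) up stay ⟩
    Σ< (ℕ.suc n) up + Σ< (ℕ.suc n) stay                                   ≈⟨ +-cong up-first stay-last ⟩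
    Σ< (ℕ.suc (ℕ.suc n)) (λ j → ρ * shift w j * P j) + Σ< (ℕ.suc (ℕ.suc n)) stay
      ≈⟨ Σ<-distrib-+ (ℕ.suc (ℕ.suc n)) (λ j → ρ * shift w j * P j) stay ⟨
    Σ< (ℕ.suc (ℕ.suc n)) (λ j → ρ * shift w j * P j + stay j)             ≈⟨ Σ<-cong (ℕ.suc (ℕ.suc n))
      (λ j _ → sym (distribʳ (P j) (ρ * shift w j) ((1# - ρ) * w j))) ⟩
    Σ< (ℕ.suc (ℕ.suc n)) (λ j → weights r j * P j)                        ∎
    where
    ρ = r Fin.zero
    w : Series
    w = weights (r ∘ Fin.suc)
    P : ℕ → Carrier
    P j = powers (ℕ.suc n) j m
    up stay : ℕ → Carrier
    up j   = ρ * w j * P (ℕ.suc j)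
    stay j = (1# - ρ) * w j * P j

    expand : ∀ j → j ℕ.≤ n → (m · 1# + ρ) * (w j * powers n j m) ≈ up j + stay j
    expand j j≤n = trans
      (solve 4 (λ a ρ w p → (a :+ ρ) :* (w :* p) :=
        ρ :* w :* ((a :+ con (+ 1)) :* p) :+ (con (+ 1) :- ρ) :* w :* (a :* p)) refl (m · 1#) ρ (w j)
          (powers n j m))
      (+-congˡ (*-congˡ (sym (powers-suc n j m j≤n))))

    up-first : Σ< (ℕ.suc n) up ≈ Σ< (ℕ.suc (ℕ.suc n)) (λ j → ρ * shift w j * P j)
    up-first = sym (trans (+-congʳ (trans (*-congʳ (zeroʳ ρ)) (zeroˡ (P 0)))) (+-identityˡ _))

    stay-last : Σ< (ℕ.suc n) stay ≈ Σ< (ℕ.suc (ℕ.suc n)) stay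
    stay-last = sym (trans (Σ<-last (ℕ.suc n) stay)
      (trans (+-congˡ (trans (*-congʳ
        (trans (*-congˡ (weights-vanishes (r ∘ Fin.suc) (ℕ.suc n) ℕ.≤-refl)) (zeroʳ _))) (zeroˡ _)))
          (+-identityʳ _)))

  numerator-eulerian : ∀ {n} (r : Fin n → Carrier) h → IsNumerator r h → h ≋ λ i → Σ< (ℕ.suc n)
    (λ j → weights r j * eulerian n j i)
  numerator-eulerian {n} r h (_ , numerator) i = begin
    h i                                                                           ≈⟨ numerator i ⟨
    (linear 1# (- 1#) ^ ℕ.suc n ⊛ (λ m → ∏ (λ i → m · 1# + r i))) i               ≈⟨ [1-x]^-⊛ (ℕ.suc n)
      (λ m → ∏ (λ i → m · 1# + r i)) i ⟩
    Δ^ (ℕ.suc n) (λ m → ∏ (λ i → m · 1# + r i)) i                                 ≈⟨ Δ^-cong (ℕ.suc n)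
      (∏-powers r) i ⟩
    Δ^ (ℕ.suc n) (λ m → Σ< (ℕ.suc n) (λ j → weights r j * powers n j m)) i        ≈⟨ Δ^-Σ (ℕ.suc n) (ℕ.suc n)
      (weights r) (powers n) i ⟩
    Σ< (ℕ.suc n) (λ j → weights r j * Δ^ (ℕ.suc n) (powers n j) i)                ≈⟨ Σ<-cong (ℕ.suc n)
      (λ j j<1+n → *-congˡ {weights r j} (numerator-powers n j (ℕ.s≤s⁻¹ j<1+n) i)) ⟩
    Σ< (ℕ.suc n) (λ j → weights r j * eulerian n j i)                             ∎

-- Likelihood ratio order of the weights

module LikelihoodRatio (ℝ : CompleteOrderedField) where
  open CompleteOrderedField ℝ
  open Polynomials ℝ
  open IntegerSolver ℝ
  open OrderedField ℝ
  open Sums ℝ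
  open Evaluation ℝ
  open Numerators ℝ

  -- For i + d + k = n this is the likelihood ratio order between e and the
  -- reversal of ẽ; the larger sums compare e with its shifts and make the
  -- relation inductive.
  Dominates : ℕ → Series → Series → Set
  Dominates n e ẽ = ∀ i k d → n ℕ.≤ i ℕ.+ d ℕ.+ k → e (i ℕ.+ d) * ẽ (k ℕ.+ d) ≤ e i * ẽ k

  weights-nonNeg : ∀ {n} (r : Fin n → Carrier) → (∀ i → 0# ≤ r i × r i ≤ 1#) → ∀ j → 0# ≤ weights r j
  weights-nonNeg {ℕ.zero}  r r∈ ℕ.zero    = proj₁ 0<1
  weights-nonNeg {ℕ.zero}  r r∈ (ℕ.suc j) = ≤-refl
  weights-nonNeg {ℕ.suc n} r r∈ j =
    +-nonNeg (*-nonNeg (proj₁ (r∈ Fin.zero)) (shifted j))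
             (*-nonNeg (x≤y⇒0≤y-x (proj₂ (r∈ Fin.zero))) (weights-nonNeg (r ∘ Fin.suc) (r∈ ∘ Fin.suc) j))
    where
    shifted : ∀ j → 0# ≤ shift (weights (r ∘ Fin.suc)) j
    shifted ℕ.zero    = ≤-refl
    shifted (ℕ.suc j) = weights-nonNeg (r ∘ Fin.suc) (r∈ ∘ Fin.suc) j

  private
    0≤-both : ∀ {x y z w} → x * y ≈ 0# → 0# ≤ z → 0# ≤ w → x * y ≤ z * w
    0≤-both xy≈0 0≤z 0≤w = ≤-respˡ-≈ (sym xy≈0) (*-nonNeg 0≤z 0≤w)

    module Step {n : ℕ} {e ẽ : Series} (0≤e : ∀ j → 0# ≤ e j) (0≤ẽ : ∀ j → 0# ≤ ẽ j)
                (e-vanishes : VanishesAbove n e) (ẽ-vanishes : VanishesAbove n ẽ) (dominates : Dominates n e ẽ) where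

      0≤shift-e : ∀ j → 0# ≤ shift e j
      0≤shift-e ℕ.zero    = ≤-refl
      0≤shift-e (ℕ.suc j) = 0≤e j

      0≤shift-ẽ : ∀ j → 0# ≤ shift ẽ j
      0≤shift-ẽ ℕ.zero    = ≤-refl
      0≤shift-ẽ (ℕ.suc j) = 0≤ẽ j

      sum-comm : ∀ k d → n ℕ.< d ℕ.+ k → n ℕ.< k ℕ.+ d
      sum-comm k d = ≡.subst (n ℕ.<_) (ℕ.+-comm d k)

      -- Shifting costs one unit of the index sum, which n + 1 affords. At i = 0 the left side
      -- vanishes because k + d exceeds the degree bound.
      shift-e : ∀ i k d → n ℕ.< i ℕ.+ d ℕ.+ k → shift e (i ℕ.+ d) * ẽ (k ℕ.+ d) ≤ shift e i * ẽ k
      shift-e ℕ.zero    k d n< = 0≤-both (trans (*-congˡ (ẽ-vanishes (k ℕ.+ d) (sum-comm k d n<))) (zeroʳ _))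
        (0≤shift-e 0) (0≤ẽ k)
      shift-e (ℕ.suc i) k d n< = dominates i k d (ℕ.s≤s⁻¹ n<)

      shift-ẽ : ∀ i k d → n ℕ.< i ℕ.+ d ℕ.+ k → e (i ℕ.+ d) * shift ẽ (k ℕ.+ d) ≤ e i * shift ẽ k
      shift-ẽ i ℕ.zero    d n< =
        0≤-both (trans (*-congʳ (e-vanishes (i ℕ.+ d) (≡.subst (n ℕ.<_) (ℕ.+-identityʳ (i ℕ.+ d)) n<)))
          (zeroˡ _)) (0≤e i) (0≤shift-ẽ 0)
      shift-ẽ i (ℕ.suc k) d n< = dominates i k d (ℕ.s≤s⁻¹ (≡.subst (n ℕ.<_) (ℕ.+-suc (i ℕ.+ d) k) n<))

      -- The two products are not comparable one by one when i + d + k = n + 1,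
      -- so e ẽ is compared with the shifted product and conversely.
      shift-both : ∀ i k d → n ℕ.< i ℕ.+ d ℕ.+ k →
                   0# ≤ (e i * ẽ k + shift e i * shift ẽ k) - (e (i ℕ.+ d) * ẽ (k ℕ.+ d) + shift e
                     (i ℕ.+ d) * shift ẽ (k ℕ.+ d))
      shift-both i k ℕ.zero n< rewrite ℕ.+-identityʳ i | ℕ.+-identityʳ k = ≤-reflexive (sym (-‿inverseʳ _))
      shift-both i k (ℕ.suc d) n< = ≤-respʳ-≈
        (solve 4 (λ a b c d → (a :- d) :+ (b :- c) := (a :+ b) :- (c :+ d)) refl _ _ _ _)
        (+-nonNeg (x≤y⇒0≤y-x down) (x≤y⇒0≤y-x (up i k n<)))
        where
        down : shift e (i ℕ.+ ℕ.suc d) * shift ẽ (k ℕ.+ ℕ.suc d) ≤ e i * ẽ k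
        down rewrite ℕ.+-suc i d | ℕ.+-suc k d = dominates i k d (ℕ.s≤s⁻¹ n<)

        up : ∀ i k → n ℕ.< i ℕ.+ ℕ.suc d ℕ.+ k → e (i ℕ.+ ℕ.suc d) * ẽ (k ℕ.+ ℕ.suc d) ≤ shift e i * shift ẽ k
        up ℕ.zero k n< = 0≤-both (trans (*-congˡ (ẽ-vanishes (k ℕ.+ ℕ.suc d) (sum-comm k (ℕ.suc d) n<)))
          (zeroʳ _)) (0≤shift-e 0) (0≤shift-ẽ k)
        up (ℕ.suc i) ℕ.zero n< =
          0≤-both (trans (*-congʳ (e-vanishes (ℕ.suc i ℕ.+ ℕ.suc d) (≡.subst (n ℕ.<_) (ℕ.+-identityʳ _) n<)))
            (zeroˡ _)) (0≤shift-e (ℕ.suc i)) (0≤shift-ẽ 0)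
        up (ℕ.suc i) (ℕ.suc k) n< =
          ≡.subst₂ (λ a b → e a * ẽ b ≤ e i * ẽ k) (ℕ.+-suc i (ℕ.suc d)) (ℕ.+-suc k (ℕ.suc d))
            (dominates i k (ℕ.suc (ℕ.suc d)) (≡.subst (n ℕ.≤_) eq (ℕ.s≤s⁻¹ n<)))
          where
          eq : i ℕ.+ ℕ.suc d ℕ.+ ℕ.suc k ≡ i ℕ.+ ℕ.suc (ℕ.suc d) ℕ.+ k
          eq = ≡.trans (ℕ.+-suc (i ℕ.+ ℕ.suc d) k) (≡.cong (ℕ._+ k) (≡.sym (ℕ.+-suc i (ℕ.suc d))))

      -- Write (1 - ρ)(1 - τ) as ρτ + (1 - ρ - τ). The first part joins the doubly shifted product,
      -- which has no sign alone; the second is nonnegative exactly by ρ + τ ≤ 1.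
      step : ∀ ρ τ → 0# ≤ ρ → ρ ≤ 1# → 0# ≤ τ → τ ≤ 1# → ρ + τ ≤ 1# →
             Dominates (ℕ.suc n) (λ j → ρ * shift e j + (1# - ρ) * e j) (λ j → τ * shift ẽ j + (1# - τ) * ẽ j)
      step ρ τ 0≤ρ ρ≤1 0≤τ τ≤1 ρ+τ≤1 i k d n< = ≤-by-difference
        (solve 10 (λ ρ τ a a′ b b′ c c′ d d′ → let 1′ = con (+ 1) in
          (ρ :* a′ :+ (1′ :- ρ) :* a) :* (τ :* b′ :+ (1′ :- τ) :* b) :- (ρ :* c′ :+
            (1′ :- ρ) :* c) :* (τ :* d′ :+ (1′ :- τ) :* d) :=
          (ρ :* τ) :* ((a :* b :+ a′ :* b′) :- (c :* d :+ c′ :* d′)) :+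
            (1′ :- (ρ :+ τ)) :* (a :* b :- c :* d) :+
          (ρ :* (1′ :- τ)) :* (a′ :* b :- c′ :* d) :+ ((1′ :- ρ) :* τ) :* (a :* b′ :- c :* d′))
          refl ρ τ (e i) (shift e i) (ẽ k) (shift ẽ k) (e (i ℕ.+ d)) (shift e (i ℕ.+ d)) (ẽ (k ℕ.+ d))
            (shift ẽ (k ℕ.+ d)))
        (+-nonNeg (+-nonNeg (+-nonNeg
          (*-nonNeg (*-nonNeg 0≤ρ 0≤τ) (shift-both i k d n<))
          (*-nonNeg (x≤y⇒0≤y-x ρ+τ≤1) (x≤y⇒0≤y-x (dominates i k d (ℕ.<⇒≤ n<)))))
          (*-nonNeg (*-nonNeg 0≤ρ (x≤y⇒0≤y-x τ≤1)) (x≤y⇒0≤y-x (shift-e i k d n<))))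
          (*-nonNeg (*-nonNeg (x≤y⇒0≤y-x ρ≤1) 0≤τ) (x≤y⇒0≤y-x (shift-ẽ i k d n<))))

  weights-dominate : ∀ {n} (r s : Fin n → Carrier) → (∀ i → 0# ≤ r i × r i ≤ 1#) → (∀ i → 0# ≤ s i × s i ≤ 1#) →
                     (∀ i → r i + s i ≤ 1#) → Dominates n (weights r) (weights s)
  weights-dominate {ℕ.zero} r s r∈ s∈ r+s≤1 i k ℕ.zero    n≤ rewrite ℕ.+-identityʳ i | ℕ.+-identityʳ k = ≤-refl
  weights-dominate {ℕ.zero} r s r∈ s∈ r+s≤1 i k (ℕ.suc d) n≤ =
    0≤-both (trans (*-congʳ (weights-vanishes r (i ℕ.+ ℕ.suc d) (≡.subst (0 ℕ.<_) (≡.sym (ℕ.+-suc i d)) z<s)))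
      (zeroˡ _))
      (weights-nonNeg r r∈ i) (weights-nonNeg s s∈ k)
  weights-dominate {ℕ.suc n} r s r∈ s∈ r+s≤1 = step (r Fin.zero) (s Fin.zero)
    (proj₁ (r∈ Fin.zero)) (proj₂ (r∈ Fin.zero)) (proj₁ (s∈ Fin.zero)) (proj₂ (s∈ Fin.zero)) (r+s≤1 Fin.zero)
    where
    open Step (weights-nonNeg (r ∘ Fin.suc) (r∈ ∘ Fin.suc)) (weights-nonNeg (s ∘ Fin.suc) (s∈ ∘ Fin.suc))
      (weights-vanishes (r ∘ Fin.suc)) (weights-vanishes (s ∘ Fin.suc))
      (weights-dominate (r ∘ Fin.suc) (s ∘ Fin.suc) (r∈ ∘ Fin.suc) (s∈ ∘ Fin.suc) (r+s≤1 ∘ Fin.suc))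

  private
    *-Σ<-mono : ∀ N {x y} {f g : ℕ → Carrier} → (∀ l → l ℕ.< N → x * f l ≤ y * g l) → x * Σ< N f ≤ y * Σ< N g
    *-Σ<-mono N {x} {y} {f} {g} le = ≤-by-difference
      (trans (+-cong (*-distribˡ-Σ< N y g)
        (trans (solve 2 (λ x s → :- (x :* s) := (:- x) :* s) refl x _) (*-distribˡ-Σ< N (- x) f)))
        (sym (Σ<-distrib-+ N (λ l → y * g l) (λ l → - x * f l))))
      (Σ<-nonNeg N (λ l l<N → ≤-respʳ-≈ (+-congˡ (solve 2 (λ x s → :- (x :* s) := (:- x) :* s) refl x (f l)))
        (x≤y⇒0≤y-x (le l l<N))))

  Σ<-*-mono : ∀ N {f f′ g g′ : ℕ → Carrier} → (∀ k l → k ℕ.< N → l ℕ.< N → f k * f′ l ≤ g k * g′ l) →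
              Σ< N f * Σ< N f′ ≤ Σ< N g * Σ< N g′
  Σ<-*-mono N {f} {f′} {g} {g′} le =
    ≤-respˡ-≈ (*-comm _ _) (≤-respʳ-≈ (*-comm _ _) (*-Σ<-mono N {f = f} {g = g} (λ k k<N →
      ≤-respˡ-≈ (*-comm (f k) _)
        (≤-respʳ-≈ (*-comm (g k) _) (*-Σ<-mono N {f = f′} {g = g′} (λ l l<N → le k l k<N l<N))))))

  -- The products expand into double sums over pairs (k, l), so domination is required of every pair
  -- and not only of k = l.
  dominates-Σ : ∀ n N (c : ℕ → Carrier) (e ẽ : ℕ → Series) → (∀ k → 0# ≤ c k) →
                (∀ k l → Dominates n (e k) (ẽ l)) →
                Dominates n (λ j → Σ< N (λ k → c k * e k j)) (λ j → Σ< N (λ k → c k * ẽ k j))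
  dominates-Σ n N c e ẽ 0≤c dominates i k d n≤ = Σ<-*-mono N (λ s t _ _ → ≤-by-difference
    (solve 6 (λ a b p q p′ q′ → (a :* p) :* (b :* q) :- (a :* p′) :* (b :* q′) :=
      (a :* b) :* (p :* q :- p′ :* q′)) refl (c s) (c t) (e s i) (ẽ t k) (e s (i ℕ.+ d)) (ẽ t (k ℕ.+ d)))
    (*-nonNeg (*-nonNeg (0≤c s) (0≤c t)) (x≤y⇒0≤y-x (dominates s t i k d n≤))))

-- Polynomials with positive leading coefficient and given zeros

module FactoredPolynomials (ℝ : CompleteOrderedField) where
  open CompleteOrderedField ℝ
  open Polynomials ℝ
  open IntegerSolver ℝ
  open OrderedField ℝ
  open RingProperties ring
  open Evaluation ℝ
  open Roots ℝ
  open SplitPolynomials ℝ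

  -- With `scale` positive, interlacing zeros always lead to the same-sign constructor of `≪`.
  record Factored (n : ℕ) (f : Series) (rs : List Carrier) : Set where
    constructor factored
    field
      scale       : Carrier
      0<scale     : 0# < scale
      f≋          : f ≋ constant scale ⊛ monic rs
      length-rs   : length rs ≡ n

  module _ {n f rs} (f-factored : Factored n f rs) where
    open Factored f-factored

    f≈ : ∀ j → f j ≈ scale * monic rs j
    f≈ j = trans (f≋ j) (constant-⊛ scale (monic rs) j)

    private
      as-linear : f ≋ λ j → scale * monic rs j + 0# * monic rs j
      as-linear j = trans (f≈ j) (solve 2 (λ c m → c :* m := c :* m :+ con (+ 0) :* m) refl _ _)

      only-first : ∀ c a → c * a + 0# * a ≈ c * a
      only-first c a = solve 2 (λ c m → c :* m :+ con (+ 0) :* m := c :* m) refl c a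

    factored-eval : ∀ x → eval n f x ≈ scale * eval-monic rs x
    factored-eval x = ≡.subst (λ n → eval n f x ≈ scale * eval-monic rs x) length-rs
      (trans (eval-cong (length rs) x as-linear)
        (trans (eval-linear (length rs) scale 0# (monic rs) (monic rs) x) (only-first _ _)))

    factored-derivative : ∀ x → derivative n f x ≈ scale * derivative-monic rs x
    factored-derivative x = ≡.subst (λ n → derivative n f x ≈ scale * derivative-monic rs x) length-rs
      (trans (derivative-cong (length rs) x as-linear)
        (trans (derivative-linear (length rs) scale 0# (monic rs) (monic rs) x) (only-first _ _)))

    factored-roots : All (λ r → eval n f r ≈ 0#) rs
    factored-roots = All.map (λ {y} root → trans (factored-eval y) (trans (*-congˡ root) (zeroʳ _)))
      (monic-root rs)

    factored-derivative-alternates : Descending rs → Alternates (derivative n f) rs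
    factored-derivative-alternates desc = alternates-sameSign
      (All.universal (λ y → sameSign-positive-multiple (derivative-monic rs) (derivative n f) y scale 0<scale
        (factored-derivative y)) rs)
      (derivative-monic-alternates rs desc)

    factored-interlaced : ∀ ys → length ys ℕ.≤ length rs → Descending (zigzag rs ys) → Alternates
      (λ y → - eval n f y) ys
    factored-interlaced ys len desc = alternates-sameSign
      (All.universal (λ y → sameSign-positive-multiple (λ y → - eval-monic rs y)
        (λ y → - eval n f y) y scale 0<scale
        (trans (-‿cong (factored-eval y)) (-‿distribʳ-* _ _))) ys)
      (interlaced⇒alternates rs ys len desc)

    factored-leading : 0# < f (length rs)
    factored-leading = <-respʳ-≈
      (sym (trans (f≈ (length rs)) (trans (*-congˡ (monic-leading rs)) (*-identityʳ scale)))) 0<scale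

    factored-degree : Degree f (length rs)
    factored-degree = proj₂ factored-leading ∘ sym ,
      λ j n<j → trans (f≈ j) (trans (*-congˡ (monic-vanishes rs j n<j)) (zeroʳ scale))

    factored-hasZeros : HasZeros f rs
    factored-hasZeros = scale , proj₂ 0<scale ∘ sym , f≋

  interlaced⇒≪ : ∀ {m n f g rs ss} → Factored m f rs → Factored n g ss →
                 length rs ≡ ℕ.suc (length ss) ⊎ length rs ≡ length ss →
                 Linked (flip _≤_) (zigzag rs ss) → g ≪ f
  interlaced⇒≪ {rs = rs} {ss = ss} f-factored g-factored lengths linked = ≪⁺
    (rs , ss , factored-hasZeros f-factored , factored-hasZeros g-factored , lengths , linked)
    (length ss , length rs , factored-degree g-factored , factored-degree f-factored ,
      *-pos (factored-leading g-factored) (factored-leading f-factored))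

  factored-shift : ∀ {n f rs} → f 0 ≈ 0# → Factored n (f ∘ ℕ.suc) rs → Factored (ℕ.suc n) f (0# ∷ rs)
  factored-shift {n} {f} {rs} f₀≈0 (factored c 0<c f≋ len) = factored c 0<c (factored-∷ c rs 0# f≋shift f≋)
    (≡.cong ℕ.suc len)
    where
    f≋shift : f ≋ times-root 0# (f ∘ ℕ.suc)
    f≋shift ℕ.zero    = trans f₀≈0
      (solve 1 (λ a → con (+ 0) := :- con (+ 0) :* a :+ con (+ 1) :* con (+ 0)) refl _)
    f≋shift (ℕ.suc j) = solve 2 (λ a b → b := :- con (+ 0) :* a :+ con (+ 1) :* b) refl _ _

  factored-cong : ∀ {n f g rs} → f ≋ g → Factored n f rs → Factored n g rs
  factored-cong f≋g (factored c 0<c f≋ len) = factored c 0<c (λ j → trans (sym (f≋g j)) (f≋ j)) len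

  factored-scale : ∀ {n f rs} c → 0# < c → Factored n f rs → Factored n (λ j → c * f j) rs
  factored-scale {n} {f} {rs} c 0<c F@(factored d 0<d f≋ len) = factored (c * d) (*-pos 0<c 0<d)
    (λ j → trans (*-congˡ (f≈ F j)) (trans (sym (*-assoc c d _)) (sym (constant-⊛ (c * d) (monic rs) j)))) len

-- Zeros of the Eulerian polynomials

module EulerianRoots (ℝ : CompleteOrderedField) where
  open CompleteOrderedField ℝ
  open Polynomials ℝ
  open IntegerSolver ℝ
  open OrderedField ℝ
  open Evaluation ℝ
  open Roots ℝ
  open Zigzag ℝ
  open SplitPolynomials ℝ
  open FactoredPolynomials ℝ
  open Eulerian ℝ
  open Jets ℝ
  module W (x : Carrier) = WronskianPositivity ℝ x
  module J (x : Carrier) = EulerianJets ℝ x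

  -- The classical Eulerian polynomial with constant term 1, the numerator of the sum of (m +
  -- 1)^(n+1) x^m. The index is its degree, one less than its level.
  T : ℕ → Series
  T n = eulerian (ℕ.suc n) (ℕ.suc n)

  T-vanishes : ∀ n → VanishesAbove n (T n)
  T-vanishes n j n<j = trans (eulerian-last n j) (partialSum-vanishes n (ℕ.suc n) j n<j)

  T-leading : ∀ n → T n n ≈ 1#
  T-leading n = trans (eulerian-last n n) (partialSum-leading n n ℕ.≤-refl)

  top-T : ∀ n x → W.level x (ℕ.suc n) (ℕ.suc n) ≈ᴶ (eval n (T n) x , derivative n (T n) x)
  top-T n x = trans (sym (proj₁ (J.jet-eulerian x (ℕ.suc n) (ℕ.suc n)))) (eval-suc n (T n) x (T-vanishes n)) ,
              trans (sym (proj₂ (J.jet-eulerian x (ℕ.suc n) (ℕ.suc n))))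
                (derivative-suc n (T n) x (T-vanishes n))

  W-at-root : ∀ x F G → proj₁ G ≈ 0# → W.W x F G ≈ proj₂ G * - proj₁ F
  W-at-root x (v , d) (w , e) w≈0 = trans (pairing-cong 0# 1# (refl , refl) (w≈0 , refl))
    (solve 3 (λ v d e → con (+ 0) :* (v :* con (+ 0)) :+ con (+ 1) :* (d :* con (+ 0) :- v :* e) :=
      e :* :- v) refl v d e)

  T-root-nonZero : ∀ n x → eval n (T n) x ≈ 0# → W.top x n ≉ 0#
  T-root-nonZero n x root = W.consecutive-tops-nonZero x n (trans (proj₁ (top-T n x)) root)

  -- At a zero of `T n` its Wronskian with `T (suc n)` reduces to this product. It is bounded below
  -- by the square of the preceding top, which does not vanish there.
  T-consecutive-signs : ∀ n x → eval n (T n) x ≈ 0# →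
                        0# < derivative n (T n) x * - eval (ℕ.suc n) (T (ℕ.suc n)) x
  T-consecutive-signs ℕ.zero    x root = contradiction (trans (sym root) (T-leading 0)) 0≉1
  T-consecutive-signs (ℕ.suc n) x root = go (ℕ.suc n) z<s root
    where
    go : ∀ n → 0 ℕ.< n → eval n (T n) x ≈ 0# → 0# < derivative n (T n) x * - eval (ℕ.suc n) (T (ℕ.suc n)) x
    go n 0<n root = <-respʳ-≈
      (trans (W-at-root x (W.level x (ℕ.suc (ℕ.suc n)) (ℕ.suc (ℕ.suc n))) (W.level x (ℕ.suc n) (ℕ.suc n))
        (trans (proj₁ (top-T n x)) root))
        (*-cong (proj₂ (top-T n x)) (-‿cong (proj₁ (top-T (ℕ.suc n) x)))))
      (<-≤-trans (x*x-pos (T-root-nonZero n x root)) (W.W-consecutive-tops-≥ x n 0<n))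

  EulerianRoots : ℕ → Set
  EulerianRoots n = ∃ λ es → Factored n (T n) es × Descending es × All (_< 0#) es

  private
    -- The points are 0, where the value is 1, and the zeros of `T n`, where the signs are opposite
    -- to those of its derivative. The leading coefficient supplies the lowest zero.
    next-roots : ∀ n → EulerianRoots n → EulerianRoots (ℕ.suc n)
    next-roots n (es , T-factored , desc , es<0) = conclude
      (splits-leading (ℕ.suc n) (T (ℕ.suc n)) (0# ∷ es) (T-vanishes (ℕ.suc n))
        (<-respʳ-≈ (sym (T-leading (ℕ.suc n))) 0<1)
        (≡.cong ℕ.suc (Factored.length-rs T-factored))
          (AllPairs⇒Linked (es<0 ∷ Linked⇒AllPairs (flip <-trans) desc))
        (<-respʳ-≈ (sym (trans (eval-0 (ℕ.suc n) (T (ℕ.suc n))) (eulerian-constant-1 (ℕ.suc (ℕ.suc n))))) 0<1 ∷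
         alternates-sameSign (All.map (λ {y} → sameSign y) (factored-roots T-factored))
           (factored-derivative-alternates T-factored desc)))
      where
      sameSign : ∀ y → eval n (T n) y ≈ 0# → SameSignAt (derivative n (T n))
        (λ y → - eval (ℕ.suc n) (T (ℕ.suc n)) y) y
      sameSign y root = sameSign-product (derivative n (T n)) (λ y → - eval (ℕ.suc n) (T (ℕ.suc n)) y) y
        (T-consecutive-signs n y root)

      conclude : Splits (ℕ.suc n) (T (ℕ.suc n)) (0# ∷ es) → EulerianRoots (ℕ.suc n)
      conclude (c , es′ , 0<c , T≋ , len , desc′) =
        es′ , factored c 0<c T≋ len , proj₂ (descending-zigzag⁻ (0# ∷ es) es′ desc′) ,
          proj₁ (All-zigzag⁻ es′ es (descending-head desc′))

  abstract
    eulerian-roots : ∀ n → EulerianRoots n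
    eulerian-roots ℕ.zero    =
      [] , factored (T 0 0) (<-respʳ-≈ (sym (T-leading 0)) 0<1) (factored-[] (T-vanishes 0)) ≡.refl , [] , []
    eulerian-roots (ℕ.suc n) = next-roots n (eulerian-roots n)

-- Wronskians of linear combinations

module Combinations (ℝ : CompleteOrderedField) (x : CompleteOrderedField.Carrier ℝ) where
  open CompleteOrderedField ℝ
  open Polynomials ℝ
  open IntegerSolver ℝ
  open OrderedField ℝ
  open RingProperties ring
  open Sums ℝ
  open Jets ℝ
  open Evaluation ℝ
  open Eulerian ℝ
  open EulerianJets ℝ x
  open WronskianPositivity ℝ x

  combination : ℕ → (ℕ → Carrier) → (ℕ → Jet) → Jet
  combination m e F = Σᴶ m (λ k → e k * proj₁ (F k) , e k * proj₂ (F k))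

  private
    W-scaleˡ : ∀ c F G → W (c * proj₁ F , c * proj₂ F) G ≈ c * W F G
    W-scaleˡ c (v , d) (w , u) = solve 5 (λ c v d w u →
      con (+ 0) :* ((c :* v) :* w) :+ con (+ 1) :* ((c :* d) :* w :- (c :* v) :* u) :=
      c :* (con (+ 0) :* (v :* w) :+ con (+ 1) :* (d :* w :- v :* u))) refl c v d w u

  W-combination : ∀ m e F G → W (combination m e F) G ≈ Σ< m (λ k → e k * W (F k) G)
  W-combination m e F G = trans (pairing-Σˡ 0# 1# m (λ k → e k * proj₁ (F k) , e k * proj₂ (F k)) G)
    (Σ<-cong m (λ k _ → W-scaleˡ (e k) (F k) G))

  private
    W-last : ∀ P Q F a b → W (proj₁ P + a * proj₁ F , proj₂ P + a * proj₂ F) (proj₁ Q + b * proj₁ F ,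
      proj₂ Q + b * proj₂ F) ≈
                           W P Q + (b * W P F - a * W Q F)
    W-last (p , p′) (q , q′) (v , d) a b = solve 8 (λ p p′ q q′ v d a b →
      let W v d w e = con (+ 0) :* (v :* w) :+ con (+ 1) :* (d :* w :- v :* e) in
      W (p :+ a :* v) (p′ :+ a :* d) (q :+ b :* v) (q′ :+ b :* d) :=
      W p p′ q q′ :+ (b :* W p p′ v d :- a :* W q q′ v d)) refl p p′ q q′ v d a b

  -- The Wronskian is alternating, so only the 2 × 2 minors of the coefficient
  -- sequences contribute.
  W-combination-suc : ∀ m e f F →
    W (combination (ℕ.suc m) e F) (combination (ℕ.suc m) f F) ≈
    W (combination m e F) (combination m f F) + Σ< m (λ i → (e i * f m - e m * f i) * W (F i) (F m))
  W-combination-suc m e f F = begin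
    W (combination (ℕ.suc m) e F) (combination (ℕ.suc m) f F)
      ≈⟨ pairing-cong 0# 1# (Σ<-last m (λ k → e k * proj₁ (F k)) , Σ<-last m (λ k → e k * proj₂ (F k)))
                            (Σ<-last m (λ k → f k * proj₁ (F k)) , Σ<-last m (λ k → f k * proj₂ (F k))) ⟩
    W (proj₁ P + e m * proj₁ (F m) , proj₂ P + e m * proj₂ (F m)) (proj₁ Q + f m * proj₁ (F m) ,
      proj₂ Q + f m * proj₂ (F m))
      ≈⟨ W-last P Q (F m) (e m) (f m) ⟩
    W P Q + (f m * W P (F m) - e m * W Q (F m))
      ≈⟨ +-congˡ (+-cong (trans (*-congˡ (W-combination m e F (F m)))
        (*-distribˡ-Σ< m (f m) (λ i → e i * W (F i) (F m))))
                         (trans (-‿distribˡ-* (e m) _)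
                           (trans (*-congˡ (W-combination m f F (F m)))
                             (*-distribˡ-Σ< m (- e m) (λ i → f i * W (F i) (F m)))))) ⟩
    W P Q + (Σ< m (λ i → f m * (e i * W (F i) (F m))) + Σ< m (λ i → - e m * (f i * W (F i) (F m))))
      ≈⟨ +-congˡ (sym (Σ<-distrib-+ m (λ i → f m * (e i * W (F i) (F m)))
        (λ i → - e m * (f i * W (F i) (F m))))) ⟩
    W P Q + Σ< m (λ i → f m * (e i * W (F i) (F m)) + - e m * (f i * W (F i) (F m)))
      ≈⟨ +-congˡ (Σ<-cong m (λ i _ → solve 5
        (λ a b c d w → b :* (a :* w) :+ :- c :* (d :* w) := (a :* b :- c :* d) :* w) refl (e i) (f m) (e m)
          (f i) (W (F i) (F m)))) ⟩
    W P Q + Σ< m (λ i → (e i * f m - e m * f i) * W (F i) (F m)) ∎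
    where
    open SetoidReasoning setoid
    P = combination m e F
    Q = combination m f F

  module _ (n : ℕ) (e f : ℕ → Carrier) (F : ℕ → Jet)
           (minors : ∀ i j → i ℕ.< j → j ℕ.≤ n → e j * f i ≤ e i * f j)
           (wronskians : ∀ i j → i ℕ.< j → j ℕ.≤ n → 0# ≤ W (F i) (F j)) where

    private
      0≤terms : ∀ m → m ℕ.≤ n → ∀ i → i ℕ.< m → 0# ≤ (e i * f m - e m * f i) * W (F i) (F m)
      0≤terms m m≤n i i<m = *-nonNeg (x≤y⇒0≤y-x (minors i m i<m m≤n)) (wronskians i m i<m m≤n)

      0≤W : ∀ m → m ℕ.≤ ℕ.suc n → 0# ≤ W (combination m e F) (combination m f F)
      0≤W ℕ.zero    _         = ≤-reflexive
        (solve 0 (con (+ 0) := con (+ 0) :* (con (+ 0) :* con (+ 0)) :+ con (+ 1) :* (con (+ 0) :* con (+ 0) :- con (+ 0) :* con (+ 0))) refl)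
      0≤W (ℕ.suc m) (s≤s m≤n) = ≤-respʳ-≈ (sym (W-combination-suc m e f F))
        (+-nonNeg (0≤W m (ℕ.m≤n⇒m≤1+n m≤n)) (Σ<-nonNeg m (0≤terms m m≤n)))

    -- The pair (0, n) is the one to keep: its Wronskian is an exact square, and for p and `𝓘 n p`
    -- its minor becomes p_n² - p_0².
    W-combination-≥ : 0 ℕ.< n → (e 0 * f n - e n * f 0) * W (F 0) (F n) ≤ W (combination (ℕ.suc n) e F)
      (combination (ℕ.suc n) f F)
    W-combination-≥ 0<n = ≤-trans (Σ<-≥term n (0≤terms n ℕ.≤-refl) 0 0<n)
      (≤-by-difference (trans (+-congʳ (W-combination-suc n e f F))
        (solve 2 (λ a b → (a :+ b) :- b := a) refl _ _)) (0≤W n (ℕ.n≤1+n n)))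

  jet-combination : ∀ n e {f} → f ≋ (λ i → Σ< (ℕ.suc n) (λ j → e j * eulerian n j i)) → jet n f ≈ᴶ combination
    (ℕ.suc n) e (level n)
  jet-combination n e {f} f≋ =
    trans (eval-cong n x f≋) (trans (proj₁ (jet-Σ n (ℕ.suc n) e (eulerian n)))
      (Σ<-cong (ℕ.suc n) (λ k _ → *-congˡ {e k} (proj₁ (jet-eulerian n k))))) ,
    trans (derivative-cong n x f≋)
      (trans (proj₂ (jet-Σ n (ℕ.suc n) e (eulerian n)))
        (Σ<-cong (ℕ.suc n) (λ k _ → *-congˡ {e k} (proj₂ (jet-eulerian n k)))))

-- Consequences of the symmetric decomposition

module Decompositions (ℝ : CompleteOrderedField) where
  open CompleteOrderedField ℝ
  open Polynomials ℝ
  open IntegerSolver ℝ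
  open OrderedField ℝ
  open Evaluation ℝ
  open LogConcavity ℝ

  module _ {n′ : ℕ} {p a b : Series} (decomposition : Is𝓘-Decomposition (ℕ.suc n′) p a b) where
    open Is𝓘-Decomposition decomposition
    private
      n = ℕ.suc n′

    p≈a+xb : ∀ j → p j ≈ a j + shift b j
    p≈a+xb j = trans (p≋a+xb j) (+-congˡ (trans (linear-⊛ 0# 1# b j)
      (solve 2 (λ b b′ → con (+ 0) :* b :+ con (+ 1) :* b′ := b′) refl (b j) (shift b j))))

    a-vanishes : VanishesAbove n a
    a-vanishes j n<j = trans (sym (a-symmetric j)) (reflexive (𝓘-> n a j n<j))

    b-vanishes : VanishesAbove n′ b
    b-vanishes j n′<j = trans (sym (b-symmetric j)) (reflexive (𝓘-> n′ b j n′<j))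

    -- Reversing x b in degree n is reversing b in degree n - 1, which fixes b.
    𝓘p≈a+b : ∀ j → 𝓘 n p j ≈ a j + b j
    𝓘p≈a+b j with j ℕ.≤? n
    ... | no  j≰n = trans (reflexive (𝓘-> n p j (ℕ.≰⇒> j≰n))) (sym (trans
      (+-cong (a-vanishes j (ℕ.≰⇒> j≰n)) (b-vanishes j (ℕ.<-trans (ℕ.n<1+n n′) (ℕ.≰⇒> j≰n)))) (+-identityˡ 0#)))
    ... | yes j≤n = begin
      𝓘 n p j                              ≡⟨ 𝓘-≤ n p j j≤n ⟩
      p (n ℕ.∸ j)                           ≈⟨ p≈a+xb (n ℕ.∸ j) ⟩
      a (n ℕ.∸ j) + shift b (n ℕ.∸ j)       ≈⟨ +-cong
        (trans (reflexive (≡.sym (𝓘-≤ n a j j≤n))) (a-symmetric j)) (shifted j j≤n) ⟩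
      a j + b j                             ∎
      where
      open SetoidReasoning setoid
      shifted : ∀ j → j ℕ.≤ n → shift b (n ℕ.∸ j) ≈ b j
      shifted j j≤n with ℕ.m≤n⇒m<n∨m≡n j≤n
      ... | inj₁ (s≤s j≤n′) = trans
        (reflexive (≡.trans (≡.cong (shift b) (ℕ.+-∸-assoc 1 j≤n′)) (≡.sym (𝓘-≤ n′ b j j≤n′)))) (b-symmetric j)
      ... | inj₂ ≡.refl     = trans (reflexive (≡.cong (shift b) (ℕ.n∸n≡0 n))) (sym (b-vanishes n ℕ.≤-refl))

    module _ (a-zero⊎split : a ≋ constant 0# ⊎ ∃ (NonPositiveZeros a)) (b-zero⊎split : b ≋ constant 0# ⊎ ∃ (NonPositiveZeros b)) where
      private
        unimodal : ∀ {m f} → f ≋ constant 0# ⊎ ∃ (NonPositiveZeros f) → 𝓘 m f ≋ f →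
                   ∀ i → ℕ.suc (i ℕ.+ i) ℕ.≤ m → f i ≤ f (ℕ.suc i)
        unimodal     (inj₁ f≋0)          _     i _  = ≤-reflexive
          (trans (f≋0 i) (trans (constant-0 i) (sym (f≋0 (ℕ.suc i)))))
        unimodal {f = f} (inj₂ (rs , f-split)) sym-f i le = symmetric-unimodal {rs = rs} f-split sym-f i le

        nonNeg : ∀ {f} → f ≋ constant 0# ⊎ ∃ (NonPositiveZeros f) → 0# ≤ f 0
        nonNeg (inj₁ f≋0)            = ≤-reflexive (sym (f≋0 0))
        nonNeg (inj₂ (rs , f-split)) = split-nonNeg {rs = rs} f-split 0

      -- The steps of the chain are p_(n-i) - p_i = b_i - b_(i-1), with b_(-1) = 0, and p_(i+1) -
      -- p_(n-i) = a_(i+1) - a_i. Unimodality of b and of a each settles one kind.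
      alternatinglyIncreasing : Degree p n → AlternatinglyIncreasing n p
      alternatinglyIncreasing degree = record
        { degree    = degree
        ; 0≤p₀      = ≤-respʳ-≈ (sym (trans (p≈a+xb 0) (+-identityʳ _))) (nonNeg a-zero⊎split)
        ; pᵢ≤pₙ₋ᵢ   = λ i 2i<n → ≤-by-difference (trans (+-congʳ (𝓘p≈ i (ℕ.≤-trans (ℕ.m≤m+n i i) (ℕ.<⇒≤ 2i<n))))
            (trans (+-congˡ (-‿cong (p≈a+xb i)))
              (solve 3 (λ a b b′ → (a :+ b) :- (a :+ b′) := b :- b′) refl (a i) (b i) (shift b i))))
                (b-step i 2i<n)
        ; pₙ₋ᵢ≤pᵢ₊₁ = λ i 2i+1<n → ≤-by-difference
          (trans (+-cong (p≈a+xb (ℕ.suc i))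
            (-‿cong (𝓘p≈ i (ℕ.≤-trans (ℕ.m≤m+n i i) (ℕ.<⇒≤ (ℕ.<-trans (ℕ.n<1+n _) 2i+1<n))))))
            (solve 3 (λ a b a′ → (a′ :+ b) :- (a :+ b) := a′ :- a) refl (a i) (b i) (a (ℕ.suc i))))
            (x≤y⇒0≤y-x (unimodal a-zero⊎split a-symmetric i (ℕ.<⇒≤ 2i+1<n)))
        }
        where
        𝓘p≈ : ∀ i → i ℕ.≤ n → p (n ℕ.∸ i) ≈ a i + b i
        𝓘p≈ i i≤n = trans (reflexive (≡.sym (𝓘-≤ n p i i≤n))) (𝓘p≈a+b i)

        b-step : ∀ i → i ℕ.+ i ℕ.< n → 0# ≤ b i - shift b i
        b-step ℕ.zero    _          = ≤-respʳ-≈ (solve 1 (λ b → b := b :- con (+ 0)) refl (b 0))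
          (nonNeg b-zero⊎split)
        b-step (ℕ.suc i) (s≤s 2i+2≤n′) = x≤y⇒0≤y-x (unimodal b-zero⊎split b-symmetric i
          (ℕ.≤-trans (ℕ.≤-reflexive (≡.sym (ℕ.+-suc i i))) (ℕ.<⇒≤ 2i+2≤n′)))

  -- Serves both degenerate cases: p = 𝓘 n p gives b = x b, and p = x 𝓘 n p gives a = x a.
  ≋shift⇒≋0 : ∀ {f} → f ≋ shift f → f ≋ constant 0#
  ≋shift⇒≋0 {f} f≋ ℕ.zero    = f≋ 0
  ≋shift⇒≋0 {f} f≋ (ℕ.suc j) = trans (f≋ (ℕ.suc j)) (trans (≋shift⇒≋0 f≋ j) (constant-0 j))

-- Nonnegative combinations and strict signs

module EulerianCombinations (ℝ : CompleteOrderedField) where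
  open CompleteOrderedField ℝ
  open Polynomials ℝ
  open IntegerSolver ℝ
  open OrderedField ℝ
  open Sums ℝ
  open Jets ℝ
  open Evaluation ℝ
  open Eulerian ℝ
  open LogConcavity ℝ using (𝓘-≤; 𝓘->)
  open LikelihoodRatio ℝ
  open EulerianRoots ℝ
  open SetoidReasoning setoid

  record IsCombination (n : ℕ) (e : ℕ → Carrier) (p : Series) : Set where
    constructor combine
    field
      expansion : p ≋ λ i → Σ< (ℕ.suc n) (λ j → e j * eulerian n j i)

  open IsCombination

  module _ {n e p} (p-combination : IsCombination n e p) where
    private
      p≋ = expansion p-combination

    combination-vanishes : VanishesAbove n p
    combination-vanishes i n<i = trans (p≋ i)
      (Σ<-zero (ℕ.suc n) (λ j _ → trans (*-congˡ {e j} (eulerian-vanishes n j i n<i)) (zeroʳ (e j))))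

    -- Only the polynomial of index 0 reaches degree n; dually, only that of index n has a nonzero
    -- constant term.
    combination-leading : p n ≈ e 0
    combination-leading = trans (p≋ n)
      (trans (+-cong (trans (*-congˡ (eulerian-leading-1 n)) (*-identityʳ _)) (Σ<-zero n (rest n)))
        (+-identityʳ _))
      where
      rest : ∀ n j → j ℕ.< n → e (ℕ.suc j) * eulerian n (ℕ.suc j) n ≈ 0#
      rest (ℕ.suc n) j (s≤s j≤n) = trans (*-congˡ (eulerian-leading-0 n j j≤n)) (zeroʳ _)

    combination-constant : p 0 ≈ e n
    combination-constant = trans (p≋ 0) (trans (Σ<-last n (λ j → e j * eulerian n j 0))
      (trans (+-cong (Σ<-zero n (λ j j<n → trans (*-congˡ {e j} (eulerian-constant-0 n j j<n)) (zeroʳ (e j))))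
                     (trans (*-congˡ (eulerian-constant-1 n)) (*-identityʳ _)))
        (+-identityˡ _)))

    combination-𝓘 : IsCombination n (λ j → e (n ℕ.∸ j)) (𝓘 n p)
    combination-𝓘 .expansion i with i ℕ.≤? n
    ... | no  i≰n = trans (reflexive (𝓘-> n p i (ℕ.≰⇒> i≰n)))
      (sym (Σ<-zero (ℕ.suc n) (λ j _ → trans (*-congˡ {e (n ℕ.∸ j)} (eulerian-vanishes n j i (ℕ.≰⇒> i≰n)))
        (zeroʳ (e (n ℕ.∸ j))))))
    ... | yes i≤n = begin
      𝓘 n p i                                                          ≡⟨ 𝓘-≤ n p i i≤n ⟩
      p (n ℕ.∸ i)                                                       ≈⟨ p≋ (n ℕ.∸ i) ⟩
      Σ< (ℕ.suc n) (λ j → e j * eulerian n j (n ℕ.∸ i))                 ≈⟨ Σ<-cong (ℕ.suc n)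
        (λ j j<1+n → reflect j (ℕ.s≤s⁻¹ j<1+n)) ⟩
      Σ< (ℕ.suc n) (λ j → F (n ℕ.∸ j))                                  ≈⟨ Σ<-reverse n F (ℕ.suc n) 0
        (ℕ.+-identityʳ _) ⟩
      Σ< (ℕ.suc n) F - 0#                                               ≈⟨ solve 1 (λ a → a :- con (+ 0) :=
        a) refl _ ⟩
      Σ< (ℕ.suc n) F                                                    ∎
      where
      F : ℕ → Carrier
      F j = e (n ℕ.∸ j) * eulerian n j i

      reflect : ∀ j → j ℕ.≤ n → e j * eulerian n j (n ℕ.∸ i) ≈ F (n ℕ.∸ j)
      reflect j j≤n = *-cong (reflexive (≡.cong e (≡.sym (ℕ.m∸[m∸n]≡n j≤n))))
        (eulerian-symmetric n j (n ℕ.∸ j) (n ℕ.∸ i) i (ℕ.m+[n∸m]≡n j≤n) (ℕ.m∸n+n≡m i≤n))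

  find-positive : ∀ m {e : ℕ → Carrier} → (∀ j → 0# ≤ e j) → (∀ j → j ℕ.< m → e j ≈ 0#) ⊎ ∃ λ j → j ℕ.< m ×
    0# < e j
  find-positive ℕ.zero    0≤e = inj₁ (λ _ ())
  find-positive (ℕ.suc m) {e} 0≤e with e m ≟ 0# | find-positive m 0≤e
  ... | no  eₘ≉0 | _                     = inj₂ (m , ℕ.n<1+n m , 0≤e m , eₘ≉0 ∘ sym)
  ... | yes eₘ≈0 | inj₂ (j , j<m , 0<eⱼ) = inj₂ (j , ℕ.m<n⇒m<1+n j<m , 0<eⱼ)
  ... | yes eₘ≈0 | inj₁ e≈0              = inj₁ all-zero
    where
    all-zero : ∀ j → j ℕ.< ℕ.suc m → e j ≈ 0#
    all-zero j (s≤s j≤m) with ℕ.m≤n⇒m<n∨m≡n j≤m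
    ... | inj₁ j<m    = e≈0 j j<m
    ... | inj₂ ≡.refl = eₘ≈0

  -- Two weight sequences of one polynomial: p is expanded with `e` and `𝓘 n p` with the reversed
  -- `ẽ`, so `dominates` controls the minors of the pair.
  module _ {n′ e ẽ p} (0≤e : ∀ j → 0# ≤ e j) (dominates : Dominates (ℕ.suc n′) e ẽ)
           (p≋e : IsCombination (ℕ.suc n′) e p) (p≋ẽ : IsCombination (ℕ.suc n′) ẽ p) where
    private
      n = ℕ.suc n′
      q = 𝓘 n p

    minor : ∀ i j → i ℕ.≤ j → j ℕ.≤ n → e j * ẽ (n ℕ.∸ i) ≤ e i * ẽ (n ℕ.∸ j)
    minor i j i≤j j≤n with ℕ.m≤n⇒∃[o]m+o≡n i≤j | ℕ.m≤n⇒∃[o]m+o≡n j≤n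
    ... | d , ≡.refl | k , i+d+k≡n = ≡.subst₂ (λ l m → e (i ℕ.+ d) * ẽ l ≤ e i * ẽ m) n∸i≡ n∸j≡
      (dominates i k d (ℕ.≤-reflexive (≡.sym i+d+k≡n)))
      where
      n∸j≡ : k ≡ n ℕ.∸ (i ℕ.+ d)
      n∸j≡ = ≡.trans (≡.sym (ℕ.m+n∸m≡n (i ℕ.+ d) k)) (≡.cong (ℕ._∸ (i ℕ.+ d)) i+d+k≡n)
      n∸i≡ : k ℕ.+ d ≡ n ℕ.∸ i
      n∸i≡ = ≡.trans (≡.trans (ℕ.+-comm k d) (≡.sym (ℕ.m+n∸m≡n i (d ℕ.+ k))))
        (≡.cong (ℕ._∸ i) (≡.trans (≡.sym (ℕ.+-assoc i d k)) i+d+k≡n))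

    wronskian-bound : ∀ x → (p n * p n - p 0 * p 0) * (W.top x n * W.top x n) ≤ W.W x (J.jet x n p)
      (J.jet x n q)
    wronskian-bound x = ≤-respˡ-≈
      (*-cong (+-cong (*-cong (sym e₀) (trans (reflexive (≡.cong ẽ (ℕ.n∸n≡0 n))) (sym ẽ₀)))
        (-‿cong (*-cong (sym eₙ) (sym ẽₙ)))) (W.W-extreme x n′))
      (≤-respʳ-≈ (pairing-cong 0# 1# (sym-ᴶ (C.jet-combination n e (expansion p≋e)))
        (sym-ᴶ (C.jet-combination n (λ j → ẽ (n ℕ.∸ j)) (expansion (combination-𝓘 p≋ẽ)))))
        (C.W-combination-≥ n e (λ j → ẽ (n ℕ.∸ j)) (W.level x n) (λ i j i<j j≤n → minor i j (ℕ.<⇒≤ i<j) j≤n)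
          (λ i j i<j j≤n → proj₁ (W.nonnegative x n i j (ℕ.<⇒≤ i<j) j≤n)) z<s))
      where
      module C = Combinations ℝ x
      e₀ = combination-leading p≋e
      ẽ₀ = combination-leading p≋ẽ
      eₙ = combination-constant p≋e
      ẽₙ = combination-constant p≋ẽ

      sym-ᴶ : ∀ {F G} → F ≈ᴶ G → G ≈ᴶ F
      sym-ᴶ (v≈ , d≈) = sym v≈ , sym d≈

    p₀²≤pₙ² : p 0 * p 0 ≤ p n * p n
    p₀²≤pₙ² = ≤-respˡ-≈ (*-cong (sym (combination-constant p≋e)) (sym (combination-constant p≋ẽ)))
      (≤-respʳ-≈ (*-cong (sym (combination-leading p≋e))
        (trans (reflexive (≡.cong ẽ (ℕ.n∸n≡0 n))) (sym (combination-leading p≋ẽ))))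
        (minor 0 n z≤n ℕ.≤-refl))

    -- If p_0 = p_n, the four corner weights coincide and cancel from the minors (0, j) and (j, n).
    -- These become opposite inequalities between e_j and ẽ_(n-j).
    palindromic : 0# < p n → p 0 ≈ p n → p ≋ q
    palindromic 0<pₙ p₀≈pₙ i = trans (expansion p≋e i)
      (trans (Σ<-cong (ℕ.suc n) (λ j j<1+n → *-congʳ {eulerian n j i} (eⱼ≈ j (ℕ.s≤s⁻¹ j<1+n))))
        (sym (expansion (combination-𝓘 p≋ẽ) i)))
      where
      cancel : ∀ {x y z} → z ≈ p n → x * z ≤ y * z → x ≤ y
      cancel {x} {y} {z} z≈pₙ xz≤yz = 0≤y-x⇒x≤y (*-cancel-nonNeg (<-respʳ-≈ (sym z≈pₙ) 0<pₙ)
        (≤-respʳ-≈ (solve 3 (λ x y z → y :* z :- x :* z := z :* (y :- x)) refl x y z) (x≤y⇒0≤y-x xz≤yz)))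

      e₀≈ : e 0 ≈ p n
      e₀≈ = sym (combination-leading p≋e)
      eₙ≈ : e n ≈ p n
      eₙ≈ = trans (sym (combination-constant p≋e)) p₀≈pₙ
      ẽ₀≈ : ẽ (n ℕ.∸ n) ≈ p n
      ẽ₀≈ = trans (reflexive (≡.cong ẽ (ℕ.n∸n≡0 n))) (sym (combination-leading p≋ẽ))
      ẽₙ≈ : ẽ n ≈ p n
      ẽₙ≈ = trans (sym (combination-constant p≋ẽ)) p₀≈pₙ

      eⱼ≈ : ∀ j → j ℕ.≤ n → e j ≈ ẽ (n ℕ.∸ j)
      eⱼ≈ j j≤n = antisym
        (cancel ẽₙ≈ (≤-respʳ-≈ (trans (*-congʳ (trans e₀≈ (sym ẽₙ≈))) (*-comm _ _)) (minor 0 j z≤n j≤n)))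
        (cancel ẽ₀≈ (≤-respˡ-≈ (trans (*-congʳ (trans eₙ≈ (sym ẽ₀≈))) (*-comm _ _)) (minor j n j≤n ℕ.≤-refl)))

    -- As the derivative of T alternates at the zeros of T, this says that p alternates strictly
    -- there, with a negative value at the largest zero.
    SignsAtEulerianRoots : Set
    SignsAtEulerianRoots = ∀ x → eval n′ (T n′) x ≈ 0# → 0# < derivative n′ (T n′) x * - eval n p x

    -- Unless only e₀ survives, some eⱼ with 0 < j < n is positive, and the
    -- Wronskian of eulerian n j and T is at least (T of the previous degree)².
    first-only⊎signs : (∀ j → 0 ℕ.< j → j ℕ.≤ n → e j ≈ 0#) ⊎ SignsAtEulerianRoots
    first-only⊎signs with find-positive n′ {e ∘ ℕ.suc} (0≤e ∘ ℕ.suc)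
    ... | inj₂ (j , j<n′ , 0<eⱼ) = inj₂ signs
      where
      signs : SignsAtEulerianRoots
      signs x root = <-respʳ-≈
        (trans (W-at-root x (J.jet x n p) (W.level x n n) (trans (proj₁ (top-T n′ x)) root))
          (*-congʳ (proj₂ (top-T n′ x))))
        (<-≤-trans (*-pos 0<eⱼ (<-≤-trans (x*x-pos (T-root-nonZero n′ x root))
          (W.W-top-≥ x n′ (ℕ.suc j) z<s j<n′)))
          (≤-respʳ-≈ (trans (sym (C.W-combination (ℕ.suc n) e (W.level x n) (W.level x n n)))
                       (pairing-cong 0# 1# (sym (proj₁ p-jet) , sym (proj₂ p-jet)) (refl , refl)))
            (Σ<-≥term (ℕ.suc n) (λ k k<1+n → *-nonNeg (0≤e k)
              (proj₁ (W.nonnegative x n k n (ℕ.s≤s⁻¹ k<1+n) ℕ.≤-refl)))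
              (ℕ.suc j) (s<s (ℕ.m<n⇒m<1+n j<n′)))))
        where
        module C = Combinations ℝ x
        p-jet = C.jet-combination n e (expansion p≋e)
    ... | inj₁ middle≈0 = edge n′ ≡.refl
      where
      edge : ∀ m → m ≡ n′ → (∀ j → 0 ℕ.< j → j ℕ.≤ n → e j ≈ 0#) ⊎ SignsAtEulerianRoots
      -- For n = 1 the polynomial T is constant and has no zeros.
      edge ℕ.zero ≡.refl = inj₂ (λ x root → contradiction (trans (sym root) (T-leading 0)) 0≉1)
      edge (ℕ.suc m) ≡.refl = inj₁ only
        where
        eₙ≈0 : e n ≈ 0#
        -- Domination with i = k = 1 and d = n - 1 bounds e_n² by e_1 ẽ_1. For n ≥ 2 the weight e_1
        -- is one of the vanishing middle ones.
        eₙ≈0 = x*x≈0⇒x≈0 (antisym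
          (≤-respˡ-≈ (*-congˡ (trans (sym (combination-constant p≋ẽ)) (combination-constant p≋e)))
            (≤-respʳ-≈ (trans (*-congʳ (middle≈0 0 z<s)) (zeroˡ _))
              (dominates 1 1 n′ (ℕ.m≤n⇒m≤n+o 1 ℕ.≤-refl))))
          (x*x-nonNeg (e n)))

        only : ∀ j → 0 ℕ.< j → j ℕ.≤ n → e j ≈ 0#
        only (ℕ.suc j) _ (s≤s j≤n′) with ℕ.m≤n⇒m<n∨m≡n j≤n′
        ... | inj₁ j<n′   = middle≈0 j j<n′
        ... | inj₂ ≡.refl = eₙ≈0

-- Interlacing of p, its reversal, and the parts a and b

module Interlacing (ℝ : CompleteOrderedField) where
  open CompleteOrderedField ℝ
  open Polynomials ℝ
  open IntegerSolver ℝ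
  open OrderedField ℝ
  open RingProperties ring
  open Sums ℝ
  open Jets ℝ
  open Evaluation ℝ
  open Roots ℝ
  open Zigzag ℝ
  open LogConcavity ℝ using (NonPositiveZeros; 𝓘-≤)
  open FactoredPolynomials ℝ
  open Eulerian ℝ
  open LikelihoodRatio ℝ
  open EulerianRoots ℝ
  open Decompositions ℝ
  open EulerianCombinations ℝ
  open SetoidReasoning setoid

  factored⇒nonPositiveZeros : ∀ {n f rs} → Factored n f rs → All (_≤ 0#) rs → NonPositiveZeros f rs
  factored⇒nonPositiveZeros (factored c 0<c f≋ _) rs≤0 = c , 0<c , f≋ , rs≤0

  descending-∷ : ∀ {x xs} → All (_< x) xs → Descending xs → Descending (x ∷ xs)
  descending-∷ xs<x desc = AllPairs⇒Linked (xs<x ∷ Linked⇒AllPairs (flip <-trans) desc)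

  nonPositive : ∀ {x xs} → x ≤ 0# → Descending (x ∷ xs) → All (_< 0#) xs
  nonPositive x≤0 desc = All.map (λ y<x → <-≤-trans y<x x≤0) (descending-head desc)

  -- Besides the interlacing it records where the zeros of a and b lie, as unimodality requires. The
  -- zero polynomial is listed apart because no list of zeros describes it.
  Outcome : ℕ → Series → Series → Series → Set
  Outcome n p a b = 𝓘 n p ≪ p × b ≪ a ×
    (a ≋ constant 0# ⊎ ∃ (NonPositiveZeros a)) × (b ≋ constant 0# ⊎ ∃ (NonPositiveZeros b))

  NonPositiveSplit : ℕ → Series → Set
  NonPositiveSplit n f = ∃ λ rs → Factored n f rs × Descending rs × All (_≤ 0#) rs

  module _ {n′ e ẽ p a b} (0≤e : ∀ j → 0# ≤ e j) (dominates : Dominates (ℕ.suc n′) e ẽ)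
           (p≋e : IsCombination (ℕ.suc n′) e p) (p≋ẽ : IsCombination (ℕ.suc n′) ẽ p)
           (pₙ≉0 : p (ℕ.suc n′) ≉ 0#) (decomposition : Is𝓘-Decomposition (ℕ.suc n′) p a b) where
    private
      n = ℕ.suc n′
      q = 𝓘 n p

      p≈ : ∀ j → p j ≈ a j + shift b j
      p≈ = p≈a+xb decomposition

      q≈ : ∀ j → q j ≈ a j + b j
      q≈ = 𝓘p≈a+b decomposition

      0<pₙ : 0# < p n
      0<pₙ = ≤-respʳ-≈ (sym (combination-leading p≋e)) (0≤e 0) , pₙ≉0 ∘ sym

      0≤p₀ : 0# ≤ p 0
      0≤p₀ = ≤-respʳ-≈ (sym (combination-constant p≋e)) (0≤e n)

      p-vanishes : VanishesAbove n p
      p-vanishes = combination-vanishes p≋e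

      q-vanishes : VanishesAbove n q
      q-vanishes = combination-vanishes (combination-𝓘 p≋e)

    -- All rₖ of positive weight are 0: p = x q and q is a multiple of the
    -- Eulerian polynomial T.
    first-only : (∀ j → 0 ℕ.< j → j ℕ.≤ n → e j ≈ 0#) → EulerianRoots n′ → Outcome n p a b
    first-only eⱼ≈0 (es , T-factored , desc , es<0) =
      interlaced⇒≪ p-factored q-factored (inj₁ ≡.refl) (linked es es<0 desc) ,
      ≪0 (es , factored-hasZeros b-factored) a≋0 ,
      inj₁ a≋0 ,
      inj₂ (es , factored⇒nonPositiveZeros b-factored (All.map proj₁ es<0))
      where
      0<e₀ : 0# < e 0
      0<e₀ = <-respʳ-≈ (combination-leading p≋e) 0<pₙ

      p≋xe₀T : p ≋ shift (λ j → e 0 * T n′ j)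
      p≋xe₀T i = begin
        p i                                                                 ≈⟨ IsCombination.expansion p≋e i ⟩
        e 0 * eulerian n 0 i + Σ< n (λ j → e (ℕ.suc j) * eulerian n (ℕ.suc j) i)
          ≈⟨ +-congˡ (Σ<-zero n (λ j j<n → trans (*-congʳ {eulerian n (ℕ.suc j) i} (eⱼ≈0 (ℕ.suc j) z<s j<n))
            (zeroˡ (eulerian n (ℕ.suc j) i)))) ⟩
        e 0 * eulerian n 0 i + 0#                                           ≈⟨ +-identityʳ _ ⟩
        e 0 * eulerian n 0 i                                                ≈⟨ *-congˡ (eulerian-first n′ i) ⟩
        e 0 * shift (T n′) i                                                ≈⟨ scale-shift i ⟩
        shift (λ j → e 0 * T n′ j) i                                        ∎
        where
        scale-shift : ∀ i → e 0 * shift (T n′) i ≈ shift (λ j → e 0 * T n′ j) i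
        scale-shift ℕ.zero    = zeroʳ (e 0)
        scale-shift (ℕ.suc i) = refl

      q≋e₀T : q ≋ λ j → e 0 * T n′ j
      q≋e₀T i = begin
        q i                                                                       ≈⟨ IsCombination.expansion
          (combination-𝓘 p≋e) i ⟩
        Σ< (ℕ.suc n) (λ j → e (n ℕ.∸ j) * eulerian n j i)                         ≈⟨ Σ<-last n
          (λ j → e (n ℕ.∸ j) * eulerian n j i) ⟩
        Σ< n (λ j → e (n ℕ.∸ j) * eulerian n j i) + e (n ℕ.∸ n) * T n′ i
          ≈⟨ +-congʳ (Σ<-zero n (λ j j<n → trans
            (*-congʳ {eulerian n j i} (eⱼ≈0 (n ℕ.∸ j) (ℕ.m<n⇒0<n∸m j<n) (ℕ.m∸n≤m n j)))
              (zeroˡ (eulerian n j i)))) ⟩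
        0# + e (n ℕ.∸ n) * T n′ i                                                 ≈⟨ +-identityˡ _ ⟩
        e (n ℕ.∸ n) * T n′ i                                                      ≈⟨ *-congʳ
          (reflexive (≡.cong e (ℕ.n∸n≡0 n))) ⟩
        e 0 * T n′ i                                                              ∎

      e₀T-factored : Factored n′ (λ j → e 0 * T n′ j) es
      e₀T-factored = factored-scale (e 0) 0<e₀ T-factored

      q-factored : Factored n′ q es
      q-factored = factored-cong (λ j → sym (q≋e₀T j)) e₀T-factored

      p-factored : Factored n p (0# ∷ es)
      p-factored = factored-shift (p≋xe₀T 0) (factored-cong (λ j → sym (p≋xe₀T (ℕ.suc j))) e₀T-factored)

      a≋0 : a ≋ constant 0#
      a≋0 = ≋shift⇒≋0 a≋shift
        where
        p≋shift-q : ∀ j → a j + shift b j ≈ shift q j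
        p≋shift-q j = trans (sym (p≈ j)) (trans (p≋xe₀T j) (shift-cong (λ j → sym (q≋e₀T j)) j))

        a≋shift : a ≋ shift a
        a≋shift ℕ.zero    = trans (sym (+-identityʳ _)) (p≋shift-q 0)
        a≋shift (ℕ.suc j) = trans (solve 2 (λ a b → a := (a :+ b) :- b) refl (a (ℕ.suc j)) (b j))
          (trans (+-congʳ (trans (p≋shift-q (ℕ.suc j)) (q≈ j)))
            (solve 2 (λ a b → (a :+ b) :- b := a) refl (a j) (b j)))

      b≋q : b ≋ q
      b≋q j = sym (trans (q≈ j) (trans (+-congʳ (trans (a≋0 j) (constant-0 j))) (+-identityˡ _)))

      b-factored : Factored n′ b es
      b-factored = factored-cong (λ j → sym (b≋q j)) q-factored

      linked : ∀ es → All (_< 0#) es → Descending es → Linked (flip _≤_) (0# ∷ zigzag es es)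
      linked []       _           _    = [-]
      linked (y ∷ ys) (y<0 ∷ _) desc = proj₁ y<0 ∷ zigzag-self (y ∷ ys) desc

    -- The n - 1 zeros of T, the point 0 and the leading coefficient account for n zeros. If p(0) =
    -- 0, the factor x is removed first; division by a negative y then reverses the signs.
    p-split : SignsAtEulerianRoots 0≤e dominates p≋e p≋ẽ → EulerianRoots n′ → NonPositiveSplit n p
    p-split signs (es , T-factored , desc , es<0) with <⊎≈⊎> 0# (p 0)
    ... | inj₂ (inj₂ p₀<0) = contradiction 0≤p₀ (<⇒≱ p₀<0)
    ... | inj₁ 0<p₀ = positive-constant
      (splits-leading n p (0# ∷ es) p-vanishes 0<pₙ (≡.cong ℕ.suc (Factored.length-rs T-factored))
        (descending-∷ es<0 desc)
        (<-respʳ-≈ (sym (eval-0 n p)) 0<p₀ ∷ alternates))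
      where
      alternates : Alternates (λ y → - eval n p y) es
      alternates = alternates-sameSign
        (All.map (λ {y} root → sameSign-product (derivative n′ (T n′)) (λ y → - eval n p y) y (signs y root))
          (factored-roots T-factored))
        (factored-derivative-alternates T-factored desc)

      positive-constant : Splits n p (0# ∷ es) → NonPositiveSplit n p
      positive-constant (c , rs , 0<c , p≋ , len , desc′) =
        rs , factored c 0<c p≋ len , proj₂ (descending-zigzag⁻ (0# ∷ es) rs desc′) ,
        All.map proj₁ (proj₁ (All-zigzag⁻ rs es (descending-head desc′)))
    ... | inj₂ (inj₁ 0≈p₀) = zero-constant
      (splits-leading n′ (p ∘ ℕ.suc) es (λ j n′<j → p-vanishes (ℕ.suc j) (s<s n′<j)) 0<pₙ
        (Factored.length-rs T-factored) desc alternates)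
      where
      sameSign : ∀ y → y < 0# → eval n′ (T n′) y ≈ 0# → SameSignAt (derivative n′ (T n′))
        (eval n′ (p ∘ ℕ.suc)) y
      sameSign y y<0 root =
        let p⇒ = sameSign-scale (λ y → - eval n p y) (eval n′ (p ∘ ℕ.suc)) y (- y) (x<0⇒0<-x y<0)
                   (trans (-‿cong (trans (+-congʳ (sym 0≈p₀)) (+-identityˡ _))) (-‿distribˡ-* y _))
            T⇒ = sameSign-product (derivative n′ (T n′)) (λ y → - eval n p y) y (signs y root)
        in proj₁ p⇒ ∘ proj₁ T⇒ , proj₂ p⇒ ∘ proj₂ T⇒

      alternates : Alternates (eval n′ (p ∘ ℕ.suc)) es
      alternates = alternates-sameSign
        (All.zipWith (λ {y} (y<0 , root) → sameSign y y<0 root) (es<0 , factored-roots T-factored))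
        (factored-derivative-alternates T-factored desc)

      negative : ∀ es rs → length rs ≡ length es → All (_< 0#) es → Descending (zigzag es rs) → All (_< 0#) rs
      negative []       []  _   _           _     = []
      negative (y ∷ ys) rs  _   (y<0 ∷ _) desc′ = proj₁ (All-zigzag⁻ rs ys (nonPositive (proj₁ y<0) desc′))

      zero-constant : Splits n′ (p ∘ ℕ.suc) es → NonPositiveSplit n p
      zero-constant (c , rs , 0<c , p≋ , len , desc′) =
        0# ∷ rs , factored-shift (sym 0≈p₀) (factored c 0<c p≋ len) ,
        descending-∷ rs<0 (proj₂ (descending-zigzag⁻ es rs desc′)) ,
        ≤-refl ∷ All.map proj₁ rs<0
        where
        rs<0 : All (_< 0#) rs
        rs<0 = negative es rs (≡.trans len (≡.sym (Factored.length-rs T-factored))) es<0 desc′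

    palindromic-case : p 0 ≈ p n → NonPositiveSplit n p → Outcome n p a b
    palindromic-case p₀≈pₙ (rs , p-factored , desc , rs≤0) =
      interlaced⇒≪ p-factored (factored-cong p≋q p-factored) (inj₂ ≡.refl) (zigzag-self rs desc) ,
      0≪ b≋0 (rs , factored-hasZeros a-factored) ,
      inj₂ (rs , factored⇒nonPositiveZeros a-factored rs≤0) ,
      inj₁ b≋0
      where
      p≋q : p ≋ q
      p≋q = palindromic 0≤e dominates p≋e p≋ẽ 0<pₙ p₀≈pₙ

      b≋shift : b ≋ shift b
      b≋shift j = trans (solve 2 (λ a b → b := (a :+ b) :- a) refl (a j) (b j))
        (trans (+-congʳ (trans (sym (q≈ j)) (trans (sym (p≋q j)) (p≈ j))))
          (solve 2 (λ a b → (a :+ b) :- a := b) refl (a j) (shift b j)))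

      b≋0 : b ≋ constant 0#
      b≋0 = ≋shift⇒≋0 b≋shift

      a-factored : Factored n a rs
      a-factored = factored-cong (λ j → trans (p≈ j) (trans (+-congˡ (shifted j)) (+-identityʳ _))) p-factored
        where
        shifted : ∀ j → shift b j ≈ 0#
        shifted ℕ.zero    = refl
        shifted (ℕ.suc j) = trans (b≋0 j) (constant-0 j)

    module _ (p₀≉pₙ : p 0 ≉ p n) (signs : SignsAtEulerianRoots 0≤e dominates p≋e p≋ẽ)
             {rs} (p-factored : Factored n p rs) (desc : Descending rs) (rs≤0 : All (_≤ 0#) rs) where
      open Is𝓘-Decomposition decomposition

      private
        0<pₙ²-p₀² : 0# < p n * p n - p 0 * p 0
        0<pₙ²-p₀² = x≤y⇒0≤y-x (p₀²≤pₙ² 0≤e dominates p≋e p≋ẽ) , difference≉0 ∘ sym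
          where
          difference≉0 : p n * p n - p 0 * p 0 ≉ 0#
          difference≉0 eq with xy≈0⇒x≈0⊎y≈0
            (trans (solve 2 (λ a b → (a :- b) :* (a :+ b) := a :* a :- b :* b) refl (p n) (p 0)) eq)
          ... | inj₁ pₙ-p₀≈0 = p₀≉pₙ (y-x≈0⇒x≈y pₙ-p₀≈0)
          ... | inj₂ pₙ+p₀≈0 = proj₂ (+-pos-nonNeg 0<pₙ 0≤p₀) (sym pₙ+p₀≈0)

        W-left-root : ∀ y F G → proj₁ F ≈ 0# → W.W y F G ≈ proj₂ F * proj₁ G
        W-left-root y (v , d) (w , u) v≈0 = trans (pairing-cong 0# 1# (v≈0 , refl) (refl , refl))
          (solve 3 (λ d w u → con (+ 0) :* (con (+ 0) :* w) :+ con (+ 1) :* (d :* w :- con (+ 0) :* u) :=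
            d :* w) refl d w u)

        -- At a zero of p the Wronskian is this product, bounded below by (p_n² - p_0²) times the
        -- square of T. A common zero of p and T would contradict `signs`.
        p′q-positive : ∀ y → eval n p y ≈ 0# → 0# < derivative n p y * eval n q y
        p′q-positive y root = <-respʳ-≈ (W-left-root y (J.jet y n p) (J.jet y n q) root)
          (<-≤-trans (*-pos 0<pₙ²-p₀² (x*x-pos top≉0)) (wronskian-bound 0≤e dominates p≋e p≋ẽ y))
          where
          top≉0 : W.top y n ≉ 0#
          top≉0 top≈0 = proj₂ (signs y (trans (sym (proj₁ (top-T n′ y))) top≈0))
            (sym (trans (*-congˡ (trans (-‿cong root) -0#≈0#)) (zeroʳ _)))

        q-alternates : Alternates (eval n q) rs
        q-alternates = alternates-sameSign
          (All.map (λ {y} root → sameSign-product (derivative n p) (eval n q) y (p′q-positive y root))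
            (factored-roots p-factored))
          (factored-derivative-alternates p-factored desc)

        qₙ≈p₀ : q n ≈ p 0
        qₙ≈p₀ = reflexive (≡.trans (𝓘-≤ n p n ℕ.≤-refl) (≡.cong p (ℕ.n∸n≡0 n)))

        eval-p : ∀ y → eval n p y ≈ eval n a y + y * eval n′ b y
        eval-p y = trans (eval-cong n y p≈) (trans (eval-⊕ n a (shift b) y) (+-congˡ (+-identityˡ _)))

        eval-q : ∀ y → eval n q y ≈ eval n a y + eval n′ b y
        eval-q y = trans (eval-cong n y q≈)
          (trans (eval-⊕ n a b y) (+-congˡ (eval-suc n′ b y (b-vanishes decomposition))))

      -- The coefficient of x^n in `𝓘 n p` is p_0. If it is positive, it supplies the lowest zero;
      -- if it is 0, the degree drops and the n alternating signs suffice.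
      𝓘p≪p : 𝓘 n p ≪ p
      𝓘p≪p with <⊎≈⊎> 0# (p 0)
      ... | inj₂ (inj₂ p₀<0) = contradiction 0≤p₀ (<⇒≱ p₀<0)
      ... | inj₁ 0<p₀ = conclude
        (splits-leading n q rs q-vanishes (<-respʳ-≈ (sym qₙ≈p₀) 0<p₀)
          (Factored.length-rs p-factored) desc q-alternates)
        where
        conclude : Splits n q rs → q ≪ p
        conclude (c , ss , 0<c , q≋ , len , desc′) = interlaced⇒≪ p-factored (factored c 0<c q≋ len)
          (inj₂ (≡.trans (Factored.length-rs p-factored) (≡.sym len))) (descending⇒linked desc′)
      ... | inj₂ (inj₁ 0≈p₀) = conclude
        (splits n′ q rs vanish (Factored.length-rs p-factored) desc
          (alternates-sameSign (All.universal
            (λ y → sameSign-≈ (eval n q) (eval n′ q) y (eval-suc n′ q y vanish)) rs) q-alternates))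
        where
        vanish : VanishesAbove n′ q
        vanish j n′<j with ℕ.m≤n⇒m<n∨m≡n n′<j
        ... | inj₁ n<j    = q-vanishes j n<j
        ... | inj₂ ≡.refl = trans qₙ≈p₀ (sym 0≈p₀)

        conclude : Splits n′ q rs → q ≪ p
        conclude (c , ss , 0<c , q≋ , len , desc′) = interlaced⇒≪ p-factored (factored c 0<c q≋ len)
          (inj₁ (≡.trans (Factored.length-rs p-factored) (≡.cong ℕ.suc (≡.sym len)))) (descending⇒linked desc′)

      -- As b has degree at most n - 1, its signs at the n zeros of p locate all of its zeros.
      b-splits : Splits n′ b rs
      b-splits = splits n′ b rs (b-vanishes decomposition) (Factored.length-rs p-factored) desc
        (alternates-sameSign (All.zipWith (λ {y} (root , y≤0) → sameSign y root y≤0)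
          (factored-roots p-factored , rs≤0)) q-alternates)
        where
        sameSign : ∀ y → eval n p y ≈ 0# → y ≤ 0# → SameSignAt (eval n q) (eval n′ b) y
        -- The factor 1 - y is positive because the zeros of p are nonpositive.
        sameSign y root y≤0 = sameSign-scale (eval n q) (eval n′ b) y (1# - y)
          (+-pos-nonNeg 0<1 (x≤0⇒0≤-x y≤0)) (begin
            eval n q y                                                  ≈⟨ eval-q y ⟩
            eval n a y + eval n′ b y                                    ≈⟨ solve 3
              (λ a b y → a :+ b := (con (+ 1) :- y) :* b :+ (a :+ y :* b)) refl _ _ y ⟩
            (1# - y) * eval n′ b y + (eval n a y + y * eval n′ b y)     ≈⟨ +-congˡ
              (trans (sym (eval-p y)) root) ⟩
            (1# - y) * eval n′ b y + 0#                                 ≈⟨ +-identityʳ _ ⟩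
            (1# - y) * eval n′ b y                                      ∎)

      module _ {βs} (b-factored : Factored n′ b βs) (desc-rsβs : Descending (zigzag rs βs)) where
        private
          a₀≈p₀ : a 0 ≈ p 0
          a₀≈p₀ = sym (trans (p≈ 0) (+-identityʳ _))

          aₙ≈p₀ : a n ≈ p 0
          aₙ≈p₀ = trans (trans (sym (a-symmetric n))
            (reflexive (≡.trans (𝓘-≤ n a n ℕ.≤-refl) (≡.cong a (ℕ.n∸n≡0 n))))) a₀≈p₀

          length-βs<length-rs : length rs ≡ ℕ.suc (length βs)
          length-βs<length-rs = ≡.trans (Factored.length-rs p-factored)
            (≡.cong ℕ.suc (≡.sym (Factored.length-rs b-factored)))

          βs-desc : Descending βs
          βs-desc = proj₂ (descending-zigzag⁻ rs βs desc-rsβs)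

          βs<0 : All (_< 0#) βs
          βs<0 = go rs length-βs<length-rs rs≤0 desc-rsβs
            where
            go : ∀ rs → length rs ≡ ℕ.suc (length βs) → All (_≤ 0#) rs → Descending (zigzag rs βs) → All
              (_< 0#) βs
            go (r ∷ rs) _ (r≤0 ∷ _) desc = proj₁ (All-zigzag⁻ βs rs (nonPositive r≤0 desc))

          a-alternates : Alternates (λ y → - eval n a y) βs
          a-alternates = alternates-sameSign
            (All.map (λ {y} root → sameSign-≈ (λ y → - eval n p y) (λ y → - eval n a y) y
              (-‿cong (trans (eval-p y) (trans (+-congˡ (trans (*-congˡ root) (zeroʳ y))) (+-identityʳ _)))))
                (factored-roots b-factored))
            (factored-interlaced p-factored βs
              (≡.subst (length βs ℕ.≤_) (≡.sym length-βs<length-rs) (ℕ.n≤1+n _)) desc-rsβs)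

        A-Outcome : Set
        A-Outcome = b ≪ a × (a ≋ constant 0# ⊎ ∃ (NonPositiveZeros a))

        -- By symmetry a_n = a_0 = p_0 > 0. The point 0 and the n - 1 zeros of b enclose all zeros
        -- of a but the lowest, which the leading coefficient supplies.
        positive-constant-term : 0# < p 0 → A-Outcome
        positive-constant-term 0<p₀ = conclude
          (splits-leading n a (0# ∷ βs) (a-vanishes decomposition) (<-respʳ-≈ (sym aₙ≈p₀) 0<p₀)
            (≡.cong ℕ.suc (Factored.length-rs b-factored)) (descending-∷ βs<0 βs-desc)
            (<-respʳ-≈ (sym (trans (eval-0 n a) a₀≈p₀)) 0<p₀ ∷ a-alternates))
          where
          conclude : Splits n a (0# ∷ βs) → A-Outcome
          conclude (c , αs , 0<c , a≋ , len , desc′) =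
            interlaced⇒≪ a-factored b-factored
              (inj₁ (≡.trans len (≡.cong ℕ.suc (≡.sym (Factored.length-rs b-factored)))))
              (descending⇒linked (Linked.tail desc′)) ,
            inj₂ (αs , factored⇒nonPositiveZeros a-factored
              (All.map proj₁ (proj₁ (All-zigzag⁻ αs βs (descending-head desc′)))))
            where
            a-factored : Factored n a αs
            a-factored = factored c 0<c a≋ len

        -- Now a_0 = a_n = 0, so a / x has degree at most n - 2 and the n - 1 zeros of b suffice; a
        -- and b then have equal degree. For n = 1 nothing is left of a.
        zero-constant-term : 0# ≈ p 0 → ∀ m → m ≡ n′ → A-Outcome
        zero-constant-term 0≈p₀ ℕ.zero ≡.refl = ≪0 (βs , factored-hasZeros b-factored) a≋0 , inj₁ a≋0
          where
          a≋0 : a ≋ constant 0#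
          a≋0 ℕ.zero            = trans a₀≈p₀ (sym 0≈p₀)
          a≋0 (ℕ.suc ℕ.zero)    = trans aₙ≈p₀ (sym 0≈p₀)
          a≋0 (ℕ.suc (ℕ.suc j)) = a-vanishes decomposition (ℕ.suc (ℕ.suc j)) (s<s z<s)
        zero-constant-term 0≈p₀ (ℕ.suc m) ≡.refl = conclude
          (splits m (a ∘ ℕ.suc) βs vanish (Factored.length-rs b-factored) βs-desc
            (alternates-sameSign (All.map (λ {y} → sameSign y) βs<0) a-alternates))
          where
          vanish : VanishesAbove m (a ∘ ℕ.suc)
          vanish j m<j with ℕ.m≤n⇒m<n∨m≡n m<j
          ... | inj₁ n′<j   = a-vanishes decomposition (ℕ.suc j) (s<s n′<j)
          ... | inj₂ ≡.refl = trans aₙ≈p₀ (sym 0≈p₀)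

          sameSign : ∀ y → y < 0# → SameSignAt (λ y → - eval n a y) (eval m (a ∘ ℕ.suc)) y
          sameSign y y<0 = sameSign-scale (λ y → - eval n a y) (eval m (a ∘ ℕ.suc)) y (- y) (x<0⇒0<-x y<0)
            (trans (-‿cong (trans (+-cong (trans a₀≈p₀ (sym 0≈p₀))
              (*-congˡ (eval-suc m (a ∘ ℕ.suc) y vanish))) (+-identityˡ _))) (-‿distribˡ-* y _))

          conclude : Splits m (a ∘ ℕ.suc) βs → A-Outcome
          conclude (c , αs , 0<c , a≋ , len , desc′) =
            interlaced⇒≪ a-factored b-factored
              (inj₂ (≡.trans (≡.cong ℕ.suc len) (≡.sym (Factored.length-rs b-factored))))
              (linked βs (Factored.length-rs b-factored) βs<0 desc′) ,
            inj₂ (0# ∷ αs , factored⇒nonPositiveZeros a-factored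
              (≤-refl ∷ αs≤0 βs (Factored.length-rs b-factored) βs<0 desc′))
            where
            a-factored : Factored (ℕ.suc m) a (0# ∷ αs)
            a-factored = factored-shift (trans a₀≈p₀ (sym 0≈p₀)) (factored c 0<c a≋ len)

            linked : ∀ βs → length βs ≡ ℕ.suc m → All (_< 0#) βs → Descending (zigzag βs αs) → Linked
              (flip _≤_) (0# ∷ zigzag βs αs)
            linked (β ∷ βs) _ (β<0 ∷ _) desc = proj₁ β<0 ∷ descending⇒linked desc

            αs≤0 : ∀ βs → length βs ≡ ℕ.suc m → All (_< 0#) βs → Descending (zigzag βs αs) → All (_≤ 0#) αs
            αs≤0 (β ∷ βs) _ (β<0 ∷ _) desc = All.map proj₁
              (proj₁ (All-zigzag⁻ αs βs (nonPositive (proj₁ β<0) desc)))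

        a-outcome : A-Outcome
        a-outcome with <⊎≈⊎> 0# (p 0)
        ... | inj₁ 0<p₀        = positive-constant-term 0<p₀
        ... | inj₂ (inj₁ 0≈p₀) = zero-constant-term 0≈p₀ n′ ≡.refl
        ... | inj₂ (inj₂ p₀<0) = contradiction 0≤p₀ (<⇒≱ p₀<0)

      strict-case : Outcome n p a b
      strict-case = conclude b-splits
        where
        conclude : Splits n′ b rs → Outcome n p a b
        conclude (c , βs , 0<c , b≋ , len , desc′) =
          𝓘p≪p , proj₁ (a-outcome b-factored desc′) , proj₂ (a-outcome b-factored desc′) ,
          inj₂ (βs , factored⇒nonPositiveZeros b-factored (βs≤0 rs (Factored.length-rs p-factored) rs≤0 desc′))
          where
          b-factored : Factored n′ b βs
          b-factored = factored c 0<c b≋ len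

          βs≤0 : ∀ rs → length rs ≡ n → All (_≤ 0#) rs → Descending (zigzag rs βs) → All (_≤ 0#) βs
          βs≤0 (r ∷ rs) _ (r≤0 ∷ _) desc = All.map proj₁ (proj₁ (All-zigzag⁻ βs rs (nonPositive r≤0 desc)))

    outcome : Outcome n p a b
    outcome with first-only⊎signs 0≤e dominates p≋e p≋ẽ
    ... | inj₁ eⱼ≈0  = first-only eⱼ≈0 (eulerian-roots n′)
    ... | inj₂ signs with p-split signs (eulerian-roots n′) | p 0 ≟ p n
    ...   | split                           | yes p₀≈pₙ = palindromic-case p₀≈pₙ split
    ...   | rs , p-factored , desc , rs≤0 | no  p₀≉pₙ = strict-case p₀≉pₙ signs p-factored desc rs≤0

-- Weighted sums of numerators

module WeightedSums (ℝ : CompleteOrderedField) where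
  open CompleteOrderedField ℝ
  open Polynomials ℝ
  open IntegerSolver ℝ
  open Sums ℝ
  open Eulerian ℝ
  open Numerators ℝ
  open LikelihoodRatio ℝ
  open EulerianCombinations ℝ
  open Sum +-commutativeMonoid using (∑-comm)
  open Sum *-commutativeMonoid using () renaming (sum-permute to ∏-permute)

  -- The defining product ignores the order of its factors. This is the source of the second
  -- expansion of p.
  numerator-opposite : ∀ {n} (r : Fin n → Carrier) h → IsNumerator r h → IsNumerator (r ∘ opposite) h
  numerator-opposite {n} r h (polynomial , numerator) = polynomial , λ j →
    trans (Σ<-cong (ℕ.suc j) (λ i _ → *-congˡ {(linear 1# (- 1#) ^ ℕ.suc n) i} (reversed (j ℕ.∸ i))))
      (numerator j)
    where
    reversed : ∀ m → ∏ (λ i → m · 1# + r (opposite i)) ≈ ∏ (λ i → m · 1# + r i)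
    reversed m = sym (∏-permute (λ i → m · 1# + r i) Permutation.reverse)

  sumWeights : ∀ {n} → ℕ → (ℕ → Carrier) → (ℕ → Fin n → Carrier) → ℕ → Carrier
  sumWeights N c r j = Σ< N (λ k → c k * weights (r k) j)

  sum-combination : ∀ {n} N c (r : ℕ → Fin n → Carrier) (h : ℕ → Series) → (∀ k → IsNumerator (r k) (h k)) →
                    IsCombination n (sumWeights N c r) (λ i → Σ< N (λ k → c k * h k i))
  sum-combination {n} N c r h numerators = combine λ i → begin
    Σ< N (λ k → c k * h k i)
      ≈⟨ Σ<-cong N (λ k _ → *-congˡ {c k} (numerator-eulerian (r k) (h k) (numerators k) i)) ⟩
    Σ< N (λ k → c k * Σ< (ℕ.suc n) (λ j → weights (r k) j * eulerian n j i))
      ≈⟨ Σ<-cong N (λ k _ → *-distribˡ-Σ< (ℕ.suc n) (c k) (λ j → weights (r k) j * eulerian n j i)) ⟩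
    Σ< N (λ k → Σ< (ℕ.suc n) (λ j → c k * (weights (r k) j * eulerian n j i)))
      ≈⟨ ∑-comm {N} {ℕ.suc n} (λ k j → c (toℕ k) * (weights (r (toℕ k)) (toℕ j) * eulerian n (toℕ j) i)) ⟩
    Σ< (ℕ.suc n) (λ j → Σ< N (λ k → c k * (weights (r k) j * eulerian n j i)))
      ≈⟨ Σ<-cong (ℕ.suc n) (λ j _ → factor-out i j) ⟩
    Σ< (ℕ.suc n) (λ j → sumWeights N c r j * eulerian n j i) ∎
    where
    open SetoidReasoning setoid
    factor-out : ∀ i j → Σ< N
      (λ k → c k * (weights (r k) j * eulerian n j i)) ≈ sumWeights N c r j * eulerian n j i
    factor-out i j = begin
      Σ< N (λ k → c k * (weights (r k) j * E))   ≈⟨ Σ<-cong N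
        (λ k _ → solve 3 (λ c w e → c :* (w :* e) := e :* (c :* w)) refl (c k) (weights (r k) j) E) ⟩
      Σ< N (λ k → E * (c k * weights (r k) j))   ≈⟨ *-distribˡ-Σ< N E (λ k → c k * weights (r k) j) ⟨
      E * sumWeights N c r j                     ≈⟨ *-comm E _ ⟩
      sumWeights N c r j * E                     ∎
      where E = eulerian n j i

theorem5p3 :
    (ℝ : CompleteOrderedField) →
    let open CompleteOrderedField ℝ
        open Polynomials ℝ
    in
    (n : ℕ) → .{{_ : NonZero n}} →
    -- ℕ indexes the family of the r k (k ∈ ℕ⁺), shifted by one
    (r : ℕ → Fin n → Carrier) →
    (∀ k i j → i Fin.≤ j → r k i ≤ r k j) →
    (∀ k i → 0# ≤ r k i × r k i ≤ 1#) →
    (h : ℕ → Series) → (∀ k → IsNumerator (r k) (h k)) →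
    (c : ℕ → Carrier) → (∀ k → 0# ≤ c k) →
    (N : ℕ) → (∀ k → N ℕ.≤ k → c k ≈ 0#) →
    (p : Series) → (p ≋ λ j → ∑ {N} λ k → c (toℕ k) * h (toℕ k) j) →
    (a b : Series) → Is𝓘-Decomposition n p a b →
    (∀ k l i → 0# ≤ r k i + r l (opposite i) × r k i + r l (opposite i) ≤ 1#) →
    Degree p n →
    𝓘 n p ≪ p × b ≪ a × AlternatinglyIncreasing n p
theorem5p3 ℝ 0 = contradiction ≡.refl (ℕ.≢-nonZero⁻¹ 0)
theorem5p3 ℝ n@(ℕ.suc _) r _ r∈ h numerators c 0≤c N _ p p≋ a b decomposition r+r≤1 degree =
  let 𝓘p≪p , b≪a , a-zeros , b-zeros = outcome 0≤e dominates p≋e p≋ẽ (proj₁ degree) decomposition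
  in 𝓘p≪p , b≪a , alternatinglyIncreasing decomposition a-zeros b-zeros degree
  where
  open CompleteOrderedField ℝ
  open Polynomials ℝ
  open Sums ℝ
  open Numerators ℝ
  open LikelihoodRatio ℝ
  open EulerianCombinations ℝ
  open Decompositions ℝ
  open Interlacing ℝ
  open WeightedSums ℝ

  -- Reversing the second tuple turns the bound on `r k i + r l (opposite i)` into the positionwise
  -- bound that the induction on the number of factors uses.
  r̃ : ℕ → Fin n → Carrier
  r̃ k = r k ∘ opposite

  e ẽ : ℕ → Carrier
  e = sumWeights N c r
  ẽ = sumWeights N c r̃

  0≤e : ∀ j → 0# ≤ e j
  0≤e j = Σ<-nonNeg N (λ k _ → *-nonNeg (0≤c k) (weights-nonNeg (r k) (r∈ k) j))

  dominates : Dominates n e ẽ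
  dominates = dominates-Σ n N c (λ k → weights (r k)) (λ k → weights (r̃ k)) 0≤c
    (λ k l → weights-dominate (r k) (r̃ l) (r∈ k) (r∈ l ∘ opposite) (λ i → proj₂ (r+r≤1 k l i)))

  ≋-combination : ∀ {e f} → p ≋ f → IsCombination n e f → IsCombination n e p
  ≋-combination p≋f (combine f≋) = combine (λ i → trans (p≋f i) (f≋ i))

  p≋e : IsCombination n e p
  p≋e = ≋-combination p≋ (sum-combination N c r h numerators)

  p≋ẽ : IsCombination n ẽ p
  p≋ẽ = ≋-combination p≋ (sum-combination N c r̃ h (λ k → numerator-opposite (r k) (h k) (numerators k)))
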